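{- Consider the ATP problem with identical request distributions $\mathcal D_1=\dots=\mathcal D_T=\mathcal D$ (of finite support) and initial inventory $B_0\ge 1$. (a) There is an absolute constant $C>0$ such that for every such instance with $B_0\ge 2$ there exists an online algorithm whose expected profit is at least $\left(1-C\,\frac{\log B_0}{\sqrt{B_0}}\right)$ times the expected profit of the optimal offline algorithm. (b) There are absolute constants $c>0$ and $n_0$ such that for every integer $B_0\ge n_0$ there is such an instance with initial inventory $B_0$, whose optimal offline algorithm has positive expected profit $\mathrm{OPT}$, and on which every online algorithm has expected profit at most $\left(1-\frac{c}{\sqrt{B_0}}\right)\mathrm{OPT}$.
   Context: ATP (Asymmetric Trading Prophets) problem. A decision maker interacts with $T$ sequentially arriving requests to trade copies of a product. She has capacity $B\ge 1$ (she may hold at most $B$ copies at any time) and starts with an initial inventory of $B_0\in\{0,\dots,B\}$ copies. It is assumed throughout that $T\ge B_0$ and $B\le B_0+T$. At time $t\in\{1,\dots,T\}$ a price tuple $(b_t,s_t)$ is revealed, with $b_t\in[0,+\infty]$ (the cost of buying a copy; $b_t=+\infty$ means buying is impossible) and $s_t\in[0,\infty)$ (the revenue from selling a copy); $(b_t,s_t)$ is drawn from a known distribution $\mathcal D_t$, independently across $t$, while $b_t$ and $s_t$ may be arbitrarily correlated with each other. At time $t$ she takes exactly one action: Buy one copy at price $b_t$ (allowed if she holds at most $B-1$ copies), Sell one copy at price $s_t$ (allowed if she holds at least one copy), or Skip. Profit is total revenue from sales minus total cost of purchases. An online algorithm (possibly randomized) chooses its action at time $t$ knowing only the distributions, the tuples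 revealed up to and including time $t$, and its past actions. The optimal offline algorithm knows all realized tuples in advance and attains the maximum possible profit for each realization; its expected profit is the expectation of this maximum. -}

module Defs where

open import Algebra.Bundles using (CommutativeRing)
open import Algebra.Structures using (IsCommutativeRing)
open import Data.Fin.Base using (Fin)
open import Data.List.Base using (List; []; _∷_; cartesianProductWith; filter; map)
open import Data.Nat.Base as ℕ using (ℕ; zero; suc)
import Data.Nat.Properties as ℕ
open import Data.Product.Base using (Σ; _×_; _,_; proj₁; proj₂)
open import Data.Sum.Base using (inj₁; inj₂)
open import Data.Unit.Base using (⊤; tt)
open import Data.Vec.Base using (Vec; []; _∷_; replicate)
open import Level using (0ℓ)
open import Relation.Binary.Bundles using (DecTotalOrder)
open import Relation.Binary.PropositionalEquality
open import Relation.Binary.Structures using (IsDecTotalOrder)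
open import Relation.Nullary.Construct.Add.Supremum using (_⁺; ⊤⁺; [_])
open import Relation.Nullary.Decidable using (Dec; yes; no; _×-dec_)
open import Relation.Unary using (Pred)
import Relation.Binary.Construct.Add.Supremum.NonStrict as AddSupremum
import Relation.Binary.Construct.NonStrictToStrict as NonStrictToStrict

-- The real numbers, axiomatised as a Dedekind-complete ordered field; these
-- axioms determine ℝ up to unique isomorphism.  As in classical mathematics
-- the order is decidable.  The inverse is total, with no constraint on 0# ⁻¹.

record Reals : Set₁ where
  infixl 6 _+_
  infixl 7 _*_ _/_
  infix  8 -_
  infix  9 _⁻¹
  infix  4 _≤_ _<_
  field
    Carrier : Set
    _+_ _*_ : Carrier → Carrier → Carrier
    -_ _⁻¹  : Carrier → Carrier
    0# 1#   : Carrier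
    _≤_     : Carrier → Carrier → Set

    isCommutativeRing : IsCommutativeRing _≡_ _+_ _*_ -_ 0# 1#
    isDecTotalOrder   : IsDecTotalOrder _≡_ _≤_

    0≢1      : 0# ≢ 1#
    inverseʳ : ∀ x → x ≢ 0# → x * x ⁻¹ ≡ 1#
    +-monoʳ-≤ : ∀ z {x y} → x ≤ y → z + x ≤ z + y
    *-nonNeg  : ∀ {x y} → 0# ≤ x → 0# ≤ y → 0# ≤ x * y

  UpperBound : Pred Carrier 0ℓ → Carrier → Set
  UpperBound P u = ∀ x → P x → x ≤ u

  IsSupremum : Pred Carrier 0ℓ → Carrier → Set
  IsSupremum P s = UpperBound P s × (∀ u → UpperBound P u → s ≤ u)

  field
    supremum : (P : Pred Carrier 0ℓ) → Σ Carrier P → Σ Carrier (UpperBound P) →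
               Σ Carrier (IsSupremum P)

  _<_ : Carrier → Carrier → Set
  _<_ = NonStrictToStrict._<_ _≡_ _≤_

  commutativeRing : CommutativeRing 0ℓ 0ℓ
  commutativeRing = record { isCommutativeRing = isCommutativeRing }

  decTotalOrder : DecTotalOrder 0ℓ 0ℓ 0ℓ
  decTotalOrder = record { isDecTotalOrder = isDecTotalOrder }

  open CommutativeRing commutativeRing public using (_-_; semiring; ring)
  open DecTotalOrder decTotalOrder public using (totalOrder)

  _/_ : Carrier → Carrier → Carrier
  x / y = x * y ⁻¹

module RealFunctions (ℛ : Reals) where
  open Reals ℛ
  open import Algebra.Properties.Semiring.Exp semiring using (_^_)
  open import Algebra.Properties.Semiring.Mult semiring using () renaming (_×_ to _·_)
  open import Algebra.Properties.Ring ring using (-‿distribˡ-*; -‿involutive)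
  open CommutativeRing commutativeRing
    using (+-assoc; +-comm; +-identityˡ; +-identityʳ; -‿inverseʳ; -‿inverseˡ
          ; *-identityˡ; *-identityʳ; zeroˡ; zeroʳ; distribˡ)
  private module ≤ = IsDecTotalOrder isDecTotalOrder

  fromℕ : ℕ → Carrier
  fromℕ n = n · 1#

  0≤1 : 0# ≤ 1#
  0≤1 with ≤.total 0# 1#
  ... | inj₁ 0≤1 = 0≤1
  ... | inj₂ 1≤0 = subst (0# ≤_) -1*-1≡1 (*-nonNeg 0≤-1 0≤-1)
    where
    0≤-1 : 0# ≤ - 1#
    0≤-1 = subst₂ _≤_ (-‿inverseˡ 1#) (+-identityʳ (- 1#)) (+-monoʳ-≤ (- 1#) 1≤0)
    -1*-1≡1 : - 1# * - 1# ≡ 1#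
    -1*-1≡1 = trans (sym (-‿distribˡ-* 1# (- 1#)))
                (trans (cong -_ (*-identityˡ (- 1#))) (-‿involutive 1#))

  x≤1+x : ∀ x → x ≤ 1# + x
  x≤1+x x = subst₂ _≤_ (+-identityʳ x) (+-comm x 1#) (+-monoʳ-≤ x 0≤1)

  0≤fromℕ : ∀ n → 0# ≤ fromℕ n
  0≤fromℕ zero    = ≤.refl
  0≤fromℕ (suc n) = ≤.trans (0≤fromℕ n) (x≤1+x (fromℕ n))

  1≤x⇒x≤x*x : ∀ {x} → 1# ≤ x → x ≤ x * x
  1≤x⇒x≤x*x {x} 1≤x = subst₂ _≤_ (+-identityʳ x) eq (+-monoʳ-≤ x (*-nonNeg 0≤x 0≤y))
    where
    y : Carrier
    y = - 1# + x
    0≤x : 0# ≤ x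
    0≤x = ≤.trans 0≤1 1≤x
    0≤y : 0# ≤ y
    0≤y = subst (_≤ y) (-‿inverseˡ 1#) (+-monoʳ-≤ (- 1#) 1≤x)
    eq : x + x * y ≡ x * x
    eq = trans (cong (_+ x * y) (sym (*-identityʳ x)))
         (trans (sym (distribˡ x 1# y))
         (cong (x *_) (trans (sym (+-assoc 1# (- 1#) x))
         (trans (cong (_+ x) (-‿inverseʳ 1#)) (+-identityˡ x)))))

  square-bound : ∀ n → UpperBound (λ y → y * y ≤ fromℕ n) (fromℕ (suc n))
  square-bound n y y²≤n with ≤.total y 1#
  ... | inj₁ y≤1 = ≤.trans y≤1
                     (subst (_≤ fromℕ (suc n)) (+-identityʳ 1#) (+-monoʳ-≤ 1# (0≤fromℕ n)))
  ... | inj₂ 1≤y = ≤.trans (1≤x⇒x≤x*x 1≤y) (≤.trans y²≤n (x≤1+x (fromℕ n)))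

  √ : ℕ → Carrier
  √ n = proj₁ (supremum (λ y → y * y ≤ fromℕ n)
                 (0# , subst (_≤ fromℕ n) (sym (zeroˡ 0#)) (0≤fromℕ n))
                 (fromℕ (suc n) , square-bound n))

  -- For x ≥ 0 the sequence (1 + x/N)^N increases to eˣ, so this says eˣ ≤ y.
  Exp≤ : Carrier → Carrier → Set
  Exp≤ x y = ∀ N → (1# + x / fromℕ (suc N)) ^ suc N ≤ y

  1^n≡1 : ∀ n → 1# ^ n ≡ 1#
  1^n≡1 zero    = refl
  1^n≡1 (suc n) = trans (*-identityˡ (1# ^ n)) (1^n≡1 n)

  Exp≤-0 : ∀ n → Exp≤ 0# (fromℕ (suc n))
  Exp≤-0 n N = subst (_≤ fromℕ (suc n))
    (sym (trans (cong (_^ suc N) (trans (cong (1# +_) (zeroˡ _)) (+-identityʳ 1#)))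
                (1^n≡1 (suc N))))
    (subst (_≤ fromℕ (suc n)) (+-identityʳ 1#) (+-monoʳ-≤ 1# (0≤fromℕ n)))

  Exp≤-bound : ∀ y → UpperBound (λ x → 0# ≤ x × Exp≤ x y) y
  Exp≤-bound y x (_ , eˣ≤y) = ≤.trans (x≤1+x x) (subst (_≤ y) eq (eˣ≤y 0))
    where
    1⁻¹≡1 : fromℕ 1 ⁻¹ ≡ 1#
    1⁻¹≡1 = trans (cong _⁻¹ (+-identityʳ 1#))
            (trans (sym (*-identityˡ (1# ⁻¹))) (inverseʳ 1# (λ 1≡0 → 0≢1 (sym 1≡0))))
    eq : (1# + x / fromℕ 1) ^ 1 ≡ 1# + x
    eq = trans (*-identityʳ _)
           (cong (1# +_) (trans (cong (x *_) 1⁻¹≡1) (*-identityʳ x)))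

  -- Natural logarithm: the largest x ≥ 0 with eˣ ≤ n (log 0 is a junk value).
  log : ℕ → Carrier
  log zero    = 0#
  log (suc n) = proj₁ (supremum (λ x → 0# ≤ x × Exp≤ x (fromℕ (suc n)))
                         (0# , ≤.refl , Exp≤-0 n)
                         (fromℕ (suc n) , Exp≤-bound (fromℕ (suc n))))

module ATP (ℛ : Reals) where
  open Reals ℛ
  open RealFunctions ℛ public using (√; log)
  open AddSupremum _≤_ using (_≤⁺_)
  open import Algebra.Properties.Semiring.Sum semiring using (sum)
  open import Data.List.Extrema totalOrder using (max)

  -- Finitely supported distributions; the same outcome may be listed several
  -- times, its probability being the total of the listed ones.
  record FinDist (A : Set) : Set where
    field
      size     : ℕ
      outcome  : Fin size → A
      prob     : Fin size → Carrier
      prob≥0   : ∀ i → 0# ≤ prob i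
      sum-prob : sum prob ≡ 1#

  open FinDist public

  𝔼 : {A : Set} → FinDist A → (A → Carrier) → Carrier
  𝔼 D f = sum (λ i → prob D i * f (outcome D i))

  𝔼-iid : {A : Set} (n : ℕ) → FinDist A → (Vec A n → Carrier) → Carrier
  𝔼-iid zero    D f = f []
  𝔼-iid (suc n) D f = 𝔼 D (λ x → 𝔼-iid n D (λ xs → f (x ∷ xs)))

  record Request : Set where
    constructor ⟨_,_⟩
    field
      buyPrice  : Carrier ⁺
      sellPrice : Carrier

  open Request public

  record Instance (B₀ : ℕ) : Set where
    field
      B T         : ℕ
      𝒟           : FinDist Request
      1≤B₀        : 1 ℕ.≤ B₀
      B₀≤B        : B₀ ℕ.≤ B
      B₀≤T        : B₀ ℕ.≤ T
      B≤B₀+T      : B ℕ.≤ B₀ ℕ.+ T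
      buyPrice≥0  : ∀ i → [ 0# ] ≤⁺ buyPrice (outcome 𝒟 i)
      sellPrice≥0 : ∀ i → 0# ≤ sellPrice (outcome 𝒟 i)

  data Action : Set where
    buy sell skip : Action

  -- Buying at price +∞ is never allowed, so its value here is irrelevant.
  cost : Carrier ⁺ → Carrier
  cost [ b ] = b
  cost ⊤⁺    = 0#

  gain : Request → Action → Carrier
  gain r buy  = - cost (buyPrice r)
  gain r sell = sellPrice r
  gain r skip = 0#

  stock : Action → ℕ → ℕ
  stock buy  k = suc k
  stock sell k = ℕ.pred k
  stock skip k = k

  Finite : Carrier ⁺ → Set
  Finite b = b ≢ ⊤⁺

  -- Allowed B k r a: with capacity B and k copies in stock, a may be played on r.
  Allowed : ℕ → ℕ → Request → Action → Set
  Allowed B k r buy  = k ℕ.< B × Finite (buyPrice r)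
  Allowed B k r sell = 1 ℕ.≤ k
  Allowed B k r skip = ⊤

  finite? : ∀ b → Dec (Finite b)
  finite? ⊤⁺    = no (λ ∞≢∞ → ∞≢∞ refl)
  finite? [ b ] = yes (λ ())

  allowed? : ∀ B k r a → Dec (Allowed B k r a)
  allowed? B k r buy  = (k ℕ.<? B) ×-dec finite? (buyPrice r)
  allowed? B k r sell = 1 ℕ.≤? k
  allowed? B k r skip = yes tt

  Feasible : ∀ {n} → ℕ → ℕ → Vec Request n → Vec Action n → Set
  Feasible B k []       []       = ⊤
  Feasible B k (r ∷ rs) (a ∷ as) = Allowed B k r a × Feasible B (stock a k) rs as

  feasible? : ∀ {n} B k (rs : Vec Request n) as → Dec (Feasible B k rs as)
  feasible? B k []       []       = yes tt
  feasible? B k (r ∷ rs) (a ∷ as) = allowed? B k r a ×-dec feasible? B (stock a k) rs as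

  profit : ∀ {n} → Vec Request n → Vec Action n → Carrier
  profit []       []       = 0#
  profit (r ∷ rs) (a ∷ as) = gain r a + profit rs as

  actionSequences : ∀ n → List (Vec Action n)
  actionSequences zero    = [] ∷ []
  actionSequences (suc n) =
    cartesianProductWith _∷_ (buy ∷ sell ∷ skip ∷ []) (actionSequences n)

  -- `max` needs a default to cover empty lists; skipping throughout is feasible.
  maxProfit : ∀ {n} → ℕ → ℕ → Vec Request n → Carrier
  maxProfit {n} B k rs =
    max (profit rs (replicate n skip))
        (map (profit rs) (filter (feasible? B k rs) (actionSequences n)))

  offlineProfit : ∀ {B₀} → Instance B₀ → Carrier
  offlineProfit {B₀} I = 𝔼-iid T 𝒟 (maxProfit B B₀)
    where open Instance I

  -- Past requests together with the actions taken on them, most recent first.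
  History : Set
  History = List (Request × Action)

  stockAfter : ℕ → History → ℕ
  stockAfter B₀ []            = B₀
  stockAfter B₀ ((r , a) ∷ h) = stock a (stockAfter B₀ h)

  -- A randomized online algorithm is given by the conditional distribution of
  -- its action given the past requests and actions and the current request.
  record OnlineAlgorithm {B₀ : ℕ} (I : Instance B₀) : Set where
    open Instance I
    field
      policy  : History → Request → FinDist Action
      allowed : ∀ h r i → 0# < prob (policy h r) i →
                Allowed B (stockAfter B₀ h) r (outcome (policy h r) i)

  module _ {B₀ : ℕ} (I : Instance B₀) (A : OnlineAlgorithm I) where
    open Instance I
    open OnlineAlgorithm A

    expectedProfitFrom : History → ℕ → Carrier
    expectedProfitFrom h zero    = 0#
    expectedProfitFrom h (suc n) =
      𝔼 𝒟 (λ r → 𝔼 (policy h r) (λ a → gain r a + expectedProfitFrom ((r , a) ∷ h) n))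

    onlineProfit : Carrier
    onlineProfit = expectedProfitFrom [] T

{-# OPTIONS --safe #-}
module Submission where

-- (a) Averaging the offline optimum over the horizon gives rates of selling and buying, as functions of
-- the current request, whose profit per step is OPT/T and whose net sales over T steps are at most B₀.
-- Discarding purchases in excess of sales, and all purchases if they cost more on average than a sale
-- brings, does not lower this profit.  Online, reserve K = ⌊√B₀⌋ copies for trading: in that account sales
-- and purchases have equal rates, so its stock is a driftless walk on {0,…,K}, blocked a fraction 1/(K+1)
-- of the time.  The other B₀ - K copies are liquidated by sale attempts whose mean number is at most
-- B₀ - 2K, so running out of them costs a fraction 1/K by Chebyshev.  The optimal dynamic program does
-- at least as well as this rule, hence attains (1 - 3/K) OPT, even without the logarithm.
--
-- (b) Take b = ∞, T = 2n, B = B₀ = n and prices 2, 0, 1 with probabilities h, h, m where m ≈ 1/(16√n).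
-- The offline optimum sells a medium item iff there are fewer than n high ones, up to the number of
-- medium ones.  While at least n requests remain both alternatives keep constant probability, because
-- the difference of the numbers of high and low requests has standard deviation of order √n
-- (Paley–Zygmund).  So each of the first n/64 requests costs any online algorithm order m, in total order √n.

open import Defs
import Algebra.Construct.NaturalChoice.Max as Max
import Algebra.Properties.Ring as RingProperties
import Algebra.Properties.Semiring.Mult as SemiringMult
import Algebra.Properties.Semiring.Sum as SemiringSum
import Algebra.Solver.Ring as RingSolver
import Data.Integer.Properties as ℤ
import Data.List.Extrema as Extrema
import Data.Nat.DivMod as ℕ
import Data.Nat.Properties as ℕ
import Relation.Binary.Construct.Add.Supremum.NonStrict as AddSupremum
open import Algebra.Bundles using (CommutativeRing; RawRing)
open import Algebra.Solver.Ring.AlmostCommutativeRing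
  using (fromCommutativeRing; _-Raw-AlmostCommutative⟶_)
open import Data.Bool.Base using (Bool; true; false; if_then_else_)
open import Data.Fin.Base as Fin using (Fin)
open import Data.Integer.Base as ℤ using (ℤ; _⊖_) renaming (+_ to pos; -[1+_] to negsuc)
open import Data.List.Base as List using (List; []; _∷_; length)
open import Data.List.Membership.Propositional using (_∈_)
open import Data.List.Membership.Propositional.Properties
  using (∈-cartesianProductWith⁺; ∈-filter⁺; ∈-filter⁻; ∈-map⁺; ∈-map⁻)
open import Data.List.Relation.Unary.All as All using ()
open import Data.List.Relation.Unary.Any using (here; there)
open import Data.Maybe.Base as Maybe using (Maybe)
open import Data.Nat.Base as ℕ using (ℕ; zero; suc)
open import Data.Product.Base using (Σ; Σ-syntax; _×_; _,_; proj₁; proj₂)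
open import Data.Sum.Base using (_⊎_; inj₁; inj₂)
open import Data.Unit.Base using (tt)
open import Data.Vec.Base as Vec using (Vec; []; _∷_; replicate)
open import Relation.Binary.PropositionalEquality hiding (J)
open import Relation.Binary.Structures using (IsDecTotalOrder)
open import Relation.Nullary.Construct.Add.Supremum using (_⁺; ⊤⁺; [_])
open import Relation.Nullary.Decidable using (Dec; yes; no; dec⇒maybe)
open import Relation.Nullary.Negation using (¬_; contradiction)


-- The probabilistic estimates are backward inductions on the number of remaining requests: an
-- explicit function of the state satisfies a one-step inequality, which is a polynomial identity
-- with a nonnegative remainder. A quadratic potential replaces the stationary law of the walk, a
-- quadratic lower bound on expected sales replaces Chebyshev, and a combination of second and
-- fourth moments replaces Paley-Zygmund. In (a) the function is compared directly with the value of
-- the dynamic program, so the randomised rule itself never has to be run. The obstacle in (b) is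
-- that an online player may steer her stock so that one of the two errors on a medium request
-- becomes unlikely. High and low requests have a forced best action, so she steers only through the
-- medium ones; with m of order 1/√n these displace the stock by O(√n) over n requests, which stays
-- within the random fluctuation. The prices 2, 1, 0 make both errors cost exactly 1.

-- Ordered-field arithmetic and a ring solver with integer constants.

module OrderedField (ℛ : Reals) where
  open Reals ℛ public
  open RealFunctions ℛ public using (fromℕ; 0≤1; 0≤fromℕ; x≤1+x)
  open CommutativeRing commutativeRing public
    using (+-assoc; +-comm; +-identityˡ; +-identityʳ; -‿inverseʳ; -‿inverseˡ
          ; *-assoc; *-comm; *-identityˡ; *-identityʳ; zeroˡ; zeroʳ; distribˡ; distribʳ)
  private
    module R = RingProperties ring
    module M = SemiringMult semiring
    module ≤ = IsDecTotalOrder isDecTotalOrder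

  open IsDecTotalOrder isDecTotalOrder public
    using () renaming (refl to ≤-refl; reflexive to ≤-reflexive; trans to ≤-trans
                      ; antisym to ≤-antisym; total to ≤-total; _≤?_ to infix 4 _≤?_; _≟_ to infix 4 _≟_)

  fromℕ-+ : ∀ m n → fromℕ (m ℕ.+ n) ≡ fromℕ m + fromℕ n
  fromℕ-+ = M.×-homo-+ 1#

  fromℕ-* : ∀ m n → fromℕ (m ℕ.* n) ≡ fromℕ m * fromℕ n
  fromℕ-* = M.×1-homo-*

  fromℕ-1 : fromℕ 1 ≡ 1#
  fromℕ-1 = +-identityʳ 1#

  -- The clause for 1 makes the solver's constant 1 denote 1# rather than 1# + 0#.
  fromℤ : ℤ → Carrier
  fromℤ (pos 1)    = 1#
  fromℤ (pos n)    = fromℕ n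
  fromℤ (negsuc n) = - fromℕ (suc n)

  private
    fromℤ-pos : ∀ n → fromℤ (pos n) ≡ fromℕ n
    fromℤ-pos 0             = refl
    fromℤ-pos 1             = sym fromℕ-1
    fromℤ-pos (suc (suc n)) = refl

    1+x-[1+y] : ∀ x y → x - y ≡ (1# + x) - (1# + y)
    1+x-[1+y] x y = sym (begin
      (1# + x) + - (1# + y)      ≡⟨ cong (λ t → 1# + x + t) (sym (R.-‿+-comm 1# y)) ⟩
      (1# + x) + (- 1# + - y)    ≡⟨ cong (_+ (- 1# + - y)) (+-comm 1# x) ⟩
      (x + 1#) + (- 1# + - y)    ≡⟨ sym (+-assoc (x + 1#) (- 1#) (- y)) ⟩
      ((x + 1#) + - 1#) + - y    ≡⟨ cong (_+ - y) (+-assoc x 1# (- 1#)) ⟩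
      (x + (1# + - 1#)) + - y    ≡⟨ cong (λ t → x + t + - y) (-‿inverseʳ 1#) ⟩
      (x + 0#) + - y             ≡⟨ cong (_+ - y) (+-identityʳ x) ⟩
      x + - y                    ∎)
      where open ≡-Reasoning

    fromℤ-⊖ : ∀ m n → fromℤ (m ⊖ n) ≡ fromℕ m - fromℕ n
    fromℤ-⊖ m       zero    = trans (fromℤ-pos m) (sym (trans (cong (fromℕ m +_) R.-0#≈0#) (+-identityʳ _)))
    fromℤ-⊖ zero    (suc n) = sym (+-identityˡ _)
    fromℤ-⊖ (suc m) (suc n) = trans (cong fromℤ (ℤ.[1+m]⊖[1+n]≡m⊖n m n))
      (trans (fromℤ-⊖ m n) (1+x-[1+y] (fromℕ m) (fromℕ n)))

    fromℤ-neg : ∀ i → fromℤ (ℤ.- i) ≡ - fromℤ i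
    fromℤ-neg (pos 0)             = sym R.-0#≈0#
    fromℤ-neg (pos 1)             = cong -_ fromℕ-1
    fromℤ-neg (pos (suc (suc n))) = refl
    fromℤ-neg (negsuc n)          = trans (fromℤ-pos (suc n)) (sym (R.-‿involutive _))

    fromℤ-+ : ∀ i j → fromℤ (i ℤ.+ j) ≡ fromℤ i + fromℤ j
    fromℤ-+ (pos m)    (pos n)    = trans (fromℤ-pos (m ℕ.+ n)) (trans (fromℕ-+ m n)
      (sym (cong₂ _+_ (fromℤ-pos m) (fromℤ-pos n))))
    fromℤ-+ (pos m)    (negsuc n) = trans (fromℤ-⊖ m (suc n)) (cong (_- _) (sym (fromℤ-pos m)))
    fromℤ-+ (negsuc m) (pos n)    = trans (fromℤ-⊖ n (suc m))
      (trans (cong (_- _) (sym (fromℤ-pos n))) (+-comm _ _))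
    fromℤ-+ (negsuc m) (negsuc n) = trans (cong (λ k → - fromℕ (suc k)) (sym (ℕ.+-suc m n)))
      (trans (cong -_ (fromℕ-+ (suc m) (suc n))) (sym (R.-‿+-comm _ _)))

    fromℤ-pos*pos : ∀ m n → fromℤ (pos m ℤ.* pos n) ≡ fromℤ (pos m) * fromℤ (pos n)
    fromℤ-pos*pos m n = trans (cong fromℤ (sym (ℤ.pos-* m n))) (trans (fromℤ-pos (m ℕ.* n))
      (trans (fromℕ-* m n) (sym (cong₂ _*_ (fromℤ-pos m) (fromℤ-pos n)))))

    fromℤ-pos*negsuc : ∀ m n → fromℤ (pos m ℤ.* negsuc n) ≡ fromℤ (pos m) * fromℤ (negsuc n)
    fromℤ-pos*negsuc m n = trans (cong fromℤ (sym (ℤ.neg-distribʳ-* (pos m) (pos (suc n)))))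
      (trans (fromℤ-neg (pos m ℤ.* pos (suc n))) (trans (cong -_ (trans (fromℤ-pos*pos m (suc n))
        (cong (fromℤ (pos m) *_) (fromℤ-pos (suc n))))) (R.-‿distribʳ-* _ _)))

    fromℤ-* : ∀ i j → fromℤ (i ℤ.* j) ≡ fromℤ i * fromℤ j
    fromℤ-* (pos m)    (pos n)    = fromℤ-pos*pos m n
    fromℤ-* (pos m)    (negsuc n) = fromℤ-pos*negsuc m n
    fromℤ-* (negsuc m) (pos n)    = trans (cong fromℤ (ℤ.*-comm (negsuc m) (pos n)))
      (trans (fromℤ-pos*negsuc n m) (*-comm _ _))
    fromℤ-* (negsuc m) (negsuc n) = trans (fromℤ-pos (suc m ℕ.* suc n)) (trans (fromℕ-* (suc m) (suc n))
      (sym (trans (sym (R.-‿distribˡ-* _ _)) (trans (cong -_ (sym (R.-‿distribʳ-* _ _))) (R.-‿involutive _)))))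

  private
    ℤ-rawRing : RawRing _ _
    ℤ-rawRing = record { Carrier = ℤ ; _≈_ = _≡_ ; _+_ = ℤ._+_ ; _*_ = ℤ._*_ ; -_ = ℤ.-_ ; 0# = pos 0 ; 1# = pos 1 }

    fromℤ-morphism : ℤ-rawRing -Raw-AlmostCommutative⟶ fromCommutativeRing commutativeRing
    fromℤ-morphism = record
      { ⟦_⟧ = fromℤ ; +-homo = fromℤ-+ ; *-homo = fromℤ-* ; -‿homo = fromℤ-neg
      ; 0-homo = refl ; 1-homo = refl }

    fromℤ-≟ : ∀ i j → Maybe (fromℤ i ≡ fromℤ j)
    fromℤ-≟ i j = Maybe.map (cong fromℤ) (dec⇒maybe (i ℤ.≟ j))

  open RingSolver ℤ-rawRing (fromCommutativeRing commutativeRing) fromℤ-morphism fromℤ-≟ public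
    using (solve; _:=_; _:+_; _:*_; _:-_; :-_; con; Polynomial)

  :0 :1 : ∀ {n} → Polynomial n
  :0 = con (pos 0)
  :1 = con (pos 1)

  :ℕ : ∀ {n} → ℕ → Polynomial n
  :ℕ k = con (pos k)

  _≰_ : Carrier → Carrier → Set
  x ≰ y = ¬ x ≤ y

  ≰⇒≥ : ∀ {x y} → x ≰ y → y ≤ x
  ≰⇒≥ {x} {y} x≰y with ≤-total x y
  ... | inj₁ x≤y = contradiction x≤y x≰y
  ... | inj₂ y≤x = y≤x

  ≰⇒> : ∀ {x y} → x ≰ y → y < x
  ≰⇒> x≰y = ≰⇒≥ x≰y , λ y≡x → x≰y (≤-reflexive (sym y≡x))

  <⇒≤ : ∀ {x y} → x < y → x ≤ y
  <⇒≤ = proj₁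

  <⇒≱ : ∀ {x y} → x < y → y ≰ x
  <⇒≱ (x≤y , x≢y) y≤x = x≢y (≤-antisym x≤y y≤x)

  <-≤-trans : ∀ {x y z} → x < y → y ≤ z → x < z
  <-≤-trans (x≤y , x≢y) y≤z = ≤-trans x≤y y≤z , λ { refl → x≢y (≤-antisym x≤y y≤z) }

  infix 4 _≤-via_
  -- Certificate form of an inequality: the gap `d` is given as a visibly nonnegative expression,
  -- and a polynomial identity is left to the ring solver. Most estimates below have this shape.
  _≤-via_ : ∀ {x y d} → 0# ≤ d → y ≡ x + d → x ≤ y
  _≤-via_ {x} 0≤d y≡x+d = subst₂ _≤_ (+-identityʳ x) (sym y≡x+d) (+-monoʳ-≤ x 0≤d)

  0≤y-x : ∀ {x y} → x ≤ y → 0# ≤ y - x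
  0≤y-x {x} {y} x≤y = subst₂ _≤_ (-‿inverseˡ x) (+-comm (- x) y) (+-monoʳ-≤ (- x) x≤y)

  +-nonNeg : ∀ {x y} → 0# ≤ x → 0# ≤ y → 0# ≤ x + y
  +-nonNeg {x} {y} 0≤x 0≤y = ≤-trans 0≤x (subst (_≤ x + y) (+-identityʳ x) (+-monoʳ-≤ x 0≤y))

  +-mono-≤ : ∀ {x y u v} → x ≤ y → u ≤ v → x + u ≤ y + v
  +-mono-≤ {x} {y} {u} {v} x≤y u≤v = +-nonNeg (0≤y-x x≤y) (0≤y-x u≤v)
    ≤-via solve 4 (λ x y u v → y :+ v := (x :+ u) :+ ((y :- x) :+ (v :- u))) refl x y u v

  *-monoˡ-≤ : ∀ {c x y} → 0# ≤ c → x ≤ y → c * x ≤ c * y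
  *-monoˡ-≤ {c} {x} {y} 0≤c x≤y = *-nonNeg 0≤c (0≤y-x x≤y)
    ≤-via solve 3 (λ c x y → c :* y := c :* x :+ c :* (y :- x)) refl c x y

  *-mono-≤ : ∀ {x y u v} → 0# ≤ x → 0# ≤ v → x ≤ y → u ≤ v → x * u ≤ y * v
  *-mono-≤ {x} {y} {u} {v} 0≤x 0≤v x≤y u≤v = ≤-trans (*-monoˡ-≤ 0≤x u≤v)
    (subst₂ _≤_ (*-comm v x) (*-comm v y) (*-monoˡ-≤ 0≤v x≤y))

  -‿nonNeg : ∀ {x} → x ≤ 0# → 0# ≤ - x
  -‿nonNeg {x} x≤0 = subst (0# ≤_) (+-identityˡ (- x)) (0≤y-x x≤0)

  square-nonNeg : ∀ x → 0# ≤ x * x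
  square-nonNeg x with ≤-total 0# x
  ... | inj₁ 0≤x = *-nonNeg 0≤x 0≤x
  ... | inj₂ x≤0 = subst (0# ≤_) (solve 1 (λ x → (:- x) :* (:- x) := x :* x) refl x)
                     (*-nonNeg (-‿nonNeg x≤0) (-‿nonNeg x≤0))

  0<1 : 0# < 1#
  0<1 = 0≤1 , 0≢1

  fromℕ-mono : ∀ {m n} → m ℕ.≤ n → fromℕ m ≤ fromℕ n
  fromℕ-mono {m} {n} m≤n = 0≤fromℕ (n ℕ.∸ m)
    ≤-via trans (cong fromℕ (sym (ℕ.m+[n∸m]≡n m≤n))) (fromℕ-+ m (n ℕ.∸ m))

  0<fromℕ : ∀ n → 0# < fromℕ (suc n)
  0<fromℕ n = <-≤-trans 0<1 (subst (_≤ fromℕ (suc n)) fromℕ-1 (fromℕ-mono {1} {suc n} (ℕ.s≤s ℕ.z≤n)))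

  1≤fromℕ : ∀ n → 1# ≤ fromℕ (suc n)
  1≤fromℕ n = subst (_≤ fromℕ (suc n)) fromℕ-1 (fromℕ-mono {1} {suc n} (ℕ.s≤s ℕ.z≤n))

  >⇒≢0 : ∀ {x} → 0# < x → x ≢ 0#
  >⇒≢0 (_ , 0≢x) x≡0 = 0≢x (sym x≡0)

  *-inverse : ∀ {x} → 0# < x → x * x ⁻¹ ≡ 1#
  *-inverse 0<x = inverseʳ _ (>⇒≢0 0<x)

  ⁻¹-nonNeg : ∀ {x} → 0# < x → 0# ≤ x ⁻¹
  ⁻¹-nonNeg {x} 0<x with ≤-total 0# (x ⁻¹)
  ... | inj₁ 0≤x⁻¹ = 0≤x⁻¹
  ... | inj₂ x⁻¹≤0 = contradiction 1≤0 (<⇒≱ 0<1)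
    where
    1≤0 : 1# ≤ 0#
    1≤0 = *-nonNeg (<⇒≤ 0<x) (-‿nonNeg x⁻¹≤0) ≤-via trans
      (solve 1 (λ u → :0 := u :- u) refl 1#)
      (trans (cong (λ t → 1# - t) (sym (*-inverse 0<x)))
        (solve 2 (λ x y → :1 :- x :* y := :1 :+ x :* (:- y)) refl x (x ⁻¹)))

  ⁻¹-pos : ∀ {x} → 0# < x → 0# < x ⁻¹
  ⁻¹-pos {x} 0<x = ⁻¹-nonNeg 0<x , λ 0≡x⁻¹ → 0≢1 (trans (sym (zeroʳ x))
    (trans (cong (x *_) 0≡x⁻¹) (*-inverse 0<x)))

  *-cancelˡ-≤ : ∀ {c x y} → 0# < c → c * x ≤ c * y → x ≤ y
  *-cancelˡ-≤ {c} {x} {y} 0<c cx≤cy = subst₂ _≤_ (eq x) (eq y) (*-monoˡ-≤ (⁻¹-nonNeg 0<c) cx≤cy)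
    where
    eq : ∀ z → c ⁻¹ * (c * z) ≡ z
    eq z = trans (solve 3 (λ c i z → i :* (c :* z) := (c :* i) :* z) refl c (c ⁻¹) z)
      (trans (cong (_* z) (*-inverse 0<c)) (*-identityˡ z))

  *-pos : ∀ {x y} → 0# < x → 0# < y → 0# < x * y
  *-pos {x} {y} 0<x 0<y = ≰⇒> λ xy≤0 → <⇒≱ 0<y
    (*-cancelˡ-≤ 0<x (subst (x * y ≤_) (sym (zeroʳ x)) xy≤0))

-- Square roots and logarithms of natural numbers.

module SquareRootLogarithm (ℛ : Reals) where
  open OrderedField ℛ
  open RealFunctions ℛ using (√; log; Exp≤)
  open import Algebra.Properties.Semiring.Exp semiring using (_^_)

  y²≤n⇒y≤√n : ∀ {n y} → y * y ≤ fromℕ n → y ≤ √ n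
  y²≤n⇒y≤√n = proj₁ (proj₂ (supremum _ _ _)) _

  √-least : ∀ {n u} → (∀ y → y * y ≤ fromℕ n → y ≤ u) → √ n ≤ u
  √-least = proj₂ (proj₂ (supremum _ _ _)) _

  integer-√ : ∀ n → Σ ℕ λ k → k ℕ.* k ℕ.≤ n × n ℕ.< suc k ℕ.* suc k
  integer-√ zero = 0 , ℕ.z≤n , ℕ.s≤s ℕ.z≤n
  integer-√ (suc n) with integer-√ n
  ... | k , k²≤n , n<[1+k]² with suc k ℕ.* suc k ℕ.≤? suc n
  ...   | yes [1+k]²≤1+n = suc k , [1+k]²≤1+n , ℕ.≤-<-trans n<[1+k]² (ℕ.*-mono-< (ℕ.n<1+n (suc k)) (ℕ.n<1+n (suc k)))
  ...   | no  [1+k]²≰1+n = k , ℕ.m≤n⇒m≤1+n k²≤n , ℕ.≰⇒> [1+k]²≰1+n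

  k≤√n : ∀ {k n} → k ℕ.* k ℕ.≤ n → fromℕ k ≤ √ n
  k≤√n {k} {n} k²≤n = y²≤n⇒y≤√n {n} (subst (_≤ fromℕ n) (fromℕ-* k k) (fromℕ-mono k²≤n))

  √n≤k : ∀ {k n} → n ℕ.< k ℕ.* k → √ n ≤ fromℕ k
  √n≤k {k} {n} n<k² = √-least {n} bound
    where
    bound : ∀ y → y * y ≤ fromℕ n → y ≤ fromℕ k
    bound y y²≤n with y ≤? fromℕ k
    ... | yes y≤k = y≤k
    ... | no  y≰k = contradiction
      (≤-trans (fromℕ-mono n<k²) (≤-trans (≤-reflexive (fromℕ-* k k))
        (≤-trans (*-mono-≤ (0≤fromℕ k) (≤-trans (0≤fromℕ k) k≤y) k≤y k≤y) y²≤n)))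
      (<⇒≱ (x≤1+x (fromℕ n) , λ n≡1+n → 0≢1 (
        trans (solve 1 (λ a → :0 := a :- a) refl (fromℕ n))
        (trans (cong (_- fromℕ n) n≡1+n) (solve 1 (λ a → (:1 :+ a) :- a := :1) refl (fromℕ n))))))
      where
      k≤y : fromℕ k ≤ y
      k≤y = ≰⇒≥ y≰k

  -- A finite form of exp x ≤ 1/(1 - x). The induction rests on (1+t)(1-(j+1)t) = 1 - jt - (j+1)t²;
  -- as a product, the bound requires no sign for 1 - jt.
  [1+t]ʲ[1-jt]≤1 : ∀ {t} → 0# ≤ t → ∀ j → (1# + t) ^ j * (1# - fromℕ j * t) ≤ 1#
  [1+t]ʲ[1-jt]≤1 {t} 0≤t zero = ≤-reflexive (solve 1 (λ t → :1 :* (:1 :- :0 :* t) := :1) refl t)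
  [1+t]ʲ[1-jt]≤1 {t} 0≤t (suc j) = ≤-trans
    (*-nonNeg (pow-nonNeg j) (*-nonNeg (0≤fromℕ (suc j)) (*-nonNeg 0≤t 0≤t))
      ≤-via solve 3 (λ t p j → p :* (:1 :- j :* t)
          := ((:1 :+ t) :* p) :* (:1 :- (:1 :+ j) :* t) :+ p :* ((:1 :+ j) :* (t :* t)))
        refl t ((1# + t) ^ j) (fromℕ j))
    ([1+t]ʲ[1-jt]≤1 0≤t j)
    where
    pow-nonNeg : ∀ j → 0# ≤ (1# + t) ^ j
    pow-nonNeg zero    = 0≤1
    pow-nonNeg (suc j) = *-nonNeg (+-nonNeg 0≤1 0≤t) (pow-nonNeg j)

  ½ : Carrier
  ½ = fromℕ 2 ⁻¹

  -- With jt = ½ the previous bound reads (1+t)^j ≤ 2, that is √e ≤ 2. A positive constant below the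
  -- logarithm is enough, since the loss obtained is of order 1/√B₀.
  ½≤log : ∀ {n} → 2 ℕ.≤ n → ½ ≤ log n
  ½≤log {suc n} 2≤n = proj₁ (proj₂ (supremum _ _ _)) ½ (⁻¹-nonNeg (0<fromℕ 1) , e^½≤n)
    where
    e^½≤n : Exp≤ ½ (fromℕ (suc n))
    e^½≤n N = ≤-trans (subst₂ _≤_
        (trans (*-comm _ _) (trans (*-assoc p ½ (fromℕ 2)) (trans (cong (p *_) (trans (*-comm _ _) (*-inverse (0<fromℕ 1)))) (*-identityʳ p))))
        (*-identityʳ (fromℕ 2))
        (*-monoˡ-≤ (0≤fromℕ 2) (subst (λ x → p * x ≤ 1#) 1-jt≡½ ([1+t]ʲ[1-jt]≤1 0≤t (suc N)))))
      (fromℕ-mono 2≤n)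
      where
      t p : Carrier
      t = ½ / fromℕ (suc N)
      p = (1# + t) ^ suc N
      0≤t : 0# ≤ t
      0≤t = *-nonNeg (⁻¹-nonNeg (0<fromℕ 1)) (⁻¹-nonNeg (0<fromℕ N))
      1-jt≡½ : 1# - fromℕ (suc N) * t ≡ ½
      1-jt≡½ = trans (solve 3 (λ a b h → :1 :- a :* (h :* b) := :1 :- h :* (a :* b)) refl (fromℕ (suc N)) (fromℕ (suc N) ⁻¹) ½)
        (trans (cong (λ u → 1# - ½ * u) (*-inverse (0<fromℕ N)))
        (trans (cong (λ u → u - ½ * 1#) (sym (*-inverse (0<fromℕ 1))))
        (solve 1 (λ h → :ℕ 2 :* h :- h :* :1 := h) refl ½)))

-- Expectations over finite distributions and i.i.d. sequences.

module Expectation (ℛ : Reals) where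
  open OrderedField ℛ
  open ATP ℛ using (FinDist; size; outcome; prob; prob≥0; sum-prob; 𝔼; 𝔼-iid)
  open SemiringSum semiring using (sum; sum-cong-≗; ∑-distrib-+; *-distribˡ-sum; *-distribʳ-sum; ∑-comm)

  sum-mono : ∀ {n} {f g : Fin n → Carrier} → (∀ i → f i ≤ g i) → sum f ≤ sum g
  sum-mono {zero}  f≤g = ≤-refl
  sum-mono {suc n} f≤g = +-mono-≤ (f≤g Fin.zero) (sum-mono (λ i → f≤g (Fin.suc i)))

  private variable
    A A′ : Set

  𝔼-cong : ∀ (D : FinDist A) {f g : A → Carrier} → (∀ x → f x ≡ g x) → 𝔼 D f ≡ 𝔼 D g
  𝔼-cong D f≡g = sum-cong-≗ (λ i → cong (prob D i *_) (f≡g (outcome D i)))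

  𝔼-+ : ∀ (D : FinDist A) (f g : A → Carrier) → 𝔼 D (λ x → f x + g x) ≡ 𝔼 D f + 𝔼 D g
  𝔼-+ D f g = trans (sum-cong-≗ (λ i → distribˡ (prob D i) (f (outcome D i)) (g (outcome D i))))
    (∑-distrib-+ (λ i → prob D i * f (outcome D i)) (λ i → prob D i * g (outcome D i)))

  𝔼-* : ∀ (D : FinDist A) c (f : A → Carrier) → 𝔼 D (λ x → c * f x) ≡ c * 𝔼 D f
  𝔼-* D c f = trans
    (sum-cong-≗ (λ i → solve 3 (λ p c x → p :* (c :* x) := c :* (p :* x)) refl (prob D i) c (f (outcome D i))))
    (sym (*-distribˡ-sum c (λ i → prob D i * f (outcome D i))))

  𝔼-const : ∀ (D : FinDist A) c → 𝔼 D (λ _ → c) ≡ c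
  𝔼-const D c = trans (sym (*-distribʳ-sum c (prob D))) (trans (cong (_* c) (sum-prob D)) (*-identityˡ c))

  -- Outcomes of probability zero may violate the bound.
  𝔼-≤-const : ∀ (D : FinDist A) (f : A → Carrier) c →
              (∀ i → 0# < prob D i → f (outcome D i) ≤ c) → 𝔼 D f ≤ c
  𝔼-≤-const D f c f≤c = subst (𝔼 D f ≤_) (𝔼-const D c) (sum-mono bound)
    where
    bound : ∀ i → prob D i * f (outcome D i) ≤ prob D i * c
    bound i with 0# ≟ prob D i
    ... | yes 0≡p = ≤-reflexive (trans (cong (_* f (outcome D i)) (sym 0≡p))
                      (trans (zeroˡ _) (trans (sym (zeroˡ c)) (cong (_* c) 0≡p))))
    ... | no  0≢p = *-monoˡ-≤ (prob≥0 D i) (f≤c i (prob≥0 D i , 0≢p))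

  𝔼-mono : ∀ (D : FinDist A) (f g : A → Carrier) → (∀ i → f (outcome D i) ≤ g (outcome D i)) → 𝔼 D f ≤ 𝔼 D g
  𝔼-mono D f g f≤g = sum-mono (λ i → *-monoˡ-≤ (prob≥0 D i) (f≤g i))

  𝔼-nonNeg : ∀ (D : FinDist A) (f : A → Carrier) → (∀ i → 0# ≤ f (outcome D i)) → 0# ≤ 𝔼 D f
  𝔼-nonNeg D f 0≤f = subst (_≤ 𝔼 D f) (𝔼-const D 0#) (𝔼-mono D (λ _ → 0#) f 0≤f)

  𝔼-swap : ∀ (D : FinDist A) (D′ : FinDist A′) (f : A → A′ → Carrier) →
           𝔼 D (λ x → 𝔼 D′ (f x)) ≡ 𝔼 D′ (λ y → 𝔼 D (λ x → f x y))
  𝔼-swap D D′ f = trans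
    (sum-cong-≗ (λ i → *-distribˡ-sum (prob D i) (λ j → prob D′ j * f (outcome D i) (outcome D′ j))))
    (trans (∑-comm (λ i j → prob D i * (prob D′ j * f (outcome D i) (outcome D′ j))))
    (sum-cong-≗ (λ j → trans
      (sum-cong-≗ (λ i → solve 3 (λ p q x → p :* (q :* x) := q :* (p :* x)) refl
        (prob D i) (prob D′ j) (f (outcome D i) (outcome D′ j))))
      (sym (*-distribˡ-sum (prob D′ j) (λ i → prob D i * f (outcome D i) (outcome D′ j)))))))

  𝔼-iid-cong : ∀ n (D : FinDist A) {f g : Vec A n → Carrier} → (∀ xs → f xs ≡ g xs) → 𝔼-iid n D f ≡ 𝔼-iid n D g
  𝔼-iid-cong zero    D f≡g = f≡g []
  𝔼-iid-cong (suc n) D f≡g = 𝔼-cong D (λ x → 𝔼-iid-cong n D (λ xs → f≡g (x ∷ xs)))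

  𝔼-iid-mono : ∀ n (D : FinDist A) (f g : Vec A n → Carrier) → (∀ xs → f xs ≤ g xs) → 𝔼-iid n D f ≤ 𝔼-iid n D g
  𝔼-iid-mono zero    D f g f≤g = f≤g []
  𝔼-iid-mono (suc n) D f g f≤g = 𝔼-mono D (λ x → 𝔼-iid n D (λ xs → f (x ∷ xs))) (λ x → 𝔼-iid n D (λ xs → g (x ∷ xs))) (λ i → 𝔼-iid-mono n D _ _ (λ xs → f≤g (outcome D i ∷ xs)))

  𝔼-iid-+ : ∀ n (D : FinDist A) (f g : Vec A n → Carrier) →
            𝔼-iid n D (λ xs → f xs + g xs) ≡ 𝔼-iid n D f + 𝔼-iid n D g
  𝔼-iid-+ zero    D f g = refl
  𝔼-iid-+ (suc n) D f g = trans (𝔼-cong D (λ x → 𝔼-iid-+ n D (λ xs → f (x ∷ xs)) (λ xs → g (x ∷ xs))))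
    (𝔼-+ D (λ x → 𝔼-iid n D (λ xs → f (x ∷ xs))) (λ x → 𝔼-iid n D (λ xs → g (x ∷ xs))))

  𝔼-iid-* : ∀ n (D : FinDist A) c (f : Vec A n → Carrier) → 𝔼-iid n D (λ xs → c * f xs) ≡ c * 𝔼-iid n D f
  𝔼-iid-* zero    D c f = refl
  𝔼-iid-* (suc n) D c f = trans (𝔼-cong D (λ x → 𝔼-iid-* n D c (λ xs → f (x ∷ xs)))) (𝔼-* D c (λ x → 𝔼-iid n D (λ xs → f (x ∷ xs))))

  𝔼-iid-const : ∀ n (D : FinDist A) c → 𝔼-iid n D (λ _ → c) ≡ c
  𝔼-iid-const zero    D c = refl
  𝔼-iid-const (suc n) D c = trans (𝔼-cong D (λ _ → 𝔼-iid-const n D c)) (𝔼-const D c)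

  mapDist : (A → A′) → FinDist A → FinDist A′
  mapDist g D = record
    { size = size D ; outcome = λ i → g (outcome D i) ; prob = prob D ; prob≥0 = prob≥0 D ; sum-prob = sum-prob D }

  𝔼-iid-map : ∀ n (g : A → A′) (D : FinDist A) (f : Vec A′ n → Carrier) →
              𝔼-iid n (mapDist g D) f ≡ 𝔼-iid n D (λ xs → f (Vec.map g xs))
  𝔼-iid-map zero    g D f = refl
  𝔼-iid-map (suc n) g D f = 𝔼-cong D (λ x → 𝔼-iid-map n g D (λ ys → f (g x ∷ ys)))

-- The offline optimum as an attained maximum.

module Offline (ℛ : Reals) where
  open OrderedField ℛ
  open ATP ℛ
  open Extrema totalOrder using (max; argmax-sel; xs≤max)

  ∈-actions : ∀ a → a ∈ buy ∷ sell ∷ skip ∷ []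
  ∈-actions buy  = here refl
  ∈-actions sell = there (here refl)
  ∈-actions skip = there (there (here refl))

  ∈-actionSequences : ∀ {n} (as : Vec Action n) → as ∈ actionSequences n
  ∈-actionSequences []       = here refl
  ∈-actionSequences (a ∷ as) = ∈-cartesianProductWith⁺ _∷_ (∈-actions a) (∈-actionSequences as)

  skip-feasible : ∀ {n} B k (rs : Vec Request n) → Feasible B k rs (replicate n skip)
  skip-feasible B k []       = tt
  skip-feasible B k (r ∷ rs) = tt , skip-feasible B k rs

  maxProfit-upper : ∀ {n} B k (rs : Vec Request n) as → Feasible B k rs as → profit rs as ≤ maxProfit B k rs
  maxProfit-upper B k rs as f = All.lookup (xs≤max _ _)
    (∈-map⁺ (profit rs) (∈-filter⁺ (feasible? B k rs) (∈-actionSequences as) f))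

  maxProfit-attained : ∀ {n} B k (rs : Vec Request n) →
    Σ (Vec Action n) λ as → Feasible B k rs as × maxProfit B k rs ≡ profit rs as
  maxProfit-attained {n} B k rs
    with argmax-sel (λ p → p) (profit rs (replicate n skip)) (List.map (profit rs) (List.filter (feasible? B k rs) (actionSequences n)))
  ... | inj₁ eq = replicate n skip , skip-feasible B k rs , eq
  ... | inj₂ m∈ with ∈-map⁻ (profit rs) m∈
  ...   | as , as∈ , eq = as , proj₂ (∈-filter⁻ (feasible? B k rs) {xs = actionSequences n} as∈) , eq

  maxProfit-∷ : ∀ {n} B k r (rs : Vec Request n) a → Allowed B k r a →
                gain r a + maxProfit B (stock a k) rs ≤ maxProfit B k (r ∷ rs)
  maxProfit-∷ B k r rs a ok with maxProfit-attained B (stock a k) rs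
  ... | as , f , eq = subst (λ p → gain r a + p ≤ maxProfit B k (r ∷ rs)) (sym eq)
    (maxProfit-upper B k (r ∷ rs) (a ∷ as) (ok , f))

  maxProfit-nonNeg : ∀ {n} B k (rs : Vec Request n) → 0# ≤ maxProfit B k rs
  maxProfit-nonNeg {zero}  B k []       = maxProfit-upper B k [] [] tt
  maxProfit-nonNeg {suc n} B k (r ∷ rs) = ≤-trans (maxProfit-nonNeg B k rs)
    (subst (_≤ maxProfit B k (r ∷ rs)) (+-identityˡ _) (maxProfit-∷ B k r rs skip tt))

-- The optimal online dynamic program.

module Greedy (ℛ : Reals) where
  open OrderedField ℛ
  open ATP ℛ
  open Expectation ℛ

  point : Action → FinDist Action
  point a = record { size = 1 ; outcome = λ _ → a ; prob = λ _ → 1# ; prob≥0 = λ _ → 0≤1 ; sum-prob = +-identityʳ 1# }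

  𝔼-point : ∀ a f → 𝔼 (point a) f ≡ f a
  𝔼-point a f = trans (+-identityʳ _) (*-identityˡ _)

  module _ (w : Action → Carrier) {P : Action → Set} (P? : ∀ a → Dec (P a)) where
    improve : ∀ a → P a → ∀ a′ → Σ Action λ b → P b × w a ≤ w b × (P a′ → w a′ ≤ w b)
    improve a pa a′ with P? a′ | ≤-total (w a) (w a′)
    ... | no ¬pa′ | _          = a , pa , ≤-refl , λ pa′ → contradiction pa′ ¬pa′
    ... | yes pa′ | inj₁ wa≤wa′ = a′ , pa′ , wa≤wa′ , λ _ → ≤-refl
    ... | yes pa′ | inj₂ wa′≤wa = a , pa , ≤-refl , λ _ → wa′≤wa

    abstract
      bestAction : P skip → Σ Action λ a → P a × (∀ a′ → P a′ → w a′ ≤ w a)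
      bestAction ok with improve skip ok sell
      ... | b , pb , skip≤b , sell≤b with improve b pb buy
      ...   | c , pc , b≤c , buy≤c = c , pc , λ
        { buy pa → buy≤c pa ; sell pa → ≤-trans (sell≤b pa) b≤c ; skip _ → ≤-trans skip≤b b≤c }

  module _ {B₀ : ℕ} (I : Instance B₀) where
    open Instance I

    V : ℕ → ℕ → Carrier
    greedy : ∀ n k r → Σ Action λ a → Allowed B k r a ×
      (∀ a′ → Allowed B k r a′ → gain r a′ + V n (stock a′ k) ≤ gain r a + V n (stock a k))
    V zero    k = 0#
    V (suc n) k = 𝔼 𝒟 (λ r → gain r (proj₁ (greedy n k r)) + V n (stock (proj₁ (greedy n k r)) k))
    greedy n k r = bestAction (λ a → gain r a + V n (stock a k)) (allowed? B k r) tt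

    greedyValue : ℕ → ℕ → Request → Carrier
    greedyValue n k r = gain r (proj₁ (greedy n k r)) + V n (stock (proj₁ (greedy n k r)) k)

    greedyValue-≥ : ∀ n k r a → Allowed B k r a → gain r a + V n (stock a k) ≤ greedyValue n k r
    greedyValue-≥ n k r = proj₂ (proj₂ (greedy n k r))

    V-nonNeg : ∀ n k → 0# ≤ V n k
    V-nonNeg zero    k = ≤-refl
    V-nonNeg (suc n) k = 𝔼-nonNeg 𝒟 (greedyValue n k) λ i → ≤-trans (V-nonNeg n k)
      (subst (_≤ greedyValue n k (outcome 𝒟 i)) (+-identityˡ (V n k)) (greedyValue-≥ n k (outcome 𝒟 i) skip tt))

    greedyAlgorithm : OnlineAlgorithm I
    greedyAlgorithm = record
      -- The length of the history determines the time: `T ∸ suc (length h)` requests follow the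
      -- current one.
      { policy  = λ h r → point (proj₁ (greedy (T ℕ.∸ suc (length h)) (stockAfter B₀ h) r))
      ; allowed = λ h r _ _ → proj₁ (proj₂ (greedy (T ℕ.∸ suc (length h)) (stockAfter B₀ h) r)) }

    expectedProfitFrom-greedy : ∀ h n → length h ℕ.+ n ≡ T →
      expectedProfitFrom I greedyAlgorithm h n ≡ V n (stockAfter B₀ h)
    expectedProfitFrom-greedy h zero    _  = refl
    expectedProfitFrom-greedy h (suc n) eq = 𝔼-cong 𝒟 λ r → trans
      (𝔼-point (proj₁ (greedy (T ℕ.∸ suc (length h)) k r)) (λ a → gain r a + expectedProfitFrom I greedyAlgorithm ((r , a) ∷ h) n))
      (trans (cong (λ m → gain r (proj₁ (greedy m k r)) + expectedProfitFrom I greedyAlgorithm ((r , proj₁ (greedy m k r)) ∷ h) n) remaining)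
      (cong (gain r (proj₁ (greedy n k r)) +_) (expectedProfitFrom-greedy ((r , proj₁ (greedy n k r)) ∷ h) n eq′)))
      where
      k = stockAfter B₀ h
      eq′ : suc (length h) ℕ.+ n ≡ T
      eq′ = trans (sym (ℕ.+-suc (length h) n)) eq
      remaining : T ℕ.∸ suc (length h) ≡ n
      remaining = trans (cong (ℕ._∸ suc (length h)) (sym eq′)) (ℕ.m+n∸m≡n (suc (length h)) n)

    onlineProfit-greedy : onlineProfit I greedyAlgorithm ≡ V T B₀
    onlineProfit-greedy = expectedProfitFrom-greedy [] T refl

-- Averaging an offline strategy over the horizon.

module Frequencies (ℛ : Reals) where
  open OrderedField ℛ
  open ATP ℛ
  open Expectation ℛ

  ∑ₐ : (Action → Carrier) → Carrier
  ∑ₐ f = f buy + f sell + f skip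

  hit : Action → Action → Carrier
  hit buy  buy  = 1#
  hit sell sell = 1#
  hit skip skip = 1#
  hit _    _    = 0#

  ∑ₐ-hit : ∀ (f : Action → Carrier) a → ∑ₐ (λ a′ → f a′ * hit a a′) ≡ f a
  ∑ₐ-hit f buy  = solve 3 (λ x y z → x :* :1 :+ y :* :0 :+ z :* :0 := x) refl (f buy) (f sell) (f skip)
  ∑ₐ-hit f sell = solve 3 (λ x y z → x :* :0 :+ y :* :1 :+ z :* :0 := y) refl (f buy) (f sell) (f skip)
  ∑ₐ-hit f skip = solve 3 (λ x y z → x :* :0 :+ y :* :0 :+ z :* :1 := z) refl (f buy) (f sell) (f skip)

  hit-nonNeg : ∀ a a′ → 0# ≤ hit a a′
  hit-nonNeg buy  buy  = 0≤1
  hit-nonNeg sell sell = 0≤1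
  hit-nonNeg skip skip = 0≤1
  hit-nonNeg buy  sell = ≤-refl
  hit-nonNeg buy  skip = ≤-refl
  hit-nonNeg sell buy  = ≤-refl
  hit-nonNeg sell skip = ≤-refl
  hit-nonNeg skip buy  = ≤-refl
  hit-nonNeg skip sell = ≤-refl

  total : ∀ {n} → (Request → Action → Carrier) → Vec Request n → Vec Action n → Carrier
  total w []       []       = 0#
  total w (r ∷ rs) (a ∷ as) = w r a + total w rs as

  profit≡total : ∀ {n} (rs : Vec Request n) as → profit rs as ≡ total gain rs as
  profit≡total []       []       = refl
  profit≡total (r ∷ rs) (a ∷ as) = cong (gain r a +_) (profit≡total rs as)

  total-∷ : ∀ {n} w r (rs : Vec Request n) as → total w (r ∷ rs) as ≡ w r (Vec.head as) + total w rs (Vec.tail as)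
  total-∷ w r rs (a ∷ as) = refl

  module _ (D : FinDist Request) where
    -- frequency F r a is the sum over t of ℙ(F plays a at time t | the request at time t is r).
    frequency : ∀ {n} → (Vec Request n → Vec Action n) → Request → Action → Carrier
    frequency {zero}  F r a = 0#
    frequency {suc n} F r a = 𝔼-iid n D (λ rs → hit (Vec.head (F (r ∷ rs))) a)
                            + 𝔼 D (λ r′ → frequency (λ rs → Vec.tail (F (r′ ∷ rs))) r a)

    frequency-nonNeg : ∀ {n} (F : Vec Request n → Vec Action n) r a → 0# ≤ frequency F r a
    frequency-nonNeg {zero}  F r a = ≤-refl
    frequency-nonNeg {suc n} F r a = +-nonNeg
      (subst (_≤ 𝔼-iid n D (λ rs → hit (Vec.head (F (r ∷ rs))) a)) (𝔼-iid-const n D 0#)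
        (𝔼-iid-mono n D (λ _ → 0#) (λ rs → hit (Vec.head (F (r ∷ rs))) a) (λ rs → hit-nonNeg (Vec.head (F (r ∷ rs))) a)))
      (𝔼-nonNeg D (λ r′ → frequency (λ rs → Vec.tail (F (r′ ∷ rs))) r a) (λ i → frequency-nonNeg (λ rs → Vec.tail (F (outcome D i ∷ rs))) r a))

    ∑ₐ-* : ∀ (f : Action → Carrier) (g h : Action → Carrier) →
           ∑ₐ (λ a → f a * (g a + h a)) ≡ ∑ₐ (λ a → f a * g a) + ∑ₐ (λ a → f a * h a)
    ∑ₐ-* f g h = solve 9 (λ a b c x y z u v w → a :* (x :+ u) :+ b :* (y :+ v) :+ c :* (z :+ w)
        := (a :* x :+ b :* y :+ c :* z) :+ (a :* u :+ b :* v :+ c :* w)) refl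
      (f buy) (f sell) (f skip) (g buy) (g sell) (g skip) (h buy) (h sell) (h skip)

    𝔼-∑ₐ : ∀ {A : Set} (D : FinDist A) (f : Action → Carrier) (g : A → Action → Carrier) →
           𝔼 D (λ x → ∑ₐ (λ a → f a * g x a)) ≡ ∑ₐ (λ a → f a * 𝔼 D (λ x → g x a))
    𝔼-∑ₐ D f g = trans (𝔼-+ D (λ x → f buy * g x buy + f sell * g x sell) (λ x → f skip * g x skip))
      (cong₂ _+_ (trans (𝔼-+ D (λ x → f buy * g x buy) (λ x → f sell * g x sell))
        (cong₂ _+_ (𝔼-* D (f buy) (λ x → g x buy)) (𝔼-* D (f sell) (λ x → g x sell)))) (𝔼-* D (f skip) (λ x → g x skip)))

    𝔼-iid-∑ₐ : ∀ n (f : Action → Carrier) (g : Vec Request n → Action → Carrier) →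
           𝔼-iid n D (λ x → ∑ₐ (λ a → f a * g x a)) ≡ ∑ₐ (λ a → f a * 𝔼-iid n D (λ x → g x a))
    𝔼-iid-∑ₐ n f g = trans (𝔼-iid-+ n D (λ x → f buy * g x buy + f sell * g x sell) (λ x → f skip * g x skip))
      (cong₂ _+_ (trans (𝔼-iid-+ n D (λ x → f buy * g x buy) (λ x → f sell * g x sell))
        (cong₂ _+_ (𝔼-iid-* n D (f buy) (λ x → g x buy)) (𝔼-iid-* n D (f sell) (λ x → g x sell)))) (𝔼-iid-* n D (f skip) (λ x → g x skip)))

    -- The request at time t is independent of the others, so conditioning on it separates the
    -- weight `w r a` from the probability of playing `a`; identical distributions allow all times
    -- to be added up into one function of `r`. Profit and net sales are both totals of this kind.
    𝔼-total : ∀ {n} w (F : Vec Request n → Vec Action n) →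
      𝔼-iid n D (λ rs → total w rs (F rs)) ≡ 𝔼 D (λ r → ∑ₐ (λ a → w r a * frequency F r a))
    𝔼-total {zero} w F = trans (total-[] (F [])) (sym (trans
        (𝔼-cong D (λ r → solve 3 (λ x y z → x :* :0 :+ y :* :0 :+ z :* :0 := :0) refl (w r buy) (w r sell) (w r skip)))
        (𝔼-const D 0#)))
      where
      total-[] : ∀ as → total w [] as ≡ 0#
      total-[] [] = refl
    𝔼-total {suc n} w F = begin
      𝔼 D (λ r → 𝔼-iid n D (λ rs → total w (r ∷ rs) (F (r ∷ rs))))
        ≡⟨ 𝔼-cong D (λ r → trans (𝔼-iid-cong n D (λ rs → total-∷ w r rs (F (r ∷ rs))))
             (trans (𝔼-iid-+ n D (λ rs → w r (Vec.head (F (r ∷ rs)))) (λ rs → total w rs (Vec.tail (F (r ∷ rs)))))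
             (cong₂ _+_ (firstStep r) (𝔼-total w (λ rs → Vec.tail (F (r ∷ rs))))))) ⟩
      𝔼 D (λ r → ∑ₐ (λ a → w r a * first r a) + 𝔼 D (λ r′ → ∑ₐ (λ a → w r′ a * later r r′ a)))
        ≡⟨ 𝔼-+ D (λ r → ∑ₐ (λ a → w r a * first r a)) (λ r → 𝔼 D (λ r′ → ∑ₐ (λ a → w r′ a * later r r′ a))) ⟩
      𝔼 D (λ r → ∑ₐ (λ a → w r a * first r a)) + 𝔼 D (λ r → 𝔼 D (λ r′ → ∑ₐ (λ a → w r′ a * later r r′ a)))
        ≡⟨ cong (𝔼 D (λ r → ∑ₐ (λ a → w r a * first r a)) +_) (trans (𝔼-swap D D (λ r r′ → ∑ₐ (λ a → w r′ a * later r r′ a)))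
             (𝔼-cong D (λ r′ → 𝔼-∑ₐ D (w r′) (λ r a → later r r′ a)))) ⟩
      𝔼 D (λ r → ∑ₐ (λ a → w r a * first r a)) + 𝔼 D (λ r′ → ∑ₐ (λ a → w r′ a * 𝔼 D (λ r → later r r′ a)))
        ≡⟨ sym (𝔼-+ D (λ r → ∑ₐ (λ a → w r a * first r a)) (λ r′ → ∑ₐ (λ a → w r′ a * 𝔼 D (λ r → later r r′ a)))) ⟩
      𝔼 D (λ r → ∑ₐ (λ a → w r a * first r a) + ∑ₐ (λ a → w r a * 𝔼 D (λ r′ → later r′ r a)))
        ≡⟨ 𝔼-cong D (λ r → sym (∑ₐ-* (w r) (first r) (λ a → 𝔼 D (λ r′ → later r′ r a)))) ⟩
      𝔼 D (λ r → ∑ₐ (λ a → w r a * frequency F r a)) ∎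
      where
      open ≡-Reasoning
      first : Request → Action → Carrier
      first r a = 𝔼-iid n D (λ rs → hit (Vec.head (F (r ∷ rs))) a)
      later : Request → Request → Action → Carrier
      later r′ r a = frequency (λ rs → Vec.tail (F (r′ ∷ rs))) r a
      firstStep : ∀ r → 𝔼-iid n D (λ rs → w r (Vec.head (F (r ∷ rs)))) ≡ ∑ₐ (λ a → w r a * first r a)
      firstStep r = trans (𝔼-iid-cong n D (λ rs → sym (∑ₐ-hit (w r) (Vec.head (F (r ∷ rs))))))
        (𝔼-iid-∑ₐ n (w r) (λ rs → hit (Vec.head (F (r ∷ rs)))))

    ∑ₐ-frequency : ∀ {n} (F : Vec Request n → Vec Action n) r → ∑ₐ (λ a → 1# * frequency F r a) ≡ fromℕ n
    ∑ₐ-frequency {zero}  F r = solve 0 (:1 :* :0 :+ :1 :* :0 :+ :1 :* :0 := :0) refl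
    ∑ₐ-frequency {suc n} F r = trans (∑ₐ-* (λ _ → 1#) (λ a → 𝔼-iid n D (λ rs → hit (Vec.head (F (r ∷ rs))) a))
        (λ a → 𝔼 D (λ r′ → frequency (λ rs → Vec.tail (F (r′ ∷ rs))) r a)))
      (cong₂ _+_
        (trans (sym (𝔼-iid-∑ₐ n (λ _ → 1#) (λ rs → hit (Vec.head (F (r ∷ rs))))))
          (trans (𝔼-iid-cong n D (λ rs → ∑ₐ-hit (λ _ → 1#) (Vec.head (F (r ∷ rs))))) (𝔼-iid-const n D 1#)))
        (trans (sym (𝔼-∑ₐ D (λ _ → 1#) (λ r′ → frequency (λ rs → Vec.tail (F (r′ ∷ rs))) r)))
          (trans (𝔼-cong D (λ r′ → ∑ₐ-frequency (λ rs → Vec.tail (F (r′ ∷ rs))) r)) (𝔼-const D (fromℕ n)))))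

-- Binomial demand against a limited stock.

module Liquidation (ℛ : Reals) where
  open OrderedField ℛ

  -- The expected number of sales when each of n requests independently triggers an attempt
  -- with probability d and ℓ copies are available.
  sales : Carrier → ℕ → ℕ → Carrier
  sales d zero    ℓ       = 0#
  sales d (suc n) zero    = 0#
  sales d (suc n) (suc ℓ) = d * (1# + sales d n ℓ) + (1# - d) * sales d n (suc ℓ)

  -- E min(S, ℓ) ≥ E[S] - κ E(S - ℓ + c)² for S binomial, since S - min(S, ℓ) ≤ κ (S - ℓ + c)² when κ c ≥ 1.
  sales-lower : ∀ {d κ c} → 0# ≤ d → d ≤ 1# → 0# ≤ κ → 0# ≤ c → 1# ≤ κ * c → ∀ n ℓ →
    fromℕ n * d - κ * ((fromℕ n * d - fromℕ ℓ + c) * (fromℕ n * d - fromℕ ℓ + c) + fromℕ n * d) ≤ sales d n ℓ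
  sales-lower {d} {κ} {c} 0≤d d≤1 0≤κ 0≤c 1≤κc zero ℓ = *-nonNeg 0≤κ (square-nonNeg (c - fromℕ ℓ))
    ≤-via solve 4 (λ d κ c ℓ → :0 := (:0 :* d :- κ :* ((:0 :* d :- ℓ :+ c) :* (:0 :* d :- ℓ :+ c) :+ :0 :* d)) :+ κ :* ((c :- ℓ) :* (c :- ℓ)))
      refl d κ c (fromℕ ℓ)
  -- Without stock the bound has to be nonpositive: for u the mean demand it equals -κ(u-c)² -
  -- u(4κc-1) - κu.
  sales-lower {d} {κ} {c} 0≤d d≤1 0≤κ 0≤c 1≤κc (suc n) zero =
    +-nonNeg (*-nonNeg 0≤κ (square-nonNeg (u - c))) (+-nonNeg (*-nonNeg 0≤u (+-nonNeg (0≤y-x 1≤κc) (+-nonNeg 0≤κc (+-nonNeg 0≤κc 0≤κc)))) (*-nonNeg 0≤κ 0≤u))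
    ≤-via solve 3 (λ u κ c → :0 := (u :- κ :* ((u :- :0 :+ c) :* (u :- :0 :+ c) :+ u))
        :+ (κ :* ((u :- c) :* (u :- c)) :+ (u :* ((κ :* c :- :1) :+ (κ :* c :+ (κ :* c :+ κ :* c))) :+ κ :* u)))
      refl u κ c
    where
    u : Carrier
    u = fromℕ (suc n) * d
    0≤u : 0# ≤ u
    0≤u = *-nonNeg (0≤fromℕ (suc n)) 0≤d
    0≤κc : 0# ≤ κ * c
    0≤κc = *-nonNeg 0≤κ 0≤c
  sales-lower {d} {κ} {c} 0≤d d≤1 0≤κ 0≤c 1≤κc (suc n) (suc ℓ) = ≤-trans
    -- The variance nd(1-d) was rounded up to nd; this leaves the remainder κd².
    (*-nonNeg 0≤κ (*-nonNeg 0≤d 0≤d) ≤-via solve 5 (λ d κ c n ℓ →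
        d :* (:1 :+ (n :* d :- κ :* ((n :* d :- ℓ :+ c) :* (n :* d :- ℓ :+ c) :+ n :* d)))
          :+ (:1 :- d) :* (n :* d :- κ :* ((n :* d :- (:1 :+ ℓ) :+ c) :* (n :* d :- (:1 :+ ℓ) :+ c) :+ n :* d))
        := ((:1 :+ n) :* d :- κ :* (((:1 :+ n) :* d :- (:1 :+ ℓ) :+ c) :* ((:1 :+ n) :* d :- (:1 :+ ℓ) :+ c) :+ (:1 :+ n) :* d))
          :+ κ :* (d :* d)) refl d κ c (fromℕ n) (fromℕ ℓ))
    (+-mono-≤
      (*-monoˡ-≤ 0≤d (+-monoʳ-≤ 1# (sales-lower 0≤d d≤1 0≤κ 0≤c 1≤κc n ℓ)))
      (*-monoˡ-≤ (0≤y-x d≤1) (sales-lower 0≤d d≤1 0≤κ 0≤c 1≤κc n (suc ℓ))))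

-- The liquidation and trading accounts and their potential.

module TwoAccounts (ℛ : Reals) where
  open OrderedField ℛ
  open ATP ℛ
  open Expectation ℛ
  open Greedy ℛ
  open Liquidation ℛ

  -- Rates at which a stationary randomised rule sells from the liquidation account (α), sells from
  -- the trading account (ξ) and buys into the trading account (υ); σ and β are mean prices.
  record Rule {B₀ : ℕ} (I : Instance B₀) : Set where
    open Instance I
    field
      α ξ υ : Request → Carrier
      σ β d q : Carrier
      α≥0 : ∀ r → 0# ≤ α r
      ξ≥0 : ∀ r → 0# ≤ ξ r
      υ≥0 : ∀ r → 0# ≤ υ r
      α+ξ+υ≤1 : ∀ r → α r + ξ r + υ r ≤ 1#
      υ-finite : ∀ r → ¬ Finite (buyPrice r) → υ r ≡ 0#
      0≤β : 0# ≤ β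
      β≤σ : β ≤ σ
      𝔼-α : 𝔼 𝒟 α ≡ d
      𝔼-ξ : 𝔼 𝒟 ξ ≡ q
      𝔼-υ : 𝔼 𝒟 υ ≡ q
      𝔼-α-revenue : 𝔼 𝒟 (λ r → α r * sellPrice r) ≡ d * σ
      𝔼-ξ-revenue : 𝔼 𝒟 (λ r → ξ r * sellPrice r) ≡ q * σ
      𝔼-υ-cost    : 𝔼 𝒟 (λ r → υ r * cost (buyPrice r)) ≡ q * β

  module _ {B₀ : ℕ} (I : Instance B₀) (rule : Rule I) (N K : ℕ) (N+K≡B₀ : N ℕ.+ K ≡ B₀) where
    open Instance I
    open Rule rule

    0≤σ : 0# ≤ σ
    0≤σ = ≤-trans 0≤β β≤σ

    -- `γ` is the margin `σ - β` times the fraction 1/(K+1) of time for which the driftless walk on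
    -- {0,...,K} is blocked.
    δ γ : Carrier
    δ = fromℕ (suc K) ⁻¹
    γ = (σ - β) * δ

    [1+K]γ≡σ-β : fromℕ (suc K) * γ ≡ σ - β
    [1+K]γ≡σ-β = trans (solve 3 (λ k g d → k :* (g :* d) := g :* (k :* d)) refl (fromℕ (suc K)) (σ - β) δ)
      (trans (cong ((σ - β) *_) (*-inverse (0<fromℕ K))) (*-identityʳ _))

    0≤γ : 0# ≤ γ
    0≤γ = *-nonNeg (0≤y-x β≤σ) (⁻¹-nonNeg (0<fromℕ K))

    -- Marginal value of the (j+1)-st copy in the trading account; it makes the drift of the
    -- potential below independent of the stock, boundaries included.
    slope : ℕ → Carrier
    slope j = σ - fromℕ (suc j) * γ

    potential : ℕ → Carrier
    potential zero    = 0#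
    potential (suc z) = potential z + slope z

    potential-≤ : ∀ z y → z ℕ.+ y ≡ K → potential z ≤ potential K
    potential-≤ z zero    z+y≡K = ≤-reflexive (cong potential (trans (sym (ℕ.+-identityʳ z)) z+y≡K))
    potential-≤ z (suc y) z+y≡K = ≤-trans
      (0≤slope ≤-via refl)
      (potential-≤ (suc z) y (trans (sym (ℕ.+-suc z y)) z+y≡K))
      where
      z≤K : suc z ℕ.≤ suc K
      z≤K = ℕ.s≤s (ℕ.≤-trans (ℕ.m≤m+n z (suc y)) (ℕ.≤-reflexive z+y≡K))
      0≤slope : 0# ≤ slope z
      0≤slope = subst (0# ≤_) (trans (cong (λ t → β + (t - fromℕ (suc z) * γ)) [1+K]γ≡σ-β)
          (solve 3 (λ σ β u → β :+ ((σ :- β) :- u) := σ :- u) refl σ β (fromℕ (suc z) * γ)))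
        (+-nonNeg 0≤β (0≤y-x (subst₂ _≤_ (*-comm γ _) (*-comm γ _) (*-monoˡ-≤ 0≤γ (fromℕ-mono z≤K)))))

    -- Candidate lower bound for the value with `ℓ` copies to liquidate and `z` in the trading
    -- account. Subtracting `potential K` makes it nonpositive once no request is left, and costs
    -- nothing at the start `z = K`.
    W : ℕ → ℕ → ℕ → Carrier
    W n ℓ z = σ * sales d n ℓ + (fromℕ n * (q * (σ - β - γ)) + (potential z - potential K))

    -- This and the next two functions are the price plus the change of `W n` caused by an attempt.
    -- A blocked attempt becomes a skip and counts 0; the second argument of `tradeBuy` is the room
    -- left in the trading account.
    liquidate : ℕ → ℕ → Request → Carrier
    liquidate n zero    r = 0#
    liquidate n (suc ℓ) r = sellPrice r + σ * (sales d n ℓ - sales d n (suc ℓ))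

    tradeSell : ℕ → Request → Carrier
    tradeSell zero    r = 0#
    tradeSell (suc z) r = sellPrice r - slope z

    tradeBuy : ℕ → ℕ → Request → Carrier
    tradeBuy z zero    r = 0#
    tradeBuy z (suc y) r = slope z - cost (buyPrice r)

    𝔼-affine : ∀ (w f : Request → Carrier) c → 𝔼 𝒟 (λ r → w r * (f r + c)) ≡ 𝔼 𝒟 (λ r → w r * f r) + c * 𝔼 𝒟 w
    𝔼-affine w f c = trans
      (𝔼-cong 𝒟 (λ r → solve 3 (λ w f c → w :* (f :+ c) := w :* f :+ c :* w) refl (w r) (f r) c))
      (trans (𝔼-+ 𝒟 (λ r → w r * f r) (λ r → c * w r)) (cong (𝔼 𝒟 (λ r → w r * f r) +_) (𝔼-* 𝒟 c w)))

    𝔼-*0 : ∀ (w : Request → Carrier) → 𝔼 𝒟 (λ r → w r * 0#) ≡ 0#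
    𝔼-*0 w = trans (𝔼-cong 𝒟 (λ r → zeroʳ (w r))) (𝔼-const 𝒟 0#)

    𝔼-liquidate : ∀ n ℓ → 𝔼 𝒟 (λ r → α r * liquidate n ℓ r) ≡ σ * (sales d (suc n) ℓ - sales d n ℓ)
    𝔼-liquidate n zero = trans (𝔼-*0 α) (trans (solve 1 (λ s → :0 := s :* (:0 :- :0)) refl σ)
      (cong (λ t → σ * (0# - t)) (sym (sales-zero n))))
      where
      sales-zero : ∀ n → sales d n zero ≡ 0#
      sales-zero zero    = refl
      sales-zero (suc n) = refl
    𝔼-liquidate n (suc ℓ) = trans (𝔼-affine α sellPrice _) (trans (cong₂ _+_ 𝔼-α-revenue (cong (_ *_) 𝔼-α))
      (solve 4 (λ d s m m′ → d :* s :+ s :* (m :- m′) :* d := s :* ((d :* (:1 :+ m) :+ (:1 :- d) :* m′) :- m′)) refl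
        d σ (sales d n ℓ) (sales d n (suc ℓ))))

    𝔼-tradeSell : ∀ z → 𝔼 𝒟 (λ r → ξ r * tradeSell z r) ≡ q * (fromℕ z * γ)
    𝔼-tradeSell zero    = trans (𝔼-*0 ξ) (solve 2 (λ q g → :0 := q :* (:0 :* g)) refl q γ)
    𝔼-tradeSell (suc z) = trans (𝔼-affine ξ sellPrice (- slope z)) (trans (cong₂ _+_ 𝔼-ξ-revenue (cong (- slope z *_) 𝔼-ξ))
      (solve 3 (λ q s u → q :* s :+ (:- (s :- u)) :* q := q :* u) refl q σ (fromℕ (suc z) * γ)))

    -- Since (K+1)γ = σ - β, the formula vanishes at z = K, where purchases are blocked, just as
    -- `𝔼-tradeSell` vanishes at z = 0. The two add up to q(σ - β - γ) for every z.
    𝔼-tradeBuy : ∀ z y → z ℕ.+ y ≡ K → 𝔼 𝒟 (λ r → υ r * tradeBuy z y r) ≡ q * (σ - β - fromℕ (suc z) * γ)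
    𝔼-tradeBuy z zero    z+y≡K = trans (𝔼-*0 υ) (trans (solve 2 (λ q g → :0 := q :* (g :- g)) refl q (σ - β))
      (cong (λ t → q * (σ - β - t)) (sym (trans (cong (λ k → fromℕ (suc k) * γ) (trans (sym (ℕ.+-identityʳ z)) z+y≡K)) [1+K]γ≡σ-β))))
    𝔼-tradeBuy z (suc y) z+y≡K = trans
      (𝔼-cong 𝒟 (λ r → solve 3 (λ u s b → u :* (s :- b) := :- :1 :* (u :* (b :+ :- s))) refl (υ r) (slope z) (cost (buyPrice r))))
      (trans (𝔼-* 𝒟 (- 1#) (λ r → υ r * (cost (buyPrice r) - slope z)))
      (trans (cong (- 1# *_) (trans (𝔼-affine υ (λ r → cost (buyPrice r)) (- slope z))
          (cong₂ _+_ 𝔼-υ-cost (cong (- slope z *_) 𝔼-υ))))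
      (solve 4 (λ q s b u → :- :1 :* (q :* b :+ (:- (s :- u)) :* q) := q :* (s :- b :- u)) refl q σ β (fromℕ (suc z) * γ))))

    -- The rule mixes actions with weights a, b, c and skips with the remaining weight. The last
    -- hypothesis carries the factor c because at price +∞ buying is forbidden and only c = 0 is
    -- available.
    mixture-≤ : ∀ {w a b c x y z Ω} → 0# ≤ a → 0# ≤ b → a + b + c ≤ 1# →
      w ≤ Ω → w + x ≤ Ω → w + y ≤ Ω → 0# ≤ c * (Ω - (w + z)) → w + (a * x + (b * y + c * z)) ≤ Ω
    mixture-≤ {w} {a} {b} {c} {x} {y} {z} {Ω} 0≤a 0≤b s≤1 w≤ wx≤ wy≤ wz≤ =
      +-nonNeg (*-nonNeg 0≤a (0≤y-x wx≤)) (+-nonNeg (*-nonNeg 0≤b (0≤y-x wy≤)) (+-nonNeg wz≤ (*-nonNeg (0≤y-x s≤1) (0≤y-x w≤))))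
      ≤-via solve 8 (λ w a b c x y z o → o := (w :+ (a :* x :+ (b :* y :+ c :* z)))
        :+ (a :* (o :- (w :+ x)) :+ (b :* (o :- (w :+ y)) :+ (c :* (o :- (w :+ z)) :+ (:1 :- (a :+ b :+ c)) :* (o :- w)))))
        refl w a b c x y z Ω

    -- `W` is a subsolution of the Bellman equation: its value with one more request is the mean of
    -- the one-step values under the rule, and the greedy action dominates each of them. `y` is the
    -- room in the trading account.
    W≤V : ∀ n ℓ z y → ℓ ℕ.≤ N → z ℕ.+ y ≡ K → W n ℓ z ≤ V I n (ℓ ℕ.+ z)
    W≤V zero ℓ z y ℓ≤N z+y≡K = 0≤y-x (potential-≤ z y z+y≡K)
      ≤-via solve 4 (λ s g p k → :0 := (s :* :0 :+ (:0 :* g :+ (p :- k))) :+ (k :- p)) refl σ (q * (σ - β - γ)) (potential z) (potential K)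
    W≤V (suc n) ℓ z y ℓ≤N z+y≡K = subst (_≤ V I (suc n) (ℓ ℕ.+ z)) 𝔼-lower
      (𝔼-mono 𝒟 lower (greedyValue I n (ℓ ℕ.+ z)) (λ i → lower≤ (outcome 𝒟 i)))
      where
      lower : Request → Carrier
      lower r = W n ℓ z + (α r * liquidate n ℓ r + (ξ r * tradeSell z r + υ r * tradeBuy z y r))

      𝔼-lower : 𝔼 𝒟 lower ≡ W (suc n) ℓ z
      𝔼-lower = trans (𝔼-+ 𝒟 (λ _ → W n ℓ z) (λ r → α r * liquidate n ℓ r + (ξ r * tradeSell z r + υ r * tradeBuy z y r))) (trans (cong₂ _+_ (𝔼-const 𝒟 _)
        (trans (𝔼-+ 𝒟 (λ r → α r * liquidate n ℓ r) (λ r → ξ r * tradeSell z r + υ r * tradeBuy z y r)) (cong₂ _+_ (𝔼-liquidate n ℓ)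
          (trans (𝔼-+ 𝒟 (λ r → ξ r * tradeSell z r) (λ r → υ r * tradeBuy z y r))
            (cong₂ _+_ (𝔼-tradeSell z) (𝔼-tradeBuy z y z+y≡K))))))
        (solve 9 (λ s m m′ n q b g p z → (s :* m :+ (n :* (q :* (s :- b :- g)) :+ p)) :+ (s :* (m′ :- m) :+ (q :* (z :* g) :+ q :* (s :- b :- (:1 :+ z) :* g)))
            := s :* m′ :+ ((:1 :+ n) :* (q :* (s :- b :- g)) :+ p)) refl
          σ (sales d n ℓ) (sales d (suc n) ℓ) (fromℕ n) q β γ (potential z - potential K) (fromℕ z)))

      Ω : Request → Carrier
      Ω = greedyValue I n (ℓ ℕ.+ z)

      by-skipping : ∀ r → W n ℓ z ≤ Ω r
      by-skipping r = ≤-trans (W≤V n ℓ z y ℓ≤N z+y≡K)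
        (subst (_≤ Ω r) (+-identityˡ _) (greedyValue-≥ I n (ℓ ℕ.+ z) r skip tt))

      by-liquidating : ∀ ℓ → ℓ ℕ.≤ N → (∀ r → W n ℓ z ≤ greedyValue I n (ℓ ℕ.+ z) r) →
                       ∀ r → W n ℓ z + liquidate n ℓ r ≤ greedyValue I n (ℓ ℕ.+ z) r
      by-liquidating zero    ℓ≤N skip≤ r = subst (_≤ greedyValue I n z r) (sym (+-identityʳ _)) (skip≤ r)
      by-liquidating (suc ℓ) ℓ≤N skip≤ r = ≤-trans
        (subst (_≤ sellPrice r + V I n (ℓ ℕ.+ z))
          (solve 5 (λ s σ m m′ t → s :+ (σ :* m :+ t) := (σ :* m′ :+ t) :+ (s :+ σ :* (m :- m′))) refl
            (sellPrice r) σ (sales d n ℓ) (sales d n (suc ℓ)) (fromℕ n * (q * (σ - β - γ)) + (potential z - potential K)))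
          (+-monoʳ-≤ (sellPrice r) (W≤V n ℓ z y (ℕ.<⇒≤ ℓ≤N) z+y≡K)))
        (greedyValue-≥ I n (suc ℓ ℕ.+ z) r sell (ℕ.s≤s ℕ.z≤n))

      by-selling : ∀ z y → z ℕ.+ y ≡ K → (∀ r → W n ℓ z ≤ greedyValue I n (ℓ ℕ.+ z) r) →
                   ∀ r → W n ℓ z + tradeSell z r ≤ greedyValue I n (ℓ ℕ.+ z) r
      by-selling zero    y z+y≡K skip≤ r = subst (_≤ greedyValue I n (ℓ ℕ.+ 0) r) (sym (+-identityʳ _)) (skip≤ r)
      by-selling (suc z) y z+y≡K skip≤ r = ≤-trans
        (subst₂ _≤_
          (solve 6 (λ s a b p k w → s :+ (a :+ (b :+ (p :- k))) := (a :+ (b :+ ((p :+ w) :- k))) :+ (s :- w)) refl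
            (sellPrice r) (σ * sales d n ℓ) (fromℕ n * (q * (σ - β - γ))) (potential z) (potential K) (slope z))
          (cong (λ k → sellPrice r + V I n (ℕ.pred k)) (sym (ℕ.+-suc ℓ z)))
          (+-monoʳ-≤ (sellPrice r) (W≤V n ℓ z (suc y) ℓ≤N (trans (ℕ.+-suc z y) z+y≡K))))
        (greedyValue-≥ I n (ℓ ℕ.+ suc z) r sell (ℕ.≤-trans (ℕ.s≤s ℕ.z≤n) (ℕ.≤-reflexive (sym (ℕ.+-suc ℓ z)))))

      by-buying : ∀ y → z ℕ.+ y ≡ K → ∀ r → 0# ≤ υ r * (Ω r - (W n ℓ z + tradeBuy z y r))
      by-buying zero    z+y≡K r = *-nonNeg (υ≥0 r) (0≤y-x (subst (_≤ Ω r) (sym (+-identityʳ _)) (by-skipping r)))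
      by-buying (suc y) z+y≡K r with finite? (buyPrice r)
      ... | no  infinite = ≤-reflexive (sym (trans (cong (_* (Ω r - (W n ℓ z + tradeBuy z (suc y) r))) (υ-finite r infinite)) (zeroˡ (Ω r - (W n ℓ z + tradeBuy z (suc y) r)))))
      ... | yes finite = *-nonNeg (υ≥0 r) (0≤y-x (≤-trans
        (subst₂ _≤_
          (solve 6 (λ c a b p k w → (:- c) :+ (a :+ (b :+ ((p :+ w) :- k))) := (a :+ (b :+ (p :- k))) :+ (w :- c)) refl
            (cost (buyPrice r)) (σ * sales d n ℓ) (fromℕ n * (q * (σ - β - γ))) (potential z) (potential K) (slope z))
          (cong (λ k → - cost (buyPrice r) + V I n k) (ℕ.+-suc ℓ z))
          (+-monoʳ-≤ (- cost (buyPrice r)) (W≤V n ℓ (suc z) y ℓ≤N (trans (sym (ℕ.+-suc z y)) z+y≡K))))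
        (greedyValue-≥ I n (ℓ ℕ.+ z) r buy (below-capacity , finite))))
        where
        -- Room in the trading account is room under the capacity, as ℓ + z < N + K = B₀ ≤ B.
        below-capacity : ℓ ℕ.+ z ℕ.< B
        below-capacity = ℕ.<-≤-trans
          (ℕ.+-mono-≤-< ℓ≤N (ℕ.<-≤-trans (ℕ.m<m+n z (ℕ.s≤s ℕ.z≤n)) (ℕ.≤-reflexive z+y≡K)))
          (ℕ.≤-trans (ℕ.≤-reflexive N+K≡B₀) B₀≤B)

      lower≤ : ∀ r → lower r ≤ Ω r
      lower≤ r = mixture-≤ (α≥0 r) (ξ≥0 r) (α+ξ+υ≤1 r) (by-skipping r) (by-liquidating ℓ ℓ≤N by-skipping r)
        (by-selling z y z+y≡K by-skipping r) (by-buying y z+y≡K r)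

-- Proof of (a): the fluid relaxation of the offline optimum and its rounding.

module UpperTail (ℛ : Reals) where
  open OrderedField ℛ
  open ATP ℛ
  open Expectation ℛ
  open Greedy ℛ
  open Frequencies ℛ
  open Liquidation ℛ
  open TwoAccounts ℛ
  open Offline ℛ
  open SquareRootLogarithm ℛ using (integer-√; k≤√n; √n≤k; ½; ½≤log)
  open SemiringSum semiring using (sum)

  -- The offline optimum as a stationary randomised rule: x and y are the average probabilities
  -- of selling and buying given the current request.
  record Fluid {B₀ : ℕ} (I : Instance B₀) : Set where
    open Instance I
    field
      x y : Request → Carrier
      x≥0 : ∀ r → 0# ≤ x r
      y≥0 : ∀ r → 0# ≤ y r
      x+y≤1 : ∀ r → x r + y r ≤ 1#
      y-finite : ∀ r → ¬ Finite (buyPrice r) → y r ≡ 0#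
      net-sales : fromℕ T * (𝔼 𝒟 x - 𝔼 𝒟 y) ≤ fromℕ B₀
      value : offlineProfit I ≡ fromℕ T * (𝔼 𝒟 (λ r → x r * sellPrice r) - 𝔼 𝒟 (λ r → y r * cost (buyPrice r)))

  -- Masking purchases at price +∞ by this indicator makes `y-finite` immediate, instead of tracing
  -- through `frequency` that a feasible strategy never makes them.
  isFinite : Carrier ⁺ → Carrier
  isFinite ⊤⁺    = 0#
  isFinite [ _ ] = 1#

  isFinite-bounds : ∀ b → 0# ≤ isFinite b × isFinite b ≤ 1#
  isFinite-bounds ⊤⁺    = ≤-refl , 0≤1
  isFinite-bounds [ _ ] = 0≤1 , ≤-refl

  netSale : Request → Action → Carrier
  netSale r buy  = - isFinite (buyPrice r)
  netSale r sell = 1#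
  netSale r skip = 0#

  -- Copies sold in excess of those bought come from the initial stock. The average of this pathwise
  -- bound is the inventory constraint of the relaxation.
  total-netSale-≤ : ∀ {n} B k (rs : Vec Request n) as → Feasible B k rs as → total netSale rs as ≤ fromℕ k
  total-netSale-≤ B k [] [] _ = 0≤fromℕ k
  total-netSale-≤ B k (r ∷ rs) (sell ∷ as) (ℕ.s≤s _ , f) = +-monoʳ-≤ 1# (total-netSale-≤ B (ℕ.pred k) rs as f)
  total-netSale-≤ B k (r ∷ rs) (skip ∷ as) (_ , f) = subst (_≤ fromℕ k) (sym (+-identityˡ _)) (total-netSale-≤ B k rs as f)
  total-netSale-≤ B k (⟨ ⊤⁺ , _ ⟩ ∷ rs) (buy ∷ as) ((_ , finite) , f) = contradiction refl finite
  total-netSale-≤ B k (⟨ [ b ] , _ ⟩ ∷ rs) (buy ∷ as) (_ , f) =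
    subst (- 1# + total netSale rs as ≤_) (solve 1 (λ k → :- :1 :+ (:1 :+ k) := k) refl (fromℕ k))
      (+-monoʳ-≤ (- 1#) (total-netSale-≤ B (suc k) rs as f))

  module _ {B₀ : ℕ} (I : Instance B₀) where
    open Instance I

    0<T : 0# < fromℕ T
    0<T = <-≤-trans 0<1 (subst (_≤ fromℕ T) fromℕ-1 (fromℕ-mono (ℕ.≤-trans 1≤B₀ B₀≤T)))

    fluid : Fluid I
    fluid = record
      { x = λ r → τ * X r sell
      ; y = λ r → τ * (isFinite (buyPrice r) * X r buy)
      ; x≥0 = λ r → *-nonNeg 0≤τ (X≥0 r sell)
      ; y≥0 = λ r → *-nonNeg 0≤τ (*-nonNeg (proj₁ (isFinite-bounds (buyPrice r))) (X≥0 r buy))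
      ; x+y≤1 = λ r → +-nonNeg (*-nonNeg 0≤τ (X≥0 r skip)) (*-nonNeg 0≤τ (*-nonNeg (0≤y-x (proj₂ (isFinite-bounds (buyPrice r)))) (X≥0 r buy)))
          ≤-via trans (sym (*-inverse 0<T)) (trans (cong (_* τ) (sym (∑ₐ-frequency 𝒟 F r)))
            (solve 5 (λ t b s k f → (:1 :* b :+ :1 :* s :+ :1 :* k) :* t := (t :* s :+ t :* (f :* b)) :+ (t :* k :+ t :* ((:1 :- f) :* b)))
              refl τ (X r buy) (X r sell) (X r skip) (isFinite (buyPrice r))))
      ; y-finite = λ r infinite → trans (cong (τ *_) (y-infinite r infinite)) (zeroʳ τ)
      ; net-sales = subst (_≤ fromℕ B₀) net-sales-eq net-sales-≤
      ; value = value-eq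
      }
      where
      τ : Carrier
      τ = fromℕ T ⁻¹
      0≤τ : 0# ≤ τ
      0≤τ = ⁻¹-nonNeg 0<T
      F : Vec Request T → Vec Action T
      F rs = proj₁ (maxProfit-attained B B₀ rs)
      X : Request → Action → Carrier
      X = frequency 𝒟 F
      X≥0 : ∀ r a → 0# ≤ X r a
      X≥0 = frequency-nonNeg 𝒟 F
      y-infinite : ∀ r → ¬ Finite (buyPrice r) → isFinite (buyPrice r) * X r buy ≡ 0#
      y-infinite ⟨ ⊤⁺ , _ ⟩    _        = zeroˡ _
      y-infinite ⟨ [ _ ] , _ ⟩ infinite = contradiction (λ ()) infinite

      difference : (f g : Request → Carrier) →
        fromℕ T * (𝔼 𝒟 (λ r → τ * f r) - 𝔼 𝒟 (λ r → τ * g r)) ≡ 𝔼 𝒟 (λ r → f r + - 1# * g r)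
      difference f g = trans
        (cong₂ (λ u v → fromℕ T * (u - v)) (𝔼-* 𝒟 τ f) (𝔼-* 𝒟 τ g))
        (trans (solve 4 (λ t i a b → t :* (i :* a :- i :* b) := (t :* i) :* (a :+ :- :1 :* b)) refl (fromℕ T) τ (𝔼 𝒟 f) (𝔼 𝒟 g))
        (trans (cong (_* (𝔼 𝒟 f + - 1# * 𝔼 𝒟 g)) (*-inverse 0<T))
        (trans (*-identityˡ _) (sym (trans (𝔼-+ 𝒟 f (λ r → - 1# * g r)) (cong (𝔼 𝒟 f +_) (𝔼-* 𝒟 (- 1#) g)))))))

      net-sales-≤ : 𝔼 𝒟 (λ r → ∑ₐ (λ a → netSale r a * X r a)) ≤ fromℕ B₀
      net-sales-≤ = subst₂ _≤_ (𝔼-total 𝒟 netSale F) (𝔼-iid-const T 𝒟 (fromℕ B₀))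
        (𝔼-iid-mono T 𝒟 (λ rs → total netSale rs (F rs)) (λ _ → fromℕ B₀)
          (λ rs → total-netSale-≤ B B₀ rs (F rs) (proj₁ (proj₂ (maxProfit-attained B B₀ rs)))))

      net-sales-eq : 𝔼 𝒟 (λ r → ∑ₐ (λ a → netSale r a * X r a))
        ≡ fromℕ T * (𝔼 𝒟 (λ r → τ * X r sell) - 𝔼 𝒟 (λ r → τ * (isFinite (buyPrice r) * X r buy)))
      net-sales-eq = sym (trans (difference (λ r → X r sell) (λ r → isFinite (buyPrice r) * X r buy))
        (𝔼-cong 𝒟 (λ r → solve 4 (λ f b s k → s :+ :- :1 :* (f :* b) := :- f :* b :+ :1 :* s :+ :0 :* k) refl
          (isFinite (buyPrice r)) (X r buy) (X r sell) (X r skip))))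

      cost-finite : ∀ b u → τ * (isFinite b * u) * cost b ≡ τ * (cost b * u)
      cost-finite ⊤⁺    u = solve 2 (λ t u → t :* (:0 :* u) :* :0 := t :* (:0 :* u)) refl τ u
      cost-finite [ b ] u = solve 3 (λ t u b → t :* (:1 :* u) :* b := t :* (b :* u)) refl τ u b

      value-eq : offlineProfit I ≡ fromℕ T * (𝔼 𝒟 (λ r → τ * X r sell * sellPrice r)
        - 𝔼 𝒟 (λ r → τ * (isFinite (buyPrice r) * X r buy) * cost (buyPrice r)))
      value-eq = trans
        (𝔼-iid-cong T 𝒟 (λ rs → trans (proj₂ (proj₂ (maxProfit-attained B B₀ rs))) (profit≡total rs (F rs))))
        (trans (𝔼-total 𝒟 gain F)
        (trans (𝔼-cong 𝒟 (λ r → solve 5 (λ c b p s k → :- c :* b :+ p :* s :+ :0 :* k := s :* p :+ :- :1 :* (c :* b)) refl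
          (cost (buyPrice r)) (X r buy) (sellPrice r) (X r sell) (X r skip)))
        (trans (sym (difference (λ r → X r sell * sellPrice r) (λ r → cost (buyPrice r) * X r buy)))
        (cong₂ (λ u v → fromℕ T * (u - v))
          (𝔼-cong 𝒟 (λ r → sym (*-assoc τ (X r sell) (sellPrice r))))
          (𝔼-cong 𝒟 (λ r → sym (cost-finite (buyPrice r) (X r buy))))))))

    module _ (K N : ℕ) (N+K≡B₀ : N ℕ.+ K ≡ B₀) {κ : Carrier} (0≤κ : 0# ≤ κ) (κK≡1 : κ * fromℕ K ≡ 1#) where
      -- The choice c = N - Td makes the square in `sales-lower` vanish, and K ≤ c then limits the
      -- liquidation loss to the fraction κ. Trading loses γ ≤ κ(σ - β) per purchase. It starts with
      -- a full account, so the potentials cancel.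
      V-lower : (rule : Rule I) → let open Rule rule in fromℕ T * d ≤ fromℕ N - fromℕ K →
                (1# - κ) * (fromℕ T * (d * σ + q * (σ - β))) ≤ V I T B₀
      V-lower rule td≤N-K = subst ((1# - κ) * (fromℕ T * (d * σ + q * (σ - β))) ≤_) (cong (V I T) N+K≡B₀)
        (≤-trans
          (+-nonNeg (*-nonNeg (0≤σ I rule N K N+K≡B₀) (0≤y-x sales≥)) (*-nonNeg (*-nonNeg (0≤fromℕ T) 0≤q) (0≤y-x γ≤))
            ≤-via solve 9 (λ k t d s q b g m p → s :* m :+ (t :* (q :* (s :- b :- g)) :+ (p :- p))
              := (:1 :- k) :* (t :* (d :* s :+ q :* (s :- b)))
                :+ (s :* (m :- (t :* d :- k :* (t :* d))) :+ (t :* q) :* (k :* (s :- b) :- g))) refl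
              κ t d σ q β γ′ (sales d T N) (potential I rule N K N+K≡B₀ K))
          (W≤V I rule N K N+K≡B₀ T N K 0 ℕ.≤-refl (ℕ.+-identityʳ K)))
        where
        open Rule rule
        t c γ′ : Carrier
        t = fromℕ T
        c = fromℕ N - t * d
        γ′ = γ I rule N K N+K≡B₀
        0≤d : 0# ≤ d
        0≤d = subst (0# ≤_) 𝔼-α (𝔼-nonNeg 𝒟 α (λ i → α≥0 _))
        0≤q : 0# ≤ q
        0≤q = subst (0# ≤_) 𝔼-ξ (𝔼-nonNeg 𝒟 ξ (λ i → ξ≥0 _))
        d≤1 : d ≤ 1#
        d≤1 = subst (_≤ 1#) 𝔼-α (𝔼-≤-const 𝒟 α 1# (λ i _ → ≤-trans
          (+-nonNeg (ξ≥0 (outcome 𝒟 i)) (υ≥0 (outcome 𝒟 i)) ≤-via +-assoc _ _ _) (α+ξ+υ≤1 (outcome 𝒟 i))))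
        K≤c : fromℕ K ≤ c
        K≤c = 0≤y-x td≤N-K ≤-via solve 3 (λ n u k → n :- u := k :+ ((n :- k) :- u)) refl (fromℕ N) (t * d) (fromℕ K)
        sales≥ : t * d - κ * (t * d) ≤ sales d T N
        sales≥ = subst (_≤ sales d T N)
          (solve 3 (λ k u n → u :- k :* ((u :- n :+ (n :- u)) :* (u :- n :+ (n :- u)) :+ u) := u :- k :* u) refl κ (t * d) (fromℕ N))
          (sales-lower 0≤d d≤1 0≤κ (≤-trans (0≤fromℕ K) K≤c)
            (subst (_≤ κ * c) κK≡1 (*-monoˡ-≤ 0≤κ K≤c)) T N)
        δ′ : Carrier
        δ′ = fromℕ (suc K) ⁻¹
        δ≤κ : δ′ ≤ κ
        δ≤κ = *-cancelˡ-≤ (0<fromℕ K) (0≤κ ≤-via trans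
          (solve 2 (λ k κ → (:1 :+ k) :* κ := κ :* k :+ κ) refl (fromℕ K) κ)
          (cong (_+ κ) (trans κK≡1 (sym (*-inverse (0<fromℕ K))))))
        γ≤ : γ′ ≤ κ * (σ - β)
        γ≤ = subst (γ′ ≤_) (*-comm (σ - β) κ) (*-monoˡ-≤ (0≤y-x β≤σ) δ≤κ)

    open Fluid fluid

    p q S C : Carrier
    p = 𝔼 𝒟 x
    q = 𝔼 𝒟 y
    S = 𝔼 𝒟 (λ r → x r * sellPrice r)
    C = 𝔼 𝒟 (λ r → y r * cost (buyPrice r))

    -- Sales from both accounts are multiples of the same `x` and therefore share the mean price σ;
    -- c₂p = c₃q balances the trading account. The factor c₃ in the cost identity admits rules that
    -- never buy.
    scaledRule : ∀ {c₁ c₂ c₃ σ β} → 0# ≤ c₁ → 0# ≤ c₂ → 0# ≤ c₃ → c₁ + c₂ ≤ 1# → c₃ ≤ 1# → 0# ≤ β → β ≤ σ →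
                 S ≡ p * σ → c₃ * C ≡ c₃ * q * β → c₂ * p ≡ c₃ * q → Rule I
    scaledRule {c₁} {c₂} {c₃} {σ} {β} 0≤c₁ 0≤c₂ 0≤c₃ c₁+c₂≤1 c₃≤1 0≤β β≤σ S≡pσ c₃C≡c₃qβ c₂p≡c₃q = record
      { α = λ r → c₁ * x r ; ξ = λ r → c₂ * x r ; υ = λ r → c₃ * y r
      ; σ = σ ; β = β ; d = c₁ * p ; q = c₃ * q
      ; α≥0 = λ r → *-nonNeg 0≤c₁ (x≥0 r)
      ; ξ≥0 = λ r → *-nonNeg 0≤c₂ (x≥0 r)
      ; υ≥0 = λ r → *-nonNeg 0≤c₃ (y≥0 r)
      ; α+ξ+υ≤1 = λ r → ≤-trans
          (+-nonNeg (*-nonNeg (0≤y-x c₁+c₂≤1) (x≥0 r)) (*-nonNeg (0≤y-x c₃≤1) (y≥0 r))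
            ≤-via solve 5 (λ a b c x y → x :+ y := (a :* x :+ b :* x :+ c :* y) :+ ((:1 :- (a :+ b)) :* x :+ (:1 :- c) :* y))
              refl c₁ c₂ c₃ (x r) (y r))
          (x+y≤1 r)
      ; υ-finite = λ r infinite → trans (cong (c₃ *_) (y-finite r infinite)) (zeroʳ c₃)
      ; 0≤β = 0≤β ; β≤σ = β≤σ
      ; 𝔼-α = 𝔼-* 𝒟 c₁ x
      ; 𝔼-ξ = trans (𝔼-* 𝒟 c₂ x) c₂p≡c₃q
      ; 𝔼-υ = 𝔼-* 𝒟 c₃ y
      ; 𝔼-α-revenue = trans (revenue c₁) (trans (cong (c₁ *_) S≡pσ) (sym (*-assoc c₁ p σ)))
      ; 𝔼-ξ-revenue = trans (revenue c₂) (trans (cong (c₂ *_) S≡pσ) (trans (sym (*-assoc c₂ p σ)) (cong (_* σ) c₂p≡c₃q)))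
      ; 𝔼-υ-cost = trans (𝔼-cong 𝒟 (λ r → *-assoc c₃ (y r) (cost (buyPrice r))))
          (trans (𝔼-* 𝒟 c₃ (λ r → y r * cost (buyPrice r))) c₃C≡c₃qβ)
      }
      where
      revenue : ∀ c → 𝔼 𝒟 (λ r → c * x r * sellPrice r) ≡ c * S
      revenue c = trans (𝔼-cong 𝒟 (λ r → *-assoc c (x r) (sellPrice r))) (𝔼-* 𝒟 c (λ r → x r * sellPrice r))

    cost-nonNeg : ∀ i → 0# ≤ cost (buyPrice (outcome 𝒟 i))
    cost-nonNeg i = nonNeg (buyPrice≥0 i)
      where
      open AddSupremum _≤_ using (_≤⁺_) renaming ([_] to lift)
      nonNeg : ∀ {b} → [ 0# ] ≤⁺ b → 0# ≤ cost b
      nonNeg {⊤⁺}    _          = ≤-refl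
      nonNeg {[ b ]} (lift 0≤b) = 0≤b

    0≤p : 0# ≤ p
    0≤p = 𝔼-nonNeg 𝒟 x (λ i → x≥0 _)
    0≤q : 0# ≤ q
    0≤q = 𝔼-nonNeg 𝒟 y (λ i → y≥0 _)
    0≤S : 0# ≤ S
    0≤S = 𝔼-nonNeg 𝒟 (λ r → x r * sellPrice r) (λ i → *-nonNeg (x≥0 _) (sellPrice≥0 i))
    0≤C : 0# ≤ C
    0≤C = 𝔼-nonNeg 𝒟 (λ r → y r * cost (buyPrice r)) (λ i → *-nonNeg (y≥0 _) (cost-nonNeg i))

    term≤sum : ∀ {n} (f : Fin n → Carrier) → (∀ i → 0# ≤ f i) → ∀ i → f i ≤ sum f
    sum-nonNeg : ∀ {n} (f : Fin n → Carrier) → (∀ i → 0# ≤ f i) → 0# ≤ sum f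
    sum-nonNeg {zero}  f 0≤f = ≤-refl
    sum-nonNeg {suc n} f 0≤f = +-nonNeg (0≤f Fin.zero) (sum-nonNeg (λ i → f (Fin.suc i)) (λ i → 0≤f (Fin.suc i)))
    term≤sum f 0≤f Fin.zero    = sum-nonNeg (λ i → f (Fin.suc i)) (λ i → 0≤f (Fin.suc i)) ≤-via refl
    term≤sum f 0≤f (Fin.suc i) = ≤-trans (term≤sum (λ i → f (Fin.suc i)) (λ i → 0≤f (Fin.suc i)) i)
      (0≤f Fin.zero ≤-via +-comm _ _)

    -- Settles the case in which the mean price S/p is undefined: finitely many prices are bounded
    -- by their sum s̄, so S ≤ s̄p.
    p≤0⇒S≤0 : p ≤ 0# → S ≤ 0#
    p≤0⇒S≤0 p≤0 = ≤-trans
      (𝔼-mono 𝒟 (λ r → x r * sellPrice r) (λ r → s̄ * x r) (λ i → subst (_≤ s̄ * x (outcome 𝒟 i)) (*-comm _ _)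
        (subst₂ _≤_ (*-comm _ _) (*-comm _ _) (*-monoˡ-≤ (x≥0 (outcome 𝒟 i)) (term≤sum (λ i → sellPrice (outcome 𝒟 i)) sellPrice≥0 i)))))
      (subst₂ _≤_ (sym (𝔼-* 𝒟 s̄ x)) (zeroʳ s̄) (*-monoˡ-≤ (sum-nonNeg _ sellPrice≥0) p≤0))
      where
      s̄ : Carrier
      s̄ = sum (λ i → sellPrice (outcome 𝒟 i))

    -- The factor `ρ` slows down liquidation, so that its mean demand stays below the stock by a
    -- margin for fluctuations. The first alternative collects the distributions on which no profit
    -- can be made.
    Good : Carrier → Set
    Good ρ = offlineProfit I ≤ 0# ⊎ Σ (Rule I) λ rule → let open Rule rule renaming (q to q′) in
      fromℕ T * d ≤ ρ * fromℕ B₀ × ρ * offlineProfit I ≤ fromℕ T * (d * σ + q′ * (σ - β))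

    unprofitable : S ≤ C → offlineProfit I ≤ 0#
    unprofitable S≤C = *-nonNeg (0≤fromℕ T) (0≤y-x S≤C)
      ≤-via trans (solve 3 (λ t s c → :0 := t :* (s :- c) :+ t :* (c :- s)) refl (fromℕ T) S C) (cong (_+ fromℕ T * (C - S)) (sym value))

    module _ {ρ : Carrier} (0≤ρ : 0# ≤ ρ) (ρ≤1 : ρ ≤ 1#) (0<p : 0# < p) where
      private
        t σ c₁ : Carrier
        t = fromℕ T
        σ = S * p ⁻¹
        c₁ = ρ * (p - q) * p ⁻¹
        0≤t : 0# ≤ t
        0≤t = 0≤fromℕ T

      */-cancel : ∀ {v} → 0# < v → ∀ u → v * (u * v ⁻¹) ≡ u
      */-cancel {v} 0<v u = trans (solve 3 (λ v u i → v :* (u :* i) := u :* (v :* i)) refl v u (v ⁻¹))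
        (trans (cong (u *_) (*-inverse 0<v)) (*-identityʳ u))

      S≡pσ : S ≡ p * σ
      S≡pσ = sym (*/-cancel 0<p S)

      c₁p : c₁ * p ≡ ρ * (p - q)
      c₁p = trans (*-comm c₁ p) (*/-cancel 0<p (ρ * (p - q)))

      0≤σ′ : 0# ≤ σ
      0≤σ′ = *-nonNeg 0≤S (⁻¹-nonNeg 0<p)

      t[c₁p]≤ρB₀ : t * (c₁ * p) ≤ ρ * fromℕ B₀
      t[c₁p]≤ρB₀ = subst (_≤ ρ * fromℕ B₀) (trans (solve 4 (λ t r p q → r :* (t :* (p :- q)) := t :* (r :* (p :- q))) refl t ρ p q)
        (cong (t *_) (sym c₁p))) (*-monoˡ-≤ 0≤ρ net-sales)

      0≤c₁ : q ≤ p → 0# ≤ c₁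
      0≤c₁ q≤p = *-nonNeg (*-nonNeg 0≤ρ (0≤y-x q≤p)) (⁻¹-nonNeg 0<p)

      c₁+q/p≤1 : q ≤ p → c₁ + q * p ⁻¹ ≤ 1#
      c₁+q/p≤1 q≤p = *-cancelˡ-≤ 0<p (*-nonNeg (0≤y-x ρ≤1) (0≤y-x q≤p) ≤-via sym
        (trans (cong (_+ (1# - ρ) * (p - q)) (trans (distribˡ p c₁ (q * p ⁻¹))
            (cong₂ _+_ (trans (*-comm p c₁) c₁p) (*/-cancel 0<p q))))
          (solve 3 (λ p q r → (r :* (p :- q) :+ q) :+ (:1 :- r) :* (p :- q) := p :* :1) refl p q ρ)))

      -- Cancelling all purchases, together with as many average sales, changes the profit rate by C
      -- - qσ ≥ 0.
      withoutTrading : q * σ ≤ C → q ≤ p → Good ρ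
      withoutTrading qσ≤C q≤p = inj₂ (scaledRule (0≤c₁ q≤p) ≤-refl ≤-refl c₁+0≤1 0≤1 ≤-refl 0≤σ′ S≡pσ
          (solve 2 (λ c q → :0 :* c := :0 :* q :* :0) refl C q) (solve 2 (λ p q → :0 :* p := :0 :* q) refl p q)
        , t[c₁p]≤ρB₀
        , (*-nonNeg (*-nonNeg 0≤ρ 0≤t) (0≤y-x qσ≤C) ≤-via trans
            (cong (λ u → t * (u * σ + 0# * q * (σ - 0#))) c₁p)
            (trans (solve 6 (λ t r p q s c → t :* (r :* (p :- q) :* s :+ :0 :* q :* (s :- :0))
                := r :* (t :* (p :* s :- c)) :+ (r :* t) :* (c :- q :* s)) refl t ρ p q σ C)
              (cong (λ v → ρ * v + ρ * t * (C - q * σ)) (trans (cong (λ u → t * (u - C)) (sym S≡pσ)) (sym value))))))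
        where
        c₁+0≤1 : c₁ + 0# ≤ 1#
        c₁+0≤1 = ≤-trans (+-monoʳ-≤ c₁ (*-nonNeg 0≤q (⁻¹-nonNeg 0<p))) (c₁+q/p≤1 q≤p)

      withTrading : C < q * σ → 0# < q → Good ρ
      withTrading C<qσ 0<q with q ≤? p
      -- Sales split as p = (p - q) + q: the share q/p balances all purchases, the rest is
      -- liquidated and slowed by ρ.
      ... | yes q≤p = inj₂ (scaledRule (0≤c₁ q≤p) (*-nonNeg 0≤q (⁻¹-nonNeg 0<p)) 0≤1 (c₁+q/p≤1 q≤p) ≤-refl 0≤β β≤σ S≡pσ
          (trans (cong (1# *_) C≡qβ) (sym (*-assoc 1# q β)))
          (trans (trans (*-comm _ _) (*/-cancel 0<p q)) (sym (*-identityˡ q)))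
        , t[c₁p]≤ρB₀
        , (*-nonNeg (*-nonNeg 0≤t (0≤y-x ρ≤1)) (*-nonNeg 0≤q (0≤y-x β≤σ)) ≤-via trans
            (cong (λ u → t * (u * σ + 1# * q * (σ - β))) c₁p)
            (trans (solve 6 (λ t r p q s b → t :* (r :* (p :- q) :* s :+ :1 :* q :* (s :- b))
                := r :* (t :* (p :* s :- q :* b)) :+ (t :* (:1 :- r)) :* (q :* (s :- b))) refl t ρ p q σ β)
              (cong (λ v → ρ * v + t * (1# - ρ) * (q * (σ - β))) value′))))
        where
        β : Carrier
        β = C * q ⁻¹
        C≡qβ : C ≡ q * β
        C≡qβ = sym (*/-cancel 0<q C)
        0≤β : 0# ≤ β
        0≤β = *-nonNeg 0≤C (⁻¹-nonNeg 0<q)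
        β≤σ : β ≤ σ
        β≤σ = *-cancelˡ-≤ 0<q (subst (_≤ q * σ) C≡qβ (<⇒≤ C<qσ))
        value′ : t * (p * σ - q * β) ≡ offlineProfit I
        value′ = trans (cong₂ (λ u v → t * (u - v)) (sym S≡pσ) (sym C≡qβ)) (sym value)
      -- With more purchases than sales, the fraction p/q of the purchases is kept and nothing is
      -- liquidated.
      ... | no q≰p = inj₂ (scaledRule ≤-refl 0≤1 (*-nonNeg 0≤p (⁻¹-nonNeg 0<q)) (≤-reflexive (+-identityˡ 1#)) c₃≤1 0≤β β≤σ S≡pσ
          (trans (cong (p * q ⁻¹ *_) C≡qβ) (sym (*-assoc _ q β)))
          (trans (*-identityˡ p) (sym c₃q))
        , subst (_≤ ρ * fromℕ B₀) (solve 2 (λ t p → :0 := t :* (:0 :* p)) refl t p) (*-nonNeg 0≤ρ (0≤fromℕ B₀))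
        , (+-nonNeg (*-nonNeg (*-nonNeg 0≤t (0≤y-x ρ≤1)) (*-nonNeg 0≤p (0≤y-x β≤σ)))
                    (*-nonNeg (*-nonNeg 0≤t 0≤ρ) (*-nonNeg (0≤y-x p≤q) 0≤β)) ≤-via trans
            (cong (λ u → t * (0# * p * σ + u * (σ - β))) c₃q)
            (trans (solve 6 (λ t r p q s b → t :* (:0 :* p :* s :+ p :* (s :- b))
                := r :* (t :* (p :* s :- q :* b)) :+ ((t :* (:1 :- r)) :* (p :* (s :- b)) :+ (t :* r) :* ((q :- p) :* b))) refl t ρ p q σ β)
              (cong (λ v → ρ * v + (t * (1# - ρ) * (p * (σ - β)) + t * ρ * ((q - p) * β))) value′))))
        where
        β : Carrier
        β = C * q ⁻¹
        C≡qβ : C ≡ q * β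
        C≡qβ = sym (*/-cancel 0<q C)
        0≤β : 0# ≤ β
        0≤β = *-nonNeg 0≤C (⁻¹-nonNeg 0<q)
        β≤σ : β ≤ σ
        β≤σ = *-cancelˡ-≤ 0<q (subst (_≤ q * σ) C≡qβ (<⇒≤ C<qσ))
        value′ : t * (p * σ - q * β) ≡ offlineProfit I
        value′ = trans (cong₂ (λ u v → t * (u - v)) (sym S≡pσ) (sym C≡qβ)) (sym value)
        p≤q : p ≤ q
        p≤q = ≰⇒≥ q≰p
        c₃q : p * q ⁻¹ * q ≡ p
        c₃q = trans (*-comm _ q) (*/-cancel 0<q p)
        c₃≤1 : p * q ⁻¹ ≤ 1#
        c₃≤1 = *-cancelˡ-≤ 0<q (subst₂ _≤_ (sym (*/-cancel 0<q p)) (sym (*-identityʳ q)) p≤q)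

      good⁺ : Good ρ
      good⁺ with q * σ ≤? C
      ... | no  qσ≰C = withTrading (≰⇒> qσ≰C) (0≤q , λ 0≡q → qσ≰C (subst (_≤ C) (trans (sym (zeroˡ σ)) (cong (_* σ) 0≡q)) 0≤C))
      ... | yes qσ≤C with q ≤? p
      ...   | yes q≤p = withoutTrading qσ≤C q≤p
      -- Here S = pσ ≤ qσ ≤ C.
      ...   | no  q≰p = inj₁ (unprofitable (subst (_≤ C) (sym S≡pσ)
                (≤-trans (subst₂ _≤_ (*-comm σ p) (*-comm σ q) (*-monoˡ-≤ 0≤σ′ (≰⇒≥ q≰p))) qσ≤C)))

    good : ∀ {ρ} → 0# ≤ ρ → ρ ≤ 1# → Good ρ
    good 0≤ρ ρ≤1 with p ≤? 0#
    ... | yes p≤0 = inj₁ (unprofitable (≤-trans (p≤0⇒S≤0 p≤0) 0≤C))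
    ... | no  p≰0 = good⁺ 0≤ρ ρ≤1 (≰⇒> p≰0)

    offlineProfit-nonNeg : 0# ≤ offlineProfit I
    offlineProfit-nonNeg = subst (_≤ offlineProfit I) (𝔼-iid-const T 𝒟 0#)
      (𝔼-iid-mono T 𝒟 (λ _ → 0#) (maxProfit B B₀) (maxProfit-nonNeg B B₀))

    -- Take ρ = 1 - 2κ: K² ≤ B₀ gives K ≤ κB₀, hence ρB₀ ≤ B₀ - 2K = N - K, the margin asked for by
    -- `V-lower`. The two losses combine through (1-κ)(1-2κ) ≥ 1-3κ.
    [1-3κ]OPT≤V : ∀ {κ} K → 2 ℕ.≤ K → K ℕ.* K ℕ.≤ B₀ → 0# ≤ κ → κ * fromℕ K ≡ 1# →
                  (1# - fromℕ 3 * κ) * offlineProfit I ≤ V I T B₀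
    [1-3κ]OPT≤V {κ} K 2≤K K²≤B₀ 0≤κ κK≡1 with good 0≤ρ ρ≤1
      where
      0≤ρ : 0# ≤ 1# - fromℕ 2 * κ
      0≤ρ = 0≤y-x (subst₂ _≤_ (*-comm κ (fromℕ 2)) κK≡1 (*-monoˡ-≤ 0≤κ (fromℕ-mono 2≤K)))
      ρ≤1 : 1# - fromℕ 2 * κ ≤ 1#
      ρ≤1 = *-nonNeg (0≤fromℕ 2) 0≤κ ≤-via solve 1 (λ k → :1 := (:1 :- :ℕ 2 :* k) :+ :ℕ 2 :* k) refl κ
    ... | inj₁ OPT≤0 = ≤-trans (≤-reflexive (trans (cong (_ *_) (≤-antisym OPT≤0 offlineProfit-nonNeg)) (zeroʳ _))) (V-nonNeg I T B₀)
    ... | inj₂ (rule , Td≤ρB₀ , ρOPT≤) = ≤-trans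
      (*-nonNeg (*-nonNeg 0≤κ 0≤κ) (+-nonNeg offlineProfit-nonNeg offlineProfit-nonNeg)
        ≤-via solve 2 (λ k o → (:1 :- k) :* ((:1 :- :ℕ 2 :* k) :* o) := (:1 :- :ℕ 3 :* k) :* o :+ k :* k :* (o :+ o)) refl κ (offlineProfit I))
      (≤-trans (*-monoˡ-≤ 0≤1-κ ρOPT≤) (V-lower K N (ℕ.m∸n+n≡m K≤B₀) 0≤κ κK≡1 rule (≤-trans Td≤ρB₀ ρB₀≤N-K)))
      where
      N : ℕ
      N = B₀ ℕ.∸ K
      K≤B₀ : K ℕ.≤ B₀
      K≤B₀ = ℕ.≤-trans (ℕ.≤-trans (ℕ.≤-reflexive (sym (ℕ.*-identityʳ K))) (ℕ.*-monoʳ-≤ K (ℕ.≤-trans (ℕ.s≤s ℕ.z≤n) 2≤K))) K²≤B₀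
      0≤1-κ : 0# ≤ 1# - κ
      0≤1-κ = 0≤y-x (subst₂ _≤_ (trans (cong (κ *_) fromℕ-1) (*-identityʳ κ)) κK≡1 (*-monoˡ-≤ 0≤κ (fromℕ-mono (ℕ.≤-trans (ℕ.s≤s ℕ.z≤n) 2≤K))))
      K≤κB₀ : fromℕ K ≤ κ * fromℕ B₀
      K≤κB₀ = subst (_≤ κ * fromℕ B₀)
        (trans (cong (κ *_) (fromℕ-* K K)) (trans (sym (*-assoc κ _ _)) (trans (cong (_* fromℕ K) κK≡1) (*-identityˡ _))))
        (*-monoˡ-≤ 0≤κ (fromℕ-mono K²≤B₀))
      ρB₀≤N-K : (1# - fromℕ 2 * κ) * fromℕ B₀ ≤ fromℕ N - fromℕ K
      ρB₀≤N-K = *-nonNeg (0≤fromℕ 2) (0≤y-x K≤κB₀) ≤-via trans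
        (solve 2 (λ n k → n :- k := (n :+ k) :- :ℕ 2 :* k) refl (fromℕ N) (fromℕ K))
        (trans (cong (λ b → b - fromℕ 2 * fromℕ K) (trans (sym (fromℕ-+ N K)) (cong fromℕ (ℕ.m∸n+n≡m K≤B₀))))
          (solve 3 (λ k κ b → b :- :ℕ 2 :* k := (:1 :- :ℕ 2 :* κ) :* b :+ :ℕ 2 :* (κ :* b :- k)) refl (fromℕ K) κ (fromℕ B₀)))

  -- The constant is 12 = 3·2·2: the loss is 3κ, √B₀ ≤ K+1 ≤ 2K gives κ√B₀ ≤ 2, and log B₀ ≥ ½. For
  -- K < 2 the factor in front of the offline profit is nonpositive.
  competitive : (B₀ : ℕ) → 2 ℕ.≤ B₀ → (I : Instance B₀) →
    Σ (OnlineAlgorithm I) λ A → (1# - fromℕ 12 * (log B₀ / √ B₀)) * offlineProfit I ≤ onlineProfit I A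
  competitive B₀ 2≤B₀ I with integer-√ B₀
  ... | K , K²≤B₀ , B₀<[1+K]² = greedyAlgorithm I ,
    subst ((1# - loss) * offlineProfit I ≤_) (sym (onlineProfit-greedy I)) (bound (2 ℕ.≤? K))
    where
    open Instance I
    w : Carrier
    w = √ B₀
    0<√ : 0# < w
    0<√ = <-≤-trans 0<1 (subst (_≤ w) fromℕ-1 (k≤√n {1} {B₀} (ℕ.≤-trans (ℕ.s≤s ℕ.z≤n) 2≤B₀)))
    √≤ : w ≤ fromℕ (suc K)
    √≤ = √n≤k {suc K} {B₀} B₀<[1+K]²
    loss : Carrier
    loss = fromℕ 12 * (log B₀ / w)

    6≤√loss : fromℕ 6 ≤ w * loss
    6≤√loss = *-nonNeg (0≤fromℕ 12) (0≤y-x (½≤log 2≤B₀)) ≤-via trans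
      (trans (solve 3 (λ w l i → w :* (:ℕ 12 :* (l :* i)) := :ℕ 12 :* (l :* (w :* i))) refl w (log B₀) (w ⁻¹))
        (cong (λ u → fromℕ 12 * (log B₀ * u)) (*-inverse 0<√)))
      (trans (solve 2 (λ l h → :ℕ 12 :* (l :* :1) := :ℕ 6 :* (:ℕ 2 :* h) :+ :ℕ 12 :* (l :- h)) refl (log B₀) ½)
        (cong (_+ fromℕ 12 * (log B₀ - ½)) (trans (cong (fromℕ 6 *_) (*-inverse (0<fromℕ 1))) (*-identityʳ _))))

    bound : Dec (2 ℕ.≤ K) → (1# - loss) * offlineProfit I ≤ V I T B₀
    bound (no 2≰K) = ≤-trans (*-nonNeg (0≤y-x 1≤loss) (offlineProfit-nonNeg I)
        ≤-via solve 2 (λ l o → :0 := (:1 :- l) :* o :+ (l :- :1) :* o) refl loss (offlineProfit I)) (V-nonNeg I T B₀)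
      where
      1≤loss : 1# ≤ loss
      1≤loss = *-cancelˡ-≤ 0<√ (subst (_≤ w * loss) (sym (*-identityʳ w))
        (≤-trans √≤ (≤-trans (fromℕ-mono (ℕ.≤-trans (ℕ.≰⇒> 2≰K) (ℕ.m≤m+n 2 4))) 6≤√loss)))
    bound (yes 2≤K) = ≤-trans
      (*-nonNeg (0≤y-x 3κ≤loss) (offlineProfit-nonNeg I)
        ≤-via solve 3 (λ l k o → (:1 :- :ℕ 3 :* k) :* o := (:1 :- l) :* o :+ (l :- :ℕ 3 :* k) :* o) refl loss κ (offlineProfit I))
      ([1-3κ]OPT≤V I K 2≤K K²≤B₀ 0≤κ κK≡1)
      where
      κ : Carrier
      κ = fromℕ K ⁻¹
      0<K : 0# < fromℕ K
      0<K = <-≤-trans (0<fromℕ 1) (fromℕ-mono 2≤K)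
      0≤κ : 0# ≤ κ
      0≤κ = ⁻¹-nonNeg 0<K
      κK≡1 : κ * fromℕ K ≡ 1#
      κK≡1 = trans (*-comm _ _) (*-inverse 0<K)
      √κ≤2 : w * κ ≤ fromℕ 2
      √κ≤2 = ≤-trans (subst (_≤ κ * fromℕ (suc K)) (*-comm κ w) (*-monoˡ-≤ 0≤κ √≤)) [1+K]κ≤2
        where
        κ≤1 : κ ≤ 1#
        κ≤1 = subst₂ _≤_ (trans (cong (κ *_) fromℕ-1) (*-identityʳ κ)) κK≡1 (*-monoˡ-≤ 0≤κ (fromℕ-mono (ℕ.≤-trans (ℕ.s≤s ℕ.z≤n) 2≤K)))
        [1+K]κ≤2 : κ * fromℕ (suc K) ≤ fromℕ 2
        [1+K]κ≤2 = 0≤y-x κ≤1 ≤-via trans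
          (solve 1 (λ κ → :ℕ 2 := (κ :+ :1) :+ (:1 :- κ)) refl κ)
          (cong (_+ (1# - κ)) (trans (cong (κ +_) (sym κK≡1)) (solve 2 (λ κ k → κ :+ κ :* k := κ :* (:1 :+ k)) refl κ (fromℕ K))))
      3κ≤loss : fromℕ 3 * κ ≤ loss
      3κ≤loss = *-cancelˡ-≤ 0<√ (≤-trans
        (*-nonNeg (0≤fromℕ 3) (0≤y-x √κ≤2) ≤-via solve 2 (λ w κ → :ℕ 6 := w :* (:ℕ 3 :* κ) :+ :ℕ 3 :* (:ℕ 2 :- w :* κ)) refl w κ) 6≤√loss)

-- Proof of (b): value functions of the three-price problem and tails of the random walk.

-- Each request is high, low or medium with probabilities h, h and m.
module ThreePrices (ℛ : Reals) (h : Reals.Carrier ℛ) where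
  open OrderedField ℛ

  m : Carrier
  m = 1# - (h + h)

  open Max totalOrder using (_⊔_; x≤x⊔y; x≤y⊔x; ⊔-lub; ⊔-sel)

  isNonPos : Carrier → Carrier
  isNonPos x with x ≤? 0#
  ... | yes _ = 1#
  ... | no  _ = 0#

  isNonPos-yes : ∀ {x} → x ≤ 0# → isNonPos x ≡ 1#
  isNonPos-yes {x} x≤0 with x ≤? 0#
  ... | yes _  = refl
  ... | no x≰0 = contradiction x≤0 x≰0

  isNonPos-no : ∀ {x} → 0# < x → isNonPos x ≡ 0#
  isNonPos-no {x} 0<x with x ≤? 0#
  ... | yes x≤0 = contradiction x≤0 (<⇒≱ 0<x)
  ... | no  _   = refl

  -- With H high, L low and M medium requests among τ, tail τ x is both ℙ(H - L - M ≥ x) and ℙ(L - H - M ≥ x).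
  tail : ℕ → Carrier → Carrier
  tail zero    x = isNonPos x
  tail (suc τ) x = h * tail τ (x - 1#) + (h + m) * tail τ (x + 1#)

  average : ∀ a b → a ≡ b → h * a + (h + m) * b ≡ b
  average a b refl = solve 2 (λ h a → h :* a :+ (h :+ (:1 :- (h :+ h))) :* a := a) refl h a

  tail-certain : ∀ τ {x} → x + fromℕ τ ≤ 0# → tail τ x ≡ 1#
  tail-certain zero    {x} x+τ≤0 = isNonPos-yes (subst (_≤ 0#) (+-identityʳ x) x+τ≤0)
  tail-certain (suc τ) {x} x+τ≤0 = trans (average _ _ (trans (tail-certain τ lower) (sym upper))) upper
    where
    lower : x - 1# + fromℕ τ ≤ 0#
    lower = ≤-trans (+-nonNeg 0≤1 0≤1 ≤-via solve 2 (λ x t → x :+ (:1 :+ t) := (x :- :1 :+ t) :+ (:1 :+ :1)) refl x (fromℕ τ)) x+τ≤0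
    upper : tail τ (x + 1#) ≡ 1#
    upper = tail-certain τ (subst (_≤ 0#) (sym (+-assoc x 1# (fromℕ τ))) x+τ≤0)

  tail-impossible : ∀ τ {x} → fromℕ τ < x → tail τ x ≡ 0#
  tail-impossible zero    0<x = isNonPos-no 0<x
  tail-impossible (suc τ) {x} τ<x = trans (average _ _ (trans lower (sym upper))) upper
    where
    shift : ∀ {u v} c → u < v → u + c < v + c
    shift {u} {v} c u<v = ≰⇒> λ v+c≤u+c → <⇒≱ u<v (0≤y-x v+c≤u+c
      ≤-via solve 3 (λ u v c → u := v :+ ((u :+ c) :- (v :+ c))) refl u v c)
    τ<x-1 : fromℕ τ < x - 1#
    τ<x-1 = subst (_< x - 1#) (solve 1 (λ t → (:1 :+ t) :- :1 := t) refl (fromℕ τ)) (shift (- 1#) τ<x)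
    lower : tail τ (x - 1#) ≡ 0#
    lower = tail-impossible τ τ<x-1
    upper : tail τ (x + 1#) ≡ 0#
    upper = tail-impossible τ (<-≤-trans τ<x-1 (+-nonNeg 0≤1 0≤1 ≤-via solve 1 (λ x → x :+ :1 := (x :- :1) :+ (:1 :+ :1)) refl x))

  -- The optimal online value with τ requests remaining and k copies in stock; the prices are 2, 0, 1.
  online : ℕ → ℕ → Carrier
  online zero    k       = 0#
  online (suc τ) zero    = 0#
  online (suc τ) (suc k) = h * (fromℕ 2 + online τ k) + h * online τ (suc k) + m * ((1# + online τ k) ⊔ online τ (suc k))

  online-zero : ∀ τ → online τ zero ≡ 0#
  online-zero zero    = refl
  online-zero (suc τ) = refl

  mix-shift : ∀ c x y z → h * (c + x) + h * (c + y) + m * (c + z) ≡ c + (h * x + h * y + m * z)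
  mix-shift c x y z = solve 5 (λ h c x y z → let m = :1 :- (h :+ h) in
    h :* (c :+ x) :+ h :* (c :+ y) :+ m :* (c :+ z) := c :+ (h :* x :+ h :* y :+ m :* z)) refl h c x y z

  -- As H + L + M = τ, `high τ k` is ℙ(H > k) and `low τ k` is ℙ(H + M ≤ k). Written as values of
  -- one tail function, both are bounded by one moment estimate.
  high low : ℕ → ℕ → Carrier
  high τ k = tail τ (fromℕ 2 * fromℕ (suc k) - fromℕ τ)
  low  τ k = tail τ (fromℕ τ - fromℕ 2 * fromℕ k)

  -- The expected offline value of selling only to high and medium requests.
  offline : ℕ → ℕ → Carrier
  offline zero    k       = 0#
  offline (suc τ) zero    = 0#
  offline (suc τ) (suc k) = h * (fromℕ 2 + offline τ k) + h * offline τ (suc k) + m * (offline τ (suc k) + low τ k)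

  offline-zero : ∀ τ → offline τ zero ≡ 0#
  offline-zero zero    = refl
  offline-zero (suc τ) = refl

  0<2 : 0# < fromℕ 2
  0<2 = 0<fromℕ 1

  +-pos : ∀ {x y} → 0# ≤ x → 0# < y → 0# < x + y
  +-pos {x} {y} 0≤x 0<y = <-≤-trans 0<y (0≤x ≤-via +-comm x y)

  high-zero : ∀ τ → high (suc τ) 0 ≡ h * 1# + (h + m) * high τ 0
  high-zero τ = cong₂ (λ u v → h * u + (h + m) * v)
    (tail-certain τ (≤-reflexive (solve 1 (λ t → :ℕ 2 :* (:1 :+ :0) :- (:1 :+ t) :- :1 :+ t := :0) refl (fromℕ τ))))
    (cong (tail τ) (solve 1 (λ t → :ℕ 2 :* (:1 :+ :0) :- (:1 :+ t) :+ :1 := :ℕ 2 :* (:1 :+ :0) :- t) refl (fromℕ τ)))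

  high-suc : ∀ τ k → high (suc τ) (suc k) ≡ h * high τ k + (h + m) * high τ (suc k)
  high-suc τ k = cong₂ (λ u v → h * tail τ u + (h + m) * tail τ v)
    (solve 2 (λ t k → :ℕ 2 :* (:1 :+ (:1 :+ k)) :- (:1 :+ t) :- :1 := :ℕ 2 :* (:1 :+ k) :- t) refl (fromℕ τ) (fromℕ k))
    (solve 2 (λ t k → :ℕ 2 :* (:1 :+ (:1 :+ k)) :- (:1 :+ t) :+ :1 := :ℕ 2 :* (:1 :+ (:1 :+ k)) :- t) refl (fromℕ τ) (fromℕ k))

  low-zero : ∀ τ → low (suc τ) 0 ≡ h * low τ 0 + (h + m) * 0#
  low-zero τ = cong₂ (λ u v → h * u + (h + m) * v)
    (cong (tail τ) (solve 1 (λ t → (:1 :+ t) :- :ℕ 2 :* :0 :- :1 := t :- :ℕ 2 :* :0) refl (fromℕ τ)))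
    (tail-impossible τ (<-≤-trans (≰⇒> λ t+1≤t → <⇒≱ 0<1 (0≤y-x t+1≤t ≤-via solve 1 (λ t → :0 := :1 :+ (t :- (t :+ :1))) refl (fromℕ τ)))
      (0≤1 ≤-via solve 1 (λ t → (:1 :+ t) :- :ℕ 2 :* :0 :+ :1 := (t :+ :1) :+ :1) refl (fromℕ τ))))

  low-suc : ∀ τ k → low (suc τ) (suc k) ≡ h * low τ (suc k) + (h + m) * low τ k
  low-suc τ k = cong₂ (λ u v → h * tail τ u + (h + m) * tail τ v)
    (solve 2 (λ t k → (:1 :+ t) :- :ℕ 2 :* (:1 :+ k) :- :1 := t :- :ℕ 2 :* (:1 :+ k)) refl (fromℕ τ) (fromℕ k))
    (solve 2 (λ t k → (:1 :+ t) :- :ℕ 2 :* (:1 :+ k) :+ :1 := t :- :ℕ 2 :* k) refl (fromℕ τ) (fromℕ k))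

  -- The (k+1)-st copy earns 2 if H > k, nothing if H + M ≤ k, and 1 otherwise.
  offline-marginal : ∀ τ k → offline τ (suc k) ≡ offline τ k + (1# + high τ k - low τ k)
  offline-marginal zero k = sym (trans
    (cong₂ (λ u v → 0# + (1# + u - v))
      (isNonPos-no (subst (0# <_) (solve 1 (λ k → :ℕ 2 :* k :+ :ℕ 2 := :ℕ 2 :* (:1 :+ k) :- :0) refl (fromℕ k))
        (+-pos (*-nonNeg (0≤fromℕ 2) (0≤fromℕ k)) 0<2)))
      (isNonPos-yes (*-nonNeg (0≤fromℕ 2) (0≤fromℕ k) ≤-via solve 1 (λ k → :0 := (:0 :- :ℕ 2 :* k) :+ :ℕ 2 :* k) refl (fromℕ k))))
    (solve 0 (:0 :+ (:1 :+ :0 :- :1) := :0) refl))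
  offline-marginal (suc τ) zero = trans
    (cong₂ (λ u v → h * (fromℕ 2 + u) + h * v + m * (v + low τ 0)) (offline-zero τ)
      (trans (offline-marginal τ zero) (cong (_+ (1# + high τ 0 - low τ 0)) (offline-zero τ))))
    (trans (solve 3 (λ h a b → let m = :1 :- (h :+ h) in
        h :* (:ℕ 2 :+ :0) :+ h :* (:0 :+ (:1 :+ a :- b)) :+ m :* (:0 :+ (:1 :+ a :- b) :+ b)
        := :0 :+ (:1 :+ (h :* :1 :+ (h :+ m) :* a) :- (h :* b :+ (h :+ m) :* :0))) refl h (high τ 0) (low τ 0))
      (cong₂ (λ u v → 0# + (1# + u - v)) (sym (high-zero τ)) (sym (low-zero τ))))
  offline-marginal (suc τ) (suc k) = trans
    (trans (cong₂ (λ u v → h * (fromℕ 2 + u) + h * v + m * (v + low τ (suc k))) (offline-marginal τ k) (offline-marginal τ (suc k)))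
      (solve 7 (λ h o o′ a b a′ b′ → let m = :1 :- (h :+ h) in
        h :* (:ℕ 2 :+ (o :+ (:1 :+ a :- b))) :+ h :* (o′ :+ (:1 :+ a′ :- b′)) :+ m :* (o′ :+ (:1 :+ a′ :- b′) :+ b′)
        := (h :* (:ℕ 2 :+ o) :+ h :* o′ :+ m :* (o′ :+ b)) :+ (:1 :+ (h :* a :+ (h :+ m) :* a′) :- (h :* b′ :+ (h :+ m) :* b)))
        refl h (offline τ k) (offline τ (suc k)) (high τ k) (low τ k) (high τ (suc k)) (low τ (suc k))))
    (cong₂ (λ u v → offline (suc τ) (suc k) + (1# + u - v)) (sym (high-suc τ k)) (sym (low-suc τ k)))

  -- Compared with the offline value `offline τ (suc k) + low τ k` at a medium request, selling
  -- loses ℙ(H > k), the chance that a high request misses its copy; skipping loses ℙ(H + M ≤ k),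
  -- the chance that the copy stays unsold.
  sell-medium : ∀ τ k → 1# + offline τ k ≡ offline τ (suc k) + low τ k - high τ k
  sell-medium τ k = trans (solve 3 (λ o a b → :1 :+ o := (o :+ (:1 :+ a :- b)) :+ b :- a) refl (offline τ k) (high τ k) (low τ k))
    (cong (λ u → u + low τ k - high τ k) (sym (offline-marginal τ k)))

  module _ (0≤h : 0# ≤ h) (0≤m : 0# ≤ m) where
    tail-nonNeg : ∀ τ x → 0# ≤ tail τ x
    tail-nonNeg zero    x with x ≤? 0#
    ... | yes _ = 0≤1
    ... | no  _ = ≤-refl
    tail-nonNeg (suc τ) x = +-nonNeg (*-nonNeg 0≤h (tail-nonNeg τ (x - 1#))) (*-nonNeg (+-nonNeg 0≤h 0≤m) (tail-nonNeg τ (x + 1#)))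

    -- Second and fourth moments: w² - λ w⁴ ≤ s when 4 λ s = 1, so for the walk with steps 1, -1, 0 started
    -- at w and the number j of its steps 0, E[W² - 2 (J² + a²) - λ W⁴] ≤ s ℙ(|W| ≥ J + a).
    module _ (a : Carrier) {s ƛ : Carrier} (0≤ƛ : 0# ≤ ƛ) (0≤s : 0# ≤ s) (4ƛs≡1 : fromℕ 4 * ƛ * s ≡ 1#) where
      -- A lower bound for that expectation after τ steps: the variance of J is rounded up to τm,
      -- and E W⁴ to w⁴ + 6w²τ + 3τ². Hence it satisfies the submartingale inequality `moments-suc`.
      moments : ℕ → Carrier → Carrier → Carrier
      moments τ w j = w * w + fromℕ τ * (1# - m) - fromℕ 2 * ((j + fromℕ τ * m) * (j + fromℕ τ * m) + fromℕ τ * m + a * a)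
        - ƛ * (w * w * (w * w) + fromℕ 6 * (w * w) * fromℕ τ + fromℕ 3 * fromℕ τ * fromℕ τ)

      -- From 4ƛs = 1 follows s - w² + ƛw⁴ = ƛ(w² - 2s)².
      moments-zero-upper : ∀ w j → moments 0 w j ≤ s
      moments-zero-upper w j = subst (moments 0 w j ≤_)
        (trans (cong (λ u → (1# - u) * (w * w) + u * s) 4ƛs≡1) (solve 2 (λ s w → (:1 :- :1) :* w :+ :1 :* s := s) refl s (w * w)))
        (+-nonNeg (*-nonNeg (0≤fromℕ 2) (+-nonNeg (square-nonNeg j) (square-nonNeg a)))
                  (*-nonNeg 0≤ƛ (square-nonNeg (w * w - fromℕ 2 * s)))
          ≤-via solve 6 (λ w j m a l s →
            (:1 :- :ℕ 4 :* l :* s) :* (w :* w) :+ :ℕ 4 :* l :* s :* s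
            := (w :* w :+ :0 :* (:1 :- m) :- :ℕ 2 :* ((j :+ :0 :* m) :* (j :+ :0 :* m) :+ :0 :* m :+ a :* a)
                 :- l :* (w :* w :* (w :* w) :+ :ℕ 6 :* (w :* w) :* :0 :+ :ℕ 3 :* :0 :* :0))
               :+ (:ℕ 2 :* (j :* j :+ a :* a) :+ l :* ((w :* w :- :ℕ 2 :* s) :* (w :* w :- :ℕ 2 :* s))))
            refl w j m a ƛ s)

      -- If |w| ≤ j + a then w² ≤ (j + a)² ≤ 2(j² + a²).
      moments-zero-nonPos : ∀ w j → 0# ≤ j + a - w → 0# ≤ j + a + w → moments 0 w j ≤ 0#
      moments-zero-nonPos w j 0≤x 0≤y =
        +-nonNeg (*-nonNeg 0≤x 0≤y) (+-nonNeg (square-nonNeg (j - a)) (*-nonNeg 0≤ƛ (square-nonNeg (w * w))))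
        ≤-via solve 5 (λ w j m a l → :0
            := (w :* w :+ :0 :* (:1 :- m) :- :ℕ 2 :* ((j :+ :0 :* m) :* (j :+ :0 :* m) :+ :0 :* m :+ a :* a)
                 :- l :* (w :* w :* (w :* w) :+ :ℕ 6 :* (w :* w) :* :0 :+ :ℕ 3 :* :0 :* :0))
               :+ ((j :+ a :- w) :* (j :+ a :+ w) :+ ((j :- a) :* (j :- a) :+ l :* (w :* w :* (w :* w)))))
          refl w j m a ƛ

      moments-suc : ∀ τ w j → moments (suc τ) w j
        ≤ h * moments τ (w + 1#) j + h * moments τ (w - 1#) j + m * moments τ w (j + 1#)
      moments-suc τ w j =
        +-nonNeg (*-nonNeg (0≤fromℕ 2) (*-nonNeg 0≤m 0≤m))
          (*-nonNeg 0≤ƛ (+-nonNeg (0≤fromℕ 2) (*-nonNeg 0≤m (+-nonNeg (+-nonNeg (*-nonNeg (0≤fromℕ 6) (square-nonNeg w)) 0≤1)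
            (*-nonNeg (0≤fromℕ 6) (0≤fromℕ τ))))))
        ≤-via solve 6 (λ t w j h a l →
            let m = :1 :- (h :+ h)
                M = λ t w j → w :* w :+ t :* (:1 :- m) :- :ℕ 2 :* ((j :+ t :* m) :* (j :+ t :* m) :+ t :* m :+ a :* a)
                  :- l :* (w :* w :* (w :* w) :+ :ℕ 6 :* (w :* w) :* t :+ :ℕ 3 :* t :* t)
            in h :* M t (w :+ :1) j :+ h :* M t (w :- :1) j :+ m :* M t w (j :+ :1)
               := M (:1 :+ t) w j :+ (:ℕ 2 :* (m :* m) :+ l :* (:ℕ 2 :+ m :* (:ℕ 6 :* (w :* w) :+ :1 :+ :ℕ 6 :* t))))
          refl (fromℕ τ) w j h a ƛ

      -- Steps 1, -1, 0 are high, low and medium requests. They move the thresholds j+a-w and j+a+w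
      -- by ±1 exactly as in the recursion of `tail`, so the two tails are the chances of W ≥ J + a
      -- and of -W ≥ J + a.
      moments≤tails : ∀ τ w j → moments τ w j ≤ s * (tail τ (j + a - w) + tail τ (j + a + w))
      moments≤tails zero w j with j + a - w ≤? 0# | j + a + w ≤? 0#
      ... | yes _   | yes _   = ≤-trans (moments-zero-upper w j) (0≤s ≤-via solve 1 (λ s → s :* (:1 :+ :1) := s :+ s) refl s)
      ... | yes _   | no  _   = ≤-trans (moments-zero-upper w j) (≤-reflexive (solve 1 (λ s → s := s :* (:1 :+ :0)) refl s))
      ... | no  _   | yes _   = ≤-trans (moments-zero-upper w j) (≤-reflexive (solve 1 (λ s → s := s :* (:0 :+ :1)) refl s))
      ... | no  x≰0 | no  y≰0 = ≤-trans (moments-zero-nonPos w j (≰⇒≥ x≰0) (≰⇒≥ y≰0))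
                                  (≤-reflexive (solve 1 (λ s → :0 := s :* (:0 :+ :0)) refl s))
      moments≤tails (suc τ) w j = ≤-trans (moments-suc τ w j) (≤-trans
        (+-mono-≤ (+-mono-≤
            (*-monoˡ-≤ 0≤h (subst₂ (λ u v → moments τ (w + 1#) j ≤ s * (tail τ u + tail τ v)) eq₁ eq₂ (moments≤tails τ (w + 1#) j)))
            (*-monoˡ-≤ 0≤h (subst₂ (λ u v → moments τ (w - 1#) j ≤ s * (tail τ u + tail τ v)) eq₃ eq₄ (moments≤tails τ (w - 1#) j))))
            (*-monoˡ-≤ 0≤m (subst₂ (λ u v → moments τ w (j + 1#) ≤ s * (tail τ u + tail τ v)) eq₅ eq₆ (moments≤tails τ w (j + 1#)))))
        (≤-reflexive (solve 7 (λ h m s a b c d →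
            h :* (s :* (a :+ d)) :+ h :* (s :* (b :+ c)) :+ m :* (s :* (b :+ d))
            := s :* ((h :* a :+ (h :+ m) :* b) :+ (h :* c :+ (h :+ m) :* d)))
          refl h m s (tail τ (x - 1#)) (tail τ (x + 1#)) (tail τ (y - 1#)) (tail τ (y + 1#)))))
        where
        x y : Carrier
        x = j + a - w
        y = j + a + w
        eq₁ : j + a - (w + 1#) ≡ x - 1#
        eq₁ = solve 3 (λ j a w → j :+ a :- (w :+ :1) := j :+ a :- w :- :1) refl j a w
        eq₂ : j + a + (w + 1#) ≡ y + 1#
        eq₂ = solve 3 (λ j a w → j :+ a :+ (w :+ :1) := j :+ a :+ w :+ :1) refl j a w
        eq₃ : j + a - (w - 1#) ≡ x + 1#
        eq₃ = solve 3 (λ j a w → j :+ a :- (w :- :1) := j :+ a :- w :+ :1) refl j a w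
        eq₄ : j + a + (w - 1#) ≡ y - 1#
        eq₄ = solve 3 (λ j a w → j :+ a :+ (w :- :1) := j :+ a :+ w :- :1) refl j a w
        eq₅ : j + 1# + a - w ≡ x + 1#
        eq₅ = solve 3 (λ j a w → j :+ :1 :+ a :- w := j :+ a :- w :+ :1) refl j a w
        eq₆ : j + 1# + a + w ≡ y + 1#
        eq₆ = solve 3 (λ j a w → j :+ :1 :+ a :+ w := j :+ a :+ w :+ :1) refl j a w

    mix : ∀ {x y z x′ y′ z′} → x ≤ x′ → y ≤ y′ → z ≤ z′ → h * x + h * y + m * z ≤ h * x′ + h * y′ + m * z′
    mix x≤ y≤ z≤ = +-mono-≤ (+-mono-≤ (*-monoˡ-≤ 0≤h x≤) (*-monoˡ-≤ 0≤h y≤)) (*-monoˡ-≤ 0≤m z≤)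

    online-nonNeg : ∀ τ k → 0# ≤ online τ k
    online-nonNeg zero    k       = ≤-refl
    online-nonNeg (suc τ) zero    = ≤-refl
    online-nonNeg (suc τ) (suc k) = +-nonNeg (+-nonNeg (*-nonNeg 0≤h (+-nonNeg (0≤fromℕ 2) (online-nonNeg τ k)))
      (*-nonNeg 0≤h (online-nonNeg τ (suc k)))) (*-nonNeg 0≤m (≤-trans (online-nonNeg τ (suc k)) (x≤y⊔x _ _)))

    online-mono : ∀ τ k → online τ k ≤ online τ (suc k)
    online-mono zero    k       = ≤-refl
    online-mono (suc τ) zero    = online-nonNeg (suc τ) 1
    online-mono (suc τ) (suc k) = mix (+-monoʳ-≤ (fromℕ 2) (online-mono τ k)) (online-mono τ (suc k))
      (⊔-lub (≤-trans (+-monoʳ-≤ 1# (online-mono τ k)) (x≤x⊔y _ _)) (≤-trans (online-mono τ (suc k)) (x≤y⊔x _ _)))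

    -- No copy brings more than the top price 2; hence selling to a high request is never worse than
    -- skipping it.
    online-lipschitz : ∀ τ k → online τ (suc k) ≤ fromℕ 2 + online τ k
    online-lipschitz zero    k       = +-nonNeg (0≤fromℕ 2) ≤-refl
    online-lipschitz (suc τ) (suc k) = subst (online (suc τ) (suc (suc k)) ≤_) (mix-shift (fromℕ 2) _ _ _)
      (mix (+-monoʳ-≤ (fromℕ 2) (online-lipschitz τ k)) (online-lipschitz τ (suc k))
        (⊔-lub
          (≤-trans (+-monoʳ-≤ 1# (online-lipschitz τ k)) (≤-trans (≤-reflexive (solve 1 (λ v → :1 :+ (:ℕ 2 :+ v) := :ℕ 2 :+ (:1 :+ v)) refl (online τ k)))
            (+-monoʳ-≤ (fromℕ 2) (x≤x⊔y _ _))))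
          (≤-trans (online-lipschitz τ (suc k)) (+-monoʳ-≤ (fromℕ 2) (x≤y⊔x _ _)))))
    online-lipschitz (suc τ) zero    = subst (online (suc τ) 1 ≤_)
      (trans (cong (λ u → h * (fromℕ 2 + u) + h * (fromℕ 2 + u) + m * (fromℕ 2 + u)) (online-zero τ))
        (trans (mix-shift (fromℕ 2) 0# 0# 0#) (solve 2 (λ h m → :ℕ 2 :+ (h :* :0 :+ h :* :0 :+ m :* :0) := :ℕ 2 :+ :0) refl h m)))
      (mix ≤-refl (online-lipschitz τ zero)
        (⊔-lub (0≤1 ≤-via solve 1 (λ v → :ℕ 2 :+ v := (:1 :+ v) :+ :1) refl (online τ 0)) (online-lipschitz τ zero)))

    online≤offline : ∀ τ k → online τ k ≤ offline τ k
    online≤offline zero    k       = ≤-refl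
    online≤offline (suc τ) zero    = ≤-refl
    online≤offline (suc τ) (suc k) = mix (+-monoʳ-≤ (fromℕ 2) (online≤offline τ k)) (online≤offline τ (suc k))
      (⊔-lub
        (≤-trans (+-monoʳ-≤ 1# (online≤offline τ k)) (≤-trans (≤-reflexive (sell-medium τ k))
          (tail-nonNeg τ _ ≤-via solve 2 (λ u a → u := (u :- a) :+ a) refl (offline τ (suc k) + low τ k) (high τ k))))
        (≤-trans (online≤offline τ (suc k)) (tail-nonNeg τ _ ≤-via refl)))

    module _ (n : ℕ) (16≤n : 16 ℕ.≤ n) {ν : Carrier} (ν*n≡1 : ν * fromℕ n ≡ 1#)
             (32m≤1 : fromℕ 32 * m ≤ 1#) (256nm²≤1 : fromℕ 256 * (fromℕ n * (m * m)) ≤ 1#) where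
      private
        ñ s ƛ : Carrier
        ñ = fromℕ n
        -- With s = 4n and ƛ = 1/(16n), the fourth-moment term 3ƛτ² is at most 3τ/8 for τ ≤ 2n, so
        -- less than half of the variance is spent on it.
        s = fromℕ 4 * ñ
        ƛ = ν * fromℕ 16 ⁻¹

      0<n : 0# < ñ
      0<n = <-≤-trans (0<fromℕ 15) (fromℕ-mono 16≤n)

      0≤ν : 0# ≤ ν
      0≤ν = *-cancelˡ-≤ 0<n (subst₂ _≤_ (sym (zeroʳ ñ)) (sym (trans (*-comm ñ ν) ν*n≡1)) 0≤1)

      private
        16ƛ≡ν : fromℕ 16 * ƛ ≡ ν
        16ƛ≡ν = trans (solve 3 (λ c v i → c :* (v :* i) := v :* (c :* i)) refl (fromℕ 16) ν (fromℕ 16 ⁻¹))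
          (trans (cong (ν *_) (*-inverse (0<fromℕ 15))) (*-identityʳ ν))
        0≤ƛ : 0# ≤ ƛ
        0≤ƛ = *-nonNeg 0≤ν (⁻¹-nonNeg (0<fromℕ 15))
        0≤s : 0# ≤ s
        0≤s = *-nonNeg (0≤fromℕ 4) (0≤fromℕ n)
        4ƛs≡1 : fromℕ 4 * ƛ * s ≡ 1#
        4ƛs≡1 = trans (solve 2 (λ l n → :ℕ 4 :* l :* (:ℕ 4 :* n) := :ℕ 16 :* l :* n) refl ƛ ñ)
          (trans (cong (_* ñ) 16ƛ≡ν) ν*n≡1)

      -- Started from w = j = 0 the two tails coincide, and `moments` is at least τ/2 - 2a² ≥ n/2 -
      -- 4E² - 4. After multiplication by 16, n ≥ 16 absorbs the constant.
      tail-lower : ∀ τ → n ℕ.≤ τ → τ ℕ.≤ n ℕ.+ n → ∀ a E → a * a ≤ fromℕ 2 * (E * E) + fromℕ 2 →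
                   fromℕ 4 - fromℕ 64 * ν * (E * E) ≤ fromℕ 128 * tail τ a
      tail-lower τ n≤τ τ≤2n a E a²≤ = *-cancelˡ-≤ 0<n (subst (_≤ ñ * (fromℕ 128 * tail τ a))
        (trans (cong (λ u → fromℕ 4 * ñ - fromℕ 64 * (u * (E * E))) (sym ν*n≡1))
          (solve 3 (λ v n e → :ℕ 4 :* n :- :ℕ 64 :* (v :* n :* e) := n :* (:ℕ 4 :- :ℕ 64 :* v :* e)) refl ν ñ (E * E)))
        (≤-trans drift
          (subst (fromℕ 16 * moments a 0≤ƛ 0≤s 4ƛs≡1 τ 0# 0# ≤_)
            (trans (cong₂ (λ u v → fromℕ 16 * (s * (tail τ u + tail τ v))) (solve 1 (λ a → :0 :+ a :- :0 := a) refl a) (solve 1 (λ a → :0 :+ a :+ :0 := a) refl a))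
              (solve 2 (λ n t → :ℕ 16 :* (:ℕ 4 :* n :* (t :+ t)) := n :* (:ℕ 128 :* t)) refl ñ (tail τ a)))
            (*-monoˡ-≤ (0≤fromℕ 16) (moments≤tails a 0≤ƛ 0≤s 4ƛs≡1 τ 0# 0#)))))
        where
        t : Carrier
        t = fromℕ τ
        n≤t : ñ ≤ t
        n≤t = fromℕ-mono n≤τ
        t≤2n : t ≤ ñ + ñ
        t≤2n = subst (t ≤_) (fromℕ-+ n n) (fromℕ-mono τ≤2n)
        0≤t : 0# ≤ t
        0≤t = 0≤fromℕ τ
        νt≤2 : ν * t ≤ fromℕ 2
        νt≤2 = ≤-trans (*-monoˡ-≤ 0≤ν t≤2n) (≤-reflexive (trans (solve 2 (λ v n → v :* (n :+ n) := :ℕ 2 :* (v :* n)) refl ν ñ)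
          (trans (cong (fromℕ 2 *_) ν*n≡1) (*-identityʳ _))))
        slack : 0# ≤ fromℕ 64 - fromℕ 384 * m - fromℕ 256 * t * (m * m) - fromℕ 24 * (ν * t)
        slack = +-nonNeg (*-nonNeg (0≤fromℕ 12) (0≤y-x 32m≤1)) (+-nonNeg (*-nonNeg (0≤fromℕ 2) (0≤y-x 256nm²≤1))
            (+-nonNeg (*-nonNeg (0≤fromℕ 24) (0≤y-x νt≤2)) (+-nonNeg (*-nonNeg (*-nonNeg (0≤fromℕ 256) (0≤y-x t≤2n)) (*-nonNeg 0≤m 0≤m)) (0≤fromℕ 2))))
          ≤-via solve 4 (λ h v n t → let m = :1 :- (h :+ h) in
              :ℕ 64 :- :ℕ 384 :* m :- :ℕ 256 :* t :* (m :* m) :- :ℕ 24 :* (v :* t)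
              := :0 :+ (:ℕ 12 :* (:1 :- :ℕ 32 :* m) :+ (:ℕ 2 :* (:1 :- :ℕ 256 :* (n :* (m :* m)))
                 :+ (:ℕ 24 :* (:ℕ 2 :- v :* t) :+ (:ℕ 256 :* ((n :+ n) :- t) :* (m :* m) :+ :ℕ 2))))) refl h ν ñ t
        -- At w = j = 0, `moments` equals τ/2 - 2a² plus τ/2 times this quantity.
        halfSlack : 0# ≤ 1# - fromℕ 6 * m - fromℕ 4 * t * (m * m) - fromℕ 6 * ƛ * t
        halfSlack = *-cancelˡ-≤ (0<fromℕ 63) (subst₂ _≤_ (sym (zeroʳ (fromℕ 64)))
          (trans (cong (λ u → fromℕ 64 - fromℕ 384 * m - fromℕ 256 * t * (m * m) - fromℕ 24 * (u * t)) (sym 16ƛ≡ν))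
            (solve 3 (λ m t l → :ℕ 64 :- :ℕ 384 :* m :- :ℕ 256 :* t :* (m :* m) :- :ℕ 24 :* (:ℕ 16 :* l :* t)
                := :ℕ 64 :* (:1 :- :ℕ 6 :* m :- :ℕ 4 :* t :* (m :* m) :- :ℕ 6 :* l :* t)) refl m t ƛ))
          slack)
        drift : fromℕ 4 * ñ - fromℕ 64 * (1# * (E * E)) ≤ fromℕ 16 * moments a 0≤ƛ 0≤s 4ƛs≡1 τ 0# 0#
        drift = +-nonNeg (*-nonNeg (*-nonNeg (0≤fromℕ 8) 0≤t) halfSlack)
            (+-nonNeg (*-nonNeg (0≤fromℕ 32) (0≤y-x a²≤)) (+-nonNeg (*-nonNeg (0≤fromℕ 8) (0≤y-x n≤t))
              (*-nonNeg (0≤fromℕ 4) (0≤y-x (fromℕ-mono 16≤n)))))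
          ≤-via solve 6 (λ t n m l a E →
              :ℕ 16 :* (:0 :* :0 :+ t :* (:1 :- m) :- :ℕ 2 :* ((:0 :+ t :* m) :* (:0 :+ t :* m) :+ t :* m :+ a :* a)
                :- l :* (:0 :* :0 :* (:0 :* :0) :+ :ℕ 6 :* (:0 :* :0) :* t :+ :ℕ 3 :* t :* t))
              := :ℕ 4 :* n :- :ℕ 64 :* (:1 :* (E :* E))
                :+ (:ℕ 8 :* t :* (:1 :- :ℕ 6 :* m :- :ℕ 4 :* t :* (m :* m) :- :ℕ 6 :* l :* t)
                :+ (:ℕ 32 :* ((:ℕ 2 :* (E :* E) :+ :ℕ 2) :- a :* a) :+ (:ℕ 8 :* (t :- n) :+ :ℕ 4 :* (n :- :ℕ 16)))))
              refl t ñ m ƛ a E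

      module _ (J : ℕ) (256νJ²m²≤1 : fromℕ 256 * ν * (fromℕ J * m * (fromℕ J * m)) ≤ 1#)
               {w : Carrier} (0≤w : 0# ≤ w) (128w≡m : fromℕ 128 * w ≡ m)
               (τ₀ : ℕ) (n≤τ₀ : n ℕ.≤ τ₀) (J+τ₀≤2n : J ℕ.+ τ₀ ℕ.≤ n ℕ.+ n) where
        -- w * regret j e is a lower bound for the online loss over the next j requests
        -- when k copies and τ requests remain and 2 k - τ = e.
        regret : ℕ → Carrier → Carrier
        regret j e = fromℕ 3 * fromℕ j - fromℕ 128 * ν * fromℕ j * (e * e) - fromℕ 64 * ν * (fromℕ j * fromℕ j)

        -- A medium request costs mp ≥ w(4 - 64νe²). On average e² grows by 1, plus a drift ±2me
        -- produced by the decision on medium requests. The drift contributes ±256νjme, which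
        -- together with 64νe² is 64νu² - 256νj²m² for u = e ± 2jm; the hypothesis on Jm pays for
        -- the negative part.
        regret-step : ∀ j → j ℕ.≤ J → ∀ e e′ p → e′ ≡ e - 1# ⊎ e′ ≡ e + 1# →
          fromℕ 4 - fromℕ 64 * ν * (e * e) ≤ fromℕ 128 * p →
          w * regret (suc j) e ≤ h * (w * regret j (e - 1#)) + h * (w * regret j (e + 1#)) + m * (p + w * regret j e′)
        regret-step j j≤J e e′ p e′≡ p≥ = ≤-trans (bound e′≡) (≤-reflexive (cong (h * (w * regret j (e - 1#)) + h * (w * regret j (e + 1#)) +_)
            (trans (cong (λ u → u * p + m * (w * regret j e′)) 128w≡m) (sym (distribˡ m p _)))))
          where
          jm≤Jm : fromℕ j * m ≤ fromℕ J * m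
          jm≤Jm = subst₂ _≤_ (*-comm m _) (*-comm m _) (*-monoˡ-≤ 0≤m (fromℕ-mono j≤J))
          256νj²m²≤1 : fromℕ 256 * ν * (fromℕ j * m * (fromℕ j * m)) ≤ 1#
          256νj²m²≤1 = ≤-trans (*-monoˡ-≤ (*-nonNeg (0≤fromℕ 256) 0≤ν)
            (*-mono-≤ (*-nonNeg (0≤fromℕ j) 0≤m) (*-nonNeg (0≤fromℕ J) 0≤m) jm≤Jm jm≤Jm)) 256νJ²m²≤1
          gap : ∀ u → 0# ≤ w * (fromℕ 128 * p - (fromℕ 4 - fromℕ 64 * ν * (e * e)))
            + w * ((1# - fromℕ 256 * ν * (fromℕ j * m * (fromℕ j * m))) + fromℕ 64 * ν * (u * u + 1#))
          gap u = +-nonNeg (*-nonNeg 0≤w (0≤y-x p≥)) (*-nonNeg 0≤w (+-nonNeg (0≤y-x 256νj²m²≤1)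
            (*-nonNeg (*-nonNeg (0≤fromℕ 64) 0≤ν) (+-nonNeg (square-nonNeg u) 0≤1))))
          bound : ∀ {e′} → e′ ≡ e - 1# ⊎ e′ ≡ e + 1# → w * regret (suc j) e
            ≤ h * (w * regret j (e - 1#)) + h * (w * regret j (e + 1#)) + (fromℕ 128 * w * p + m * (w * regret j e′))
          bound (inj₁ refl) = gap (e + fromℕ 2 * (fromℕ j * m)) ≤-via solve 6 (λ h w p v j e →
            let m = :1 :- (h :+ h)
                r = λ j e → :ℕ 3 :* j :- :ℕ 128 :* v :* j :* (e :* e) :- :ℕ 64 :* v :* (j :* j)
                u = e :+ :ℕ 2 :* (j :* m)
            in h :* (w :* r j (e :- :1)) :+ h :* (w :* r j (e :+ :1)) :+ (:ℕ 128 :* w :* p :+ m :* (w :* r j (e :- :1)))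
              := w :* r (:1 :+ j) e :+ (w :* (:ℕ 128 :* p :- (:ℕ 4 :- :ℕ 64 :* v :* (e :* e)))
                :+ w :* ((:1 :- :ℕ 256 :* v :* (j :* m :* (j :* m))) :+ :ℕ 64 :* v :* (u :* u :+ :1))))
            refl h w p ν (fromℕ j) e
          bound (inj₂ refl) = gap (e - fromℕ 2 * (fromℕ j * m)) ≤-via solve 6 (λ h w p v j e →
            let m = :1 :- (h :+ h)
                r = λ j e → :ℕ 3 :* j :- :ℕ 128 :* v :* j :* (e :* e) :- :ℕ 64 :* v :* (j :* j)
                u = e :- :ℕ 2 :* (j :* m)
            in h :* (w :* r j (e :- :1)) :+ h :* (w :* r j (e :+ :1)) :+ (:ℕ 128 :* w :* p :+ m :* (w :* r j (e :+ :1)))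
              := w :* r (:1 :+ j) e :+ (w :* (:ℕ 128 :* p :- (:ℕ 4 :- :ℕ 64 :* v :* (e :* e)))
                :+ w :* ((:1 :- :ℕ 256 :* v :* (j :* m :* (j :* m))) :+ :ℕ 64 :* v :* (u :* u :+ :1))))
            refl h w p ν (fromℕ j) e

        -- Without copies both values are 0. Then |e| is the number t of remaining requests, and νt²
        -- ≥ 1 lets the term 128νje² outweigh 3j.
        regret-empty : ∀ j → let e = fromℕ 2 * 0# - fromℕ (suc j ℕ.+ τ₀) in w * regret (suc j) e ≤ 0#
        regret-empty j = *-nonNeg 0≤w (*-nonNeg (0≤fromℕ (suc j)) (+-nonNeg
            (+-nonNeg (*-nonNeg (0≤fromℕ 128) (0≤y-x 1≤νt²)) (0≤fromℕ 125)) (*-nonNeg (*-nonNeg (0≤fromℕ 64) 0≤ν) (0≤fromℕ (suc j)))))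
          ≤-via solve 4 (λ w j v t → :0
            := w :* (:ℕ 3 :* j :- :ℕ 128 :* v :* j :* ((:ℕ 2 :* :0 :- t) :* (:ℕ 2 :* :0 :- t)) :- :ℕ 64 :* v :* (j :* j))
              :+ w :* (j :* ((:ℕ 128 :* (v :* t :* t :- :1) :+ :ℕ 125) :+ :ℕ 64 :* v :* j))) refl w (fromℕ (suc j)) ν t
          where
          t : Carrier
          t = fromℕ (suc j ℕ.+ τ₀)
          n≤t : ñ ≤ t
          n≤t = fromℕ-mono (ℕ.≤-trans n≤τ₀ (ℕ.m≤n+m τ₀ (suc j)))
          1≤t : 1# ≤ t
          1≤t = 1≤fromℕ (j ℕ.+ τ₀)
          1≤νt : 1# ≤ ν * t
          1≤νt = subst (_≤ ν * t) ν*n≡1 (*-monoˡ-≤ 0≤ν n≤t)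
          1≤νt² : 1# ≤ ν * t * t
          1≤νt² = ≤-trans 1≤νt (subst (_≤ ν * t * t) (*-identityʳ _) (*-monoˡ-≤ (≤-trans 0≤1 1≤νt) 1≤t))

        -- Regret arises at medium requests only, and either decision is an error with a probability
        -- bounded below by the same function of e. A sale moves e = 2k - τ by -1 and a skip by +1,
        -- whatever the request.
        online+regret≤offline : ∀ j → j ℕ.≤ J → ∀ k →
          online (j ℕ.+ τ₀) k + w * regret j (fromℕ 2 * fromℕ k - fromℕ (j ℕ.+ τ₀)) ≤ offline (j ℕ.+ τ₀) k
        online+regret≤offline zero j≤J k = subst (_≤ offline τ₀ k)
          (solve 4 (λ o w v e → o := o :+ w :* (:ℕ 3 :* :0 :- :ℕ 128 :* v :* :0 :* (e :* e) :- :ℕ 64 :* v :* (:0 :* :0))) refl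
            (online τ₀ k) w ν (fromℕ 2 * fromℕ k - fromℕ τ₀)) (online≤offline τ₀ k)
        online+regret≤offline (suc j) j<J zero = subst (_≤ 0#) (sym (+-identityˡ _)) (regret-empty j)
        online+regret≤offline (suc j) j<J (suc k) = bound (⊔-sel (1# + online τ k) (online τ (suc k)))
          where
          τ : ℕ
          τ = j ℕ.+ τ₀
          e O O′ A A′ H L : Carrier
          e = fromℕ 2 * fromℕ (suc k) - fromℕ (suc τ)
          O = offline τ k
          O′ = offline τ (suc k)
          A = w * regret j (e - 1#)
          A′ = w * regret j (e + 1#)
          H = high τ k
          L = low τ k
          j≤J : j ℕ.≤ J
          j≤J = ℕ.<⇒≤ j<J
          n≤τ : n ℕ.≤ τ
          n≤τ = ℕ.≤-trans n≤τ₀ (ℕ.m≤n+m τ₀ j)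
          τ≤2n : τ ℕ.≤ n ℕ.+ n
          τ≤2n = ℕ.≤-trans (ℕ.+-monoˡ-≤ τ₀ j≤J) J+τ₀≤2n
          after-sale : online τ k + A ≤ O
          after-sale = subst (λ x → online τ k + w * regret j x ≤ O)
            (solve 2 (λ k t → :ℕ 2 :* k :- t := :ℕ 2 :* (:1 :+ k) :- (:1 :+ t) :- :1) refl (fromℕ k) (fromℕ τ))
            (online+regret≤offline j j≤J k)
          after-skip : online τ (suc k) + A′ ≤ O′
          after-skip = subst (λ x → online τ (suc k) + w * regret j x ≤ O′)
            (solve 2 (λ k t → :ℕ 2 :* (:1 :+ k) :- t := :ℕ 2 :* (:1 :+ k) :- (:1 :+ t) :+ :1) refl (fromℕ k) (fromℕ τ))
            (online+regret≤offline j j≤J (suc k))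
          -- The thresholds of `high` and `low` are e + 1 and 1 - e, with squares at most 2e² + 2.
          high≥ : fromℕ 4 - fromℕ 64 * ν * (e * e) ≤ fromℕ 128 * H
          high≥ = tail-lower τ n≤τ τ≤2n _ e (square-nonNeg (e - 1#)
            ≤-via solve 2 (λ k t → let e = :ℕ 2 :* (:1 :+ k) :- (:1 :+ t) ; a = :ℕ 2 :* (:1 :+ k) :- t in
              :ℕ 2 :* (e :* e) :+ :ℕ 2 := a :* a :+ (e :- :1) :* (e :- :1)) refl (fromℕ k) (fromℕ τ))
          low≥ : fromℕ 4 - fromℕ 64 * ν * (e * e) ≤ fromℕ 128 * L
          low≥ = tail-lower τ n≤τ τ≤2n _ e (square-nonNeg (e + 1#)
            ≤-via solve 2 (λ k t → let e = :ℕ 2 :* (:1 :+ k) :- (:1 :+ t) ; a = t :- :ℕ 2 :* k in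
              :ℕ 2 :* (e :* e) :+ :ℕ 2 := a :* a :+ (e :+ :1) :* (e :+ :1)) refl (fromℕ k) (fromℕ τ))
          bound : (1# + online τ k) ⊔ online τ (suc k) ≡ 1# + online τ k ⊎ (1# + online τ k) ⊔ online τ (suc k) ≡ online τ (suc k) →
                  online (suc τ) (suc k) + w * regret (suc j) e ≤ offline (suc τ) (suc k)
          bound (inj₁ sold) = subst (λ x → h * (fromℕ 2 + online τ k) + h * online τ (suc k) + m * x + w * regret (suc j) e ≤ offline (suc τ) (suc k))
            (sym sold) (≤-trans
              (+-monoʳ-≤ _ (regret-step j j≤J e (e - 1#) H (inj₁ refl) high≥))
              (+-nonNeg (*-nonNeg 0≤h (0≤y-x after-sale)) (+-nonNeg (*-nonNeg 0≤h (0≤y-x after-skip)) (*-nonNeg 0≤m (0≤y-x after-sale)))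
                ≤-via trans (cong (h * (fromℕ 2 + O) + h * O′ +_) (cong (m *_) (trans
                    (solve 3 (λ o l H → o :+ l := (o :+ l :- H) :+ H) refl O′ L H) (cong (_+ H) (sym (sell-medium τ k))))))
                  (solve 9 (λ h m o o′ a a′ v v′ H →
                    h :* (:ℕ 2 :+ o) :+ h :* o′ :+ m :* (:1 :+ o :+ H)
                    := (h :* (:ℕ 2 :+ v) :+ h :* v′ :+ m :* (:1 :+ v) :+ (h :* a :+ h :* a′ :+ m :* (H :+ a)))
                      :+ (h :* (o :- (v :+ a)) :+ (h :* (o′ :- (v′ :+ a′)) :+ m :* (o :- (v :+ a))))) refl
                    h m O O′ A A′ (online τ k) (online τ (suc k)) H)))
          bound (inj₂ skipped) = subst (λ x → h * (fromℕ 2 + online τ k) + h * online τ (suc k) + m * x + w * regret (suc j) e ≤ offline (suc τ) (suc k))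
            (sym skipped) (≤-trans
              (+-monoʳ-≤ _ (regret-step j j≤J e (e + 1#) L (inj₂ refl) low≥))
              (+-nonNeg (*-nonNeg 0≤h (0≤y-x after-sale)) (+-nonNeg (*-nonNeg 0≤h (0≤y-x after-skip)) (*-nonNeg 0≤m (0≤y-x after-skip)))
                ≤-via solve 9 (λ h m o o′ a a′ v v′ l →
                    h :* (:ℕ 2 :+ o) :+ h :* o′ :+ m :* (o′ :+ l)
                    := (h :* (:ℕ 2 :+ v) :+ h :* v′ :+ m :* v′ :+ (h :* a :+ h :* a′ :+ m :* (l :+ a′)))
                      :+ (h :* (o :- (v :+ a)) :+ (h :* (o′ :- (v′ :+ a′)) :+ m :* (o′ :- (v′ :+ a′))))) refl
                    h m O O′ A A′ (online τ k) (online τ (suc k)) L))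

-- The hard instance, and its comparison with the two value functions.

data Kind : Set where
  high-price low-price medium-price : Kind

module HardInstance (ℛ : Reals) (h : Reals.Carrier ℛ) where
  open OrderedField ℛ
  open ATP ℛ
  open Expectation ℛ
  open Offline ℛ
  open ThreePrices ℛ h
  open Max totalOrder using (_⊔_; x≤x⊔y; x≤y⊔x)

  price : Kind → Carrier
  price high-price   = fromℕ 2
  price low-price    = 0#
  price medium-price = 1#

  price≥0 : ∀ κ → 0# ≤ price κ
  price≥0 high-price   = 0≤fromℕ 2
  price≥0 low-price    = ≤-refl
  price≥0 medium-price = 0≤1

  price≤2 : ∀ κ → price κ ≤ fromℕ 2
  price≤2 high-price   = ≤-refl
  price≤2 low-price    = 0≤fromℕ 2
  price≤2 medium-price = 1≤fromℕ 1

  request : Kind → Request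
  request κ = ⟨ ⊤⁺ , price κ ⟩

  -- The event H + M ≤ k, whose probability is `low n k`.
  sellable≤ : ∀ {n} → ℕ → Vec Kind n → Bool
  sellable≤ k       []               = true
  sellable≤ k       (low-price ∷ κs) = sellable≤ k κs
  sellable≤ zero    (_ ∷ κs)         = false
  sellable≤ (suc k) (_ ∷ κs)         = sellable≤ k κs

  -- A medium item is sold iff stock remains for all later high and medium ones.
  value : ∀ {n} → ℕ → Vec Kind n → Carrier
  value zero    _                   = 0#
  value (suc k) []                  = 0#
  value (suc k) (high-price ∷ κs)   = fromℕ 2 + value k κs
  value (suc k) (low-price ∷ κs)    = value (suc k) κs
  value (suc k) (medium-price ∷ κs) = value (suc k) κs + (if sellable≤ k κs then 1# else 0#)

  sellable≤-suc : ∀ {n} k (κs : Vec Kind n) → sellable≤ k κs ≡ true → sellable≤ (suc k) κs ≡ true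
  sellable≤-suc k       []                  _ = refl
  sellable≤-suc k       (low-price ∷ κs)    f = sellable≤-suc k κs f
  sellable≤-suc (suc k) (high-price ∷ κs)   f = sellable≤-suc k κs f
  sellable≤-suc (suc k) (medium-price ∷ κs) f = sellable≤-suc k κs f

  -- When k copies serve every later high and medium request, one more is worthless; selling it to
  -- the current medium request is then pure gain, as `value` presumes.
  value-saturated : ∀ {n} k (κs : Vec Kind n) → sellable≤ k κs ≡ true → value (suc k) κs ≡ value k κs
  value-saturated zero    []                  _ = refl
  value-saturated (suc k) []                  _ = refl
  value-saturated zero    (low-price ∷ κs)    f = value-saturated zero κs f
  value-saturated (suc k) (low-price ∷ κs)    f = value-saturated (suc k) κs f
  value-saturated (suc k) (high-price ∷ κs)   f = cong (fromℕ 2 +_) (value-saturated k κs f)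
  value-saturated (suc k) (medium-price ∷ κs) f = cong₂ (λ v b → v + (if b then 1# else 0#))
    (value-saturated (suc k) κs (sellable≤-suc k κs f)) (trans (sellable≤-suc k κs f) (sym f))

  value≤maxProfit : ∀ {n} B k (κs : Vec Kind n) → value k κs ≤ maxProfit B k (Vec.map request κs)
  value≤maxProfit B zero    κs                = maxProfit-nonNeg B zero (Vec.map request κs)
  value≤maxProfit B (suc k) []                = maxProfit-nonNeg B (suc k) []
  value≤maxProfit B (suc k) (high-price ∷ κs) = ≤-trans (+-monoʳ-≤ (fromℕ 2) (value≤maxProfit B k κs))
    (maxProfit-∷ B (suc k) (request high-price) (Vec.map request κs) sell (ℕ.s≤s ℕ.z≤n))
  value≤maxProfit B (suc k) (low-price ∷ κs)  = ≤-trans (value≤maxProfit B (suc k) κs)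
    (subst (_≤ maxProfit B (suc k) (request low-price ∷ Vec.map request κs)) (+-identityˡ _)
      (maxProfit-∷ B (suc k) (request low-price) (Vec.map request κs) skip tt))
  value≤maxProfit B (suc k) (medium-price ∷ κs) with sellable≤ k κs in f
  ... | true  = ≤-trans (≤-reflexive (trans (cong (_+ 1#) (value-saturated k κs f)) (+-comm _ 1#)))
    (≤-trans (+-monoʳ-≤ 1# (value≤maxProfit B k κs))
      (maxProfit-∷ B (suc k) (request medium-price) (Vec.map request κs) sell (ℕ.s≤s ℕ.z≤n)))
  ... | false = ≤-trans (≤-reflexive (trans (+-identityʳ _) (sym (+-identityˡ _))))
    (≤-trans (+-monoʳ-≤ 0# (value≤maxProfit B (suc k) κs))
      (maxProfit-∷ B (suc k) (request medium-price) (Vec.map request κs) skip tt))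

  gain≤2 : ∀ κ a → gain (request κ) a ≤ fromℕ 2
  gain≤2 κ buy  = 0≤fromℕ 2 ≤-via solve 0 (:ℕ 2 := :- :0 :+ :ℕ 2) refl
  gain≤2 κ sell = price≤2 κ
  gain≤2 κ skip = 0≤fromℕ 2

  profit≤2n : ∀ {n} (κs : Vec Kind n) as → profit (Vec.map request κs) as ≤ fromℕ 2 * fromℕ n
  profit≤2n [] [] = ≤-reflexive (sym (zeroʳ _))
  profit≤2n (κ ∷ κs) (a ∷ as) = ≤-trans (+-mono-≤ (gain≤2 κ a) (profit≤2n κs as))
    (≤-reflexive (solve 1 (λ n → :ℕ 2 :+ :ℕ 2 :* n := :ℕ 2 :* (:1 :+ n)) refl _))

  module _ (0≤h : 0# ≤ h) (0≤m : 0# ≤ m) where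
    kinds : FinDist Kind
    kinds = record
      { size = 3 ; outcome = λ { Fin.zero → high-price ; (Fin.suc Fin.zero) → low-price ; (Fin.suc (Fin.suc _)) → medium-price }
      ; prob = λ { Fin.zero → h ; (Fin.suc Fin.zero) → h ; (Fin.suc (Fin.suc _)) → m }
      ; prob≥0 = λ { Fin.zero → 0≤h ; (Fin.suc Fin.zero) → 0≤h ; (Fin.suc (Fin.suc _)) → 0≤m }
      ; sum-prob = solve 1 (λ h → h :+ (h :+ ((:1 :- (h :+ h)) :+ :0)) := :1) refl h }

    𝔼-kinds : ∀ f → 𝔼 kinds f ≡ h * f high-price + h * f low-price + m * f medium-price
    𝔼-kinds f = solve 3 (λ a b c → a :+ (b :+ (c :+ :0)) := a :+ b :+ c) refl
      (h * f high-price) (h * f low-price) (m * f medium-price)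

    𝔼-sellable≤ : ∀ n k → 𝔼-iid n kinds (λ κs → if sellable≤ k κs then 1# else 0#) ≡ low n k
    𝔼-sellable≤ zero    k       = sym (isNonPos-yes (*-nonNeg (0≤fromℕ 2) (0≤fromℕ k)
      ≤-via solve 1 (λ k → :0 := (:0 :- :ℕ 2 :* k) :+ :ℕ 2 :* k) refl (fromℕ k)))
    𝔼-sellable≤ (suc n) zero    = trans (𝔼-kinds (λ κ → 𝔼-iid n kinds (λ κs → if sellable≤ zero (κ ∷ κs) then 1# else 0#))) (trans
      (cong₂ (λ u v → h * u + h * v + m * u) (𝔼-iid-const n kinds 0#) (𝔼-sellable≤ n zero))
      (trans (solve 3 (λ h m l → h :* :0 :+ h :* l :+ m :* :0 := h :* l :+ (h :+ m) :* :0) refl h m (low n 0))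
        (sym (low-zero n))))
    𝔼-sellable≤ (suc n) (suc k) = trans (𝔼-kinds (λ κ → 𝔼-iid n kinds (λ κs → if sellable≤ (suc k) (κ ∷ κs) then 1# else 0#))) (trans
      (cong₂ (λ u v → h * u + h * v + m * u) (𝔼-sellable≤ n k) (𝔼-sellable≤ n (suc k)))
      (trans (solve 4 (λ h m l l′ → h :* l :+ h :* l′ :+ m :* l := h :* l′ :+ (h :+ m) :* l) refl h m (low n k) (low n (suc k)))
        (sym (low-suc n k))))

    𝔼-value : ∀ n k → 𝔼-iid n kinds (value k) ≡ offline n k
    𝔼-value zero    zero    = refl
    𝔼-value zero    (suc k) = refl
    𝔼-value (suc n) zero    = 𝔼-iid-const (suc n) kinds 0#
    𝔼-value (suc n) (suc k) = trans (𝔼-kinds (λ κ → 𝔼-iid n kinds (λ κs → value (suc k) (κ ∷ κs))))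
      (cong₂ _+_ (cong₂ (λ u v → h * u + h * v)
        (trans (𝔼-iid-+ n kinds (λ _ → fromℕ 2) (value k)) (cong₂ _+_ (𝔼-iid-const n kinds (fromℕ 2)) (𝔼-value n k)))
        (𝔼-value n (suc k)))
        (cong (m *_) (trans (𝔼-iid-+ n kinds (value (suc k)) (λ κs → if sellable≤ k κs then 1# else 0#))
          (cong₂ _+_ (𝔼-value n (suc k)) (𝔼-sellable≤ n k)))))

    module _ (n : ℕ) (1≤n : 1 ℕ.≤ n) where
      hardInstance : Instance n
      hardInstance = record
        { B = n ; T = n ℕ.+ n ; 𝒟 = mapDist request kinds
        ; 1≤B₀ = 1≤n ; B₀≤B = ℕ.≤-refl ; B₀≤T = ℕ.m≤m+n n n ; B≤B₀+T = ℕ.m≤m+n n (n ℕ.+ n)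
        ; buyPrice≥0 = λ _ → AddSupremum._≤⊤⁺ [ 0# ]
        ; sellPrice≥0 = λ i → price≥0 (outcome kinds i) }

      offline≤offlineProfit : offline (n ℕ.+ n) n ≤ offlineProfit hardInstance
      offline≤offlineProfit = subst₂ _≤_ (𝔼-value (n ℕ.+ n) n) (sym (𝔼-iid-map (n ℕ.+ n) request kinds (maxProfit n n)))
        (𝔼-iid-mono (n ℕ.+ n) kinds (value n) (λ κs → maxProfit n n (Vec.map request κs)) (value≤maxProfit n n))

      offlineProfit≤4n : offlineProfit hardInstance ≤ fromℕ 4 * fromℕ n
      offlineProfit≤4n = subst₂ _≤_ (sym (𝔼-iid-map (n ℕ.+ n) request kinds (maxProfit n n)))
        (trans (𝔼-iid-const (n ℕ.+ n) kinds _) (trans (cong (fromℕ 2 *_) (fromℕ-+ n n))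
          (solve 1 (λ n → :ℕ 2 :* (n :+ n) := :ℕ 4 :* n) refl (fromℕ n))))
        (𝔼-iid-mono (n ℕ.+ n) kinds (λ κs → maxProfit n n (Vec.map request κs)) (λ _ → fromℕ 2 * fromℕ (n ℕ.+ n)) bound)
        where
        bound : ∀ κs → maxProfit n n (Vec.map request κs) ≤ fromℕ 2 * fromℕ (n ℕ.+ n)
        bound κs with maxProfit-attained n n (Vec.map request κs)
        ... | as , _ , eq = subst (_≤ fromℕ 2 * fromℕ (n ℕ.+ n)) (sym eq) (profit≤2n κs as)

      module _ (A : OnlineAlgorithm hardInstance) where
        open OnlineAlgorithm A

        upper : ℕ → ℕ → Kind → Carrier
        upper t zero    _            = 0#
        upper t (suc k) high-price   = fromℕ 2 + online t k
        upper t (suc k) low-price    = online t (suc k)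
        upper t (suc k) medium-price = (1# + online t k) ⊔ online t (suc k)

        𝔼-upper : ∀ t k → 𝔼 kinds (upper t k) ≡ online (suc t) k
        𝔼-upper t zero    = 𝔼-const kinds 0#
        𝔼-upper t (suc k) = 𝔼-kinds (upper t (suc k))

        -- Monotonicity settles low requests, the Lipschitz bound high ones, and the maximum in
        -- `upper` medium ones; the price +∞ excludes buying.
        action≤upper : ∀ t k κ a → Allowed n k (request κ) a →
                       gain (request κ) a + online t (stock a k) ≤ upper t k κ
        action≤upper t k       κ            buy  (_ , finite) = contradiction refl finite
        action≤upper t (suc k) high-price   sell _ = ≤-refl
        action≤upper t (suc k) low-price    sell _ = subst (_≤ online t (suc k)) (sym (+-identityˡ _)) (online-mono 0≤h 0≤m t k)
        action≤upper t (suc k) medium-price sell _ = x≤x⊔y _ _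
        action≤upper t zero    κ            skip _ = ≤-reflexive (trans (+-identityˡ _) (online-zero t))
        action≤upper t (suc k) high-price   skip _ = subst (_≤ fromℕ 2 + online t k) (sym (+-identityˡ _)) (online-lipschitz 0≤h 0≤m t k)
        action≤upper t (suc k) low-price    skip _ = ≤-reflexive (+-identityˡ _)
        action≤upper t (suc k) medium-price skip _ = subst (_≤ upper t (suc k) medium-price) (sym (+-identityˡ _)) (x≤y⊔x _ _)

        -- A random action is no better than the best allowed one. Only actions of positive
        -- probability are known to be allowed, whence `𝔼-≤-const`.
        expectedProfitFrom≤online : ∀ H t → expectedProfitFrom hardInstance A H t ≤ online t (stockAfter n H)
        expectedProfitFrom≤online H zero    = ≤-refl
        expectedProfitFrom≤online H (suc t) = subst (expectedProfitFrom hardInstance A H (suc t) ≤_) (𝔼-upper t (stockAfter n H))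
          (𝔼-mono kinds (λ κ → 𝔼 (policy H (request κ)) (continuation κ))
            (upper t (stockAfter n H)) (λ i → step (outcome kinds i)))
          where
          continuation : Kind → Action → Carrier
          continuation κ a = gain (request κ) a + expectedProfitFrom hardInstance A ((request κ , a) ∷ H) t
          step : ∀ κ → 𝔼 (policy H (request κ)) (continuation κ)
                       ≤ upper t (stockAfter n H) κ
          step κ = 𝔼-≤-const (policy H (request κ)) (continuation κ) (upper t (stockAfter n H) κ) (λ i 0<p →
            let a = outcome (policy H (request κ)) i in ≤-trans
            (+-monoʳ-≤ (gain (request κ) a) (expectedProfitFrom≤online ((request κ , a) ∷ H) t))
            (action≤upper t (stockAfter n H) κ a (allowed H (request κ) i 0<p)))

-- Choice of the constants in (b).

module LowerTail (ℛ : Reals) where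
  open OrderedField ℛ
  open ATP ℛ
  open SquareRootLogarithm ℛ using (integer-√; k≤√n; ½)

  -- The regret is at least 2wJ with w = 1/(128·16(K+1)) ≥ 1/(128·32√n), while the offline profit is
  -- at most 4n ≤ 4·128J; the quotient is c/√n.
  c : Carrier
  c = (fromℕ 256 * (fromℕ 32 * fromℕ 128)) ⁻¹

  private
    0<256·32·128 : 0# < fromℕ 256 * (fromℕ 32 * fromℕ 128)
    0<256·32·128 = *-pos (0<fromℕ 255) (*-pos (0<fromℕ 31) (0<fromℕ 127))

  0<c : 0# < c
  0<c = ⁻¹-pos 0<256·32·128

  module _ (n : ℕ) (64≤n : 64 ℕ.≤ n) where
    private
      K J : ℕ
      K = proj₁ (integer-√ n)
      -- Then 64νJ² ≤ J, and n ≥ 64 ensures J ≥ 1.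
      J = n ℕ./ 64

      1≤n : 1 ℕ.≤ n
      1≤n = ℕ.≤-trans (ℕ.s≤s ℕ.z≤n) 64≤n

      K²≤n : K ℕ.* K ℕ.≤ n
      K²≤n = proj₁ (proj₂ (integer-√ n))

      n<[1+K]² : n ℕ.< suc K ℕ.* suc K
      n<[1+K]² = proj₂ (proj₂ (integer-√ n))

      1≤K : 1 ℕ.≤ K
      1≤K with K in K≡ | n<[1+K]²
      ... | zero  | n<1 = contradiction (ℕ.≤-trans 1≤n (ℕ.s≤s⁻¹ n<1)) λ ()
      ... | suc _ | _   = ℕ.s≤s ℕ.z≤n

      μ h : Carrier
      -- As n ≤ (K+1)², this gives 256nμ² ≤ 1; K ≥ 1 gives 32μ ≤ 1.
      μ = (fromℕ 16 * fromℕ (suc K)) ⁻¹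
      h = ½ * (1# - μ)

      0<16[1+K] : 0# < fromℕ 16 * fromℕ (suc K)
      0<16[1+K] = *-pos (0<fromℕ 15) (0<fromℕ K)

      16[1+K]μ≡1 : fromℕ 16 * fromℕ (suc K) * μ ≡ 1#
      16[1+K]μ≡1 = *-inverse 0<16[1+K]

      0<μ : 0# < μ
      0<μ = ⁻¹-pos 0<16[1+K]

      32μ≤1 : fromℕ 32 * μ ≤ 1#
      32μ≤1 = *-nonNeg (*-nonNeg (0≤fromℕ 16) (0≤y-x (fromℕ-mono (ℕ.s≤s 1≤K)))) (<⇒≤ 0<μ)
        ≤-via trans (sym 16[1+K]μ≡1) (solve 2 (λ k u → :ℕ 16 :* k :* u := :ℕ 32 :* u :+ :ℕ 16 :* (k :- :ℕ 2) :* u) refl (fromℕ (suc K)) μ)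

      μ≤1 : μ ≤ 1#
      μ≤1 = ≤-trans (*-nonNeg (0≤fromℕ 31) (<⇒≤ 0<μ) ≤-via solve 1 (λ u → :ℕ 32 :* u := u :+ :ℕ 31 :* u) refl μ) 32μ≤1

      0≤h : 0# ≤ h
      0≤h = *-nonNeg (⁻¹-nonNeg (0<fromℕ 1)) (0≤y-x μ≤1)

      m≡μ : 1# - (h + h) ≡ μ
      m≡μ = trans (solve 2 (λ i u → :1 :- (i :* (:1 :- u) :+ i :* (:1 :- u)) := :1 :- :ℕ 2 :* i :* (:1 :- u)) refl ½ μ)
        (trans (cong (λ t → 1# - t * (1# - μ)) (*-inverse (0<fromℕ 1))) (solve 1 (λ u → :1 :- :1 :* (:1 :- u) := u) refl μ))

      m : Carrier
      m = 1# - (h + h)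

      0≤m : 0# ≤ m
      0≤m = subst (0# ≤_) (sym m≡μ) (<⇒≤ 0<μ)

      256nm²≤1 : fromℕ 256 * (fromℕ n * (m * m)) ≤ 1#
      256nm²≤1 = subst (λ t → fromℕ 256 * (fromℕ n * (t * t)) ≤ 1#) (sym m≡μ)
        (*-nonNeg (0≤fromℕ 256) (*-nonNeg (0≤y-x n≤[1+K]²) (square-nonNeg μ)) ≤-via trans
          (trans (sym (*-identityˡ 1#)) (sym (cong₂ _*_ 16[1+K]μ≡1 16[1+K]μ≡1)))
          (solve 3 (λ k u n → :ℕ 16 :* k :* u :* (:ℕ 16 :* k :* u) := :ℕ 256 :* (n :* (u :* u)) :+ :ℕ 256 :* ((k :* k :- n) :* (u :* u)))
            refl (fromℕ (suc K)) μ (fromℕ n)))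
        where
        n≤[1+K]² : fromℕ n ≤ fromℕ (suc K) * fromℕ (suc K)
        n≤[1+K]² = subst (fromℕ n ≤_) (fromℕ-* (suc K) (suc K)) (fromℕ-mono (ℕ.<⇒≤ n<[1+K]²))

      0<n : 0# < fromℕ n
      0<n = <-≤-trans (0<fromℕ 63) (fromℕ-mono 64≤n)

      ν : Carrier
      ν = fromℕ n ⁻¹

      νn≡1 : ν * fromℕ n ≡ 1#
      νn≡1 = trans (*-comm _ _) (*-inverse 0<n)

      64J≤n : 64 ℕ.* J ℕ.≤ n
      64J≤n = ℕ.≤-trans (ℕ.≤-reflexive (ℕ.*-comm 64 J)) (ℕ.m/n*n≤m n 64)

      J≤n : J ℕ.≤ n
      J≤n = ℕ.m/n≤m n 64

      1≤J : 1 ℕ.≤ J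
      1≤J = ℕ.m≥n⇒m/n>0 64≤n

      n≤128J : n ℕ.≤ 128 ℕ.* J
      n≤128J = ℕ.≤-trans (ℕ.≤-reflexive (ℕ.m≡m%n+[m/n]*n n 64)) (ℕ.≤-trans
        (ℕ.+-mono-≤ (ℕ.≤-trans (ℕ.<⇒≤ (ℕ.m%n<n n 64)) (ℕ.*-monoʳ-≤ 64 1≤J)) (ℕ.≤-reflexive (ℕ.*-comm J 64)))
        (ℕ.≤-reflexive (sym (ℕ.*-distribʳ-+ J 64 64))))

      0≤ν : 0# ≤ ν
      0≤ν = ⁻¹-nonNeg 0<n

      64νJ≤1 : fromℕ 64 * ν * fromℕ J ≤ 1#
      64νJ≤1 = subst₂ _≤_ (trans (cong (ν *_) (fromℕ-* 64 J)) (solve 3 (λ a v j → v :* (a :* j) := a :* v :* j) refl (fromℕ 64) ν (fromℕ J)))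
        νn≡1 (*-monoˡ-≤ 0≤ν (fromℕ-mono 64J≤n))

      νJ≤1 : ν * fromℕ J ≤ 1#
      νJ≤1 = subst (ν * fromℕ J ≤_) νn≡1 (*-monoˡ-≤ 0≤ν (fromℕ-mono J≤n))

      256νJ²m²≤1 : fromℕ 256 * ν * (fromℕ J * m * (fromℕ J * m)) ≤ 1#
      256νJ²m²≤1 = subst₂ _≤_
        (solve 4 (λ a v j m → v :* j :* (a :* (j :* (m :* m))) := a :* v :* (j :* m :* (j :* m))) refl (fromℕ 256) ν (fromℕ J) m)
        (*-identityˡ 1#)
        (*-mono-≤ (*-nonNeg 0≤ν (0≤fromℕ J)) 0≤1 νJ≤1 (≤-trans
          (*-monoˡ-≤ (0≤fromℕ 256) (subst₂ _≤_ (*-comm _ _) (*-comm _ _) (*-monoˡ-≤ (square-nonNeg m) (fromℕ-mono J≤n)))) 256nm²≤1))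

      w : Carrier
      w = μ * fromℕ 128 ⁻¹

      0<w : 0# < w
      0<w = *-pos 0<μ (⁻¹-pos (0<fromℕ 127))

      128w≡μ : fromℕ 128 * w ≡ μ
      128w≡μ = trans (solve 3 (λ a u i → a :* (u :* i) := u :* (a :* i)) refl (fromℕ 128) μ (fromℕ 128 ⁻¹))
        (trans (cong (μ *_) (*-inverse (0<fromℕ 127))) (*-identityʳ μ))

      τ₀ : ℕ
      τ₀ = n ℕ.+ n ℕ.∸ J

      J+τ₀≡2n : J ℕ.+ τ₀ ≡ n ℕ.+ n
      J+τ₀≡2n = ℕ.m+[n∸m]≡n (ℕ.≤-trans J≤n (ℕ.m≤m+n n n))

      n≤τ₀ : n ℕ.≤ τ₀
      n≤τ₀ = ℕ.≤-trans (ℕ.≤-reflexive (sym (ℕ.m+n∸n≡m n n))) (ℕ.∸-monoʳ-≤ (n ℕ.+ n) J≤n)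

    open HardInstance ℛ h using (hardInstance; offline≤offlineProfit; offlineProfit≤4n; expectedProfitFrom≤online)
    open ThreePrices ℛ h using (online; offline; online-nonNeg; online+regret≤offline)

    hard : Instance n
    hard = hardInstance 0≤h 0≤m n 1≤n

    private
      OPT V : Carrier
      OPT = offlineProfit hard
      V = online (n ℕ.+ n) n

      -- The start is balanced: k = n and τ = 2n give e = 0, so the regret is w(3J - 64νJ²) ≥ 2wJ.
      V+2wJ≤OPT : V + w * (fromℕ 2 * fromℕ J) ≤ OPT
      V+2wJ≤OPT = ≤-trans (≤-trans
        (*-nonNeg (<⇒≤ 0<w) (*-nonNeg (0≤fromℕ J) (0≤y-x 64νJ≤1)) ≤-via
          solve 5 (λ V w j v n → V :+ w :* (:ℕ 3 :* j :- :ℕ 128 :* v :* j :* ((:ℕ 2 :* n :- (n :+ n)) :* (:ℕ 2 :* n :- (n :+ n))) :- :ℕ 64 :* v :* (j :* j))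
            := V :+ w :* (:ℕ 2 :* j) :+ w :* (j :* (:1 :- :ℕ 64 :* v :* j))) refl V w (fromℕ J) ν (fromℕ n))
        (subst₂ (λ t u → online t n + w * (fromℕ 3 * fromℕ J - fromℕ 128 * ν * fromℕ J * ((fromℕ 2 * fromℕ n - u) * (fromℕ 2 * fromℕ n - u))
              - fromℕ 64 * ν * (fromℕ J * fromℕ J)) ≤ offline t n)
          J+τ₀≡2n (trans (cong fromℕ J+τ₀≡2n) (fromℕ-+ n n))
          (online+regret≤offline 0≤h 0≤m n (ℕ.≤-trans (ℕ.m≤m+n 16 48) 64≤n) νn≡1 (subst (λ t → fromℕ 32 * t ≤ 1#) (sym m≡μ) 32μ≤1) 256nm²≤1
            J 256νJ²m²≤1 (<⇒≤ 0<w) (trans 128w≡μ (sym m≡μ)) τ₀ n≤τ₀ (ℕ.≤-reflexive J+τ₀≡2n) J ℕ.≤-refl n)))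
        (offline≤offlineProfit 0≤h 0≤m n 1≤n)

      0<√ : 0# < √ n
      0<√ = <-≤-trans 0<1 (subst (_≤ √ n) fromℕ-1 (k≤√n {1} {n} 1≤n))

      1≤32·128√w : 1# ≤ √ n * (fromℕ 32 * fromℕ 128) * w
      1≤32·128√w = *-nonNeg (*-nonNeg (0≤fromℕ 16) (0≤y-x 1+K≤2√n)) (<⇒≤ 0<μ) ≤-via trans
        (solve 4 (λ s a b w → s :* (a :* b) :* w := s :* (a :* (b :* w))) refl (√ n) (fromℕ 32) (fromℕ 128) w)
        (trans (cong (λ t → √ n * (fromℕ 32 * t)) 128w≡μ)
        (trans (solve 3 (λ s k u → s :* (:ℕ 32 :* u) := :ℕ 16 :* k :* u :+ :ℕ 16 :* (:ℕ 2 :* s :- k) :* u) refl (√ n) (fromℕ (suc K)) μ)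
          (cong (_+ fromℕ 16 * (fromℕ 2 * √ n - fromℕ (suc K)) * μ) 16[1+K]μ≡1)))
        where
        1+K≤2√n : fromℕ (suc K) ≤ fromℕ 2 * √ n
        1+K≤2√n = ≤-trans (fromℕ-mono (ℕ.+-monoˡ-≤ K 1≤K)) (subst (_≤ fromℕ 2 * √ n)
          (trans (solve 1 (λ k → :ℕ 2 :* k := k :+ k) refl (fromℕ K)) (sym (fromℕ-+ K K)))
          (*-monoˡ-≤ (0≤fromℕ 2) (k≤√n {K} {n} K²≤n)))

      256c/√≤w : fromℕ 256 * (c / √ n) ≤ w
      256c/√≤w = *-cancelˡ-≤ (*-pos 0<√ (*-pos (0<fromℕ 31) (0<fromℕ 127))) (subst (_≤ √ n * (fromℕ 32 * fromℕ 128) * w)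
        (sym (trans (solve 5 (λ s p a c i → s :* p :* (a :* (c :* i)) := (s :* i) :* (a :* p :* c)) refl (√ n) (fromℕ 32 * fromℕ 128) (fromℕ 256) c (√ n ⁻¹))
          (trans (cong₂ _*_ (*-inverse 0<√) (*-inverse 0<256·32·128)) (*-identityˡ 1#))))
        1≤32·128√w)

      lossBound : c / √ n * OPT ≤ w * (fromℕ 2 * fromℕ J)
      lossBound = ≤-trans (*-monoˡ-≤ (*-nonNeg (<⇒≤ 0<c) (⁻¹-nonNeg 0<√)) (≤-trans (offlineProfit≤4n 0≤h 0≤m n 1≤n)
          (*-monoˡ-≤ (0≤fromℕ 4) (subst (fromℕ n ≤_) (fromℕ-* 128 J) (fromℕ-mono n≤128J)))))
        (*-nonNeg (*-nonNeg (0≤fromℕ 2) (0≤fromℕ J)) (0≤y-x 256c/√≤w) ≤-via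
          solve 3 (λ t w j → w :* (:ℕ 2 :* j) := t :* (:ℕ 4 :* (:ℕ 128 :* j)) :+ :ℕ 2 :* j :* (w :- :ℕ 256 :* t)) refl (c / √ n) w (fromℕ J))

    hard-offline-pos : 0# < offlineProfit hard
    hard-offline-pos = <-≤-trans (*-pos 0<w (*-pos (0<fromℕ 1) (<-≤-trans 0<1 (subst (_≤ fromℕ J) fromℕ-1 (fromℕ-mono 1≤J)))))
      (≤-trans (online-nonNeg 0≤h 0≤m (n ℕ.+ n) n ≤-via +-comm _ _) V+2wJ≤OPT)

    hard-online : (A : OnlineAlgorithm hard) → onlineProfit hard A ≤ (1# - c / √ n) * offlineProfit hard
    hard-online A = ≤-trans (expectedProfitFrom≤online 0≤h 0≤m n 1≤n A [] (n ℕ.+ n))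
      (+-nonNeg (0≤y-x V+2wJ≤OPT) (0≤y-x lossBound) ≤-via
        solve 4 (λ V g t o → (:1 :- t) :* o := V :+ ((o :- (V :+ g)) :+ (g :- t :* o))) refl V (w * (fromℕ 2 * fromℕ J)) (c / √ n) OPT)

theorem1p4 : (ℛ : Reals) → let open Reals ℛ in let open ATP ℛ in
    (Σ[ C ∈ Carrier ] (0# < C ×
    ((B₀ : ℕ) → 2 ℕ.≤ B₀ → (I : Instance B₀) →
    Σ[ A ∈ OnlineAlgorithm I ]
    (1# - C * (log B₀ / √ B₀)) * offlineProfit I ≤ onlineProfit I A)))
    ×
    (Σ[ c ∈ Carrier ] Σ[ n₀ ∈ ℕ ] (0# < c ×
    ((B₀ : ℕ) → n₀ ℕ.≤ B₀ →
    Σ[ I ∈ Instance B₀ ] (0# < offlineProfit I ×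
    ((A : OnlineAlgorithm I) →
    onlineProfit I A ≤ (1# - c / √ B₀) * offlineProfit I)))))
theorem1p4 ℛ =
  (fromℕ 12 , 0<fromℕ 11 , competitive) ,
  (c , 64 , 0<c , λ B₀ 64≤B₀ → hard B₀ 64≤B₀ , hard-offline-pos B₀ 64≤B₀ , hard-online B₀ 64≤B₀)
  where
  open OrderedField ℛ using (fromℕ; 0<fromℕ)
  open UpperTail ℛ using (competitive)
  open LowerTail ℛ using (c; 0<c; hard; hard-offline-pos; hard-online)
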